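{- For every positive integer $k$, in $\mathbb C[[\mathbf t]]$, \[ \sum_{n\ge0}\sum_{\underline\mu\vdash n}\frac{\mathrm{sroots}_k^{B_n}(\underline\mu)}{|Z_{\underline\mu}|}\,\mathbf t^{\mathbf c(\underline\mu)}=\exp\Big(\sum_{j\ge1}\sum_{\theta\in\mathbb Z_2}\sum_{\substack{h\mid k\\ \gcd(h,j)=1}}\frac{t_{j,\theta}^{jk/h}}{2jk/h}\,\mathrm{sroots}_h^{\mathbb Z_2}(\theta)\Big), \] where $h$ runs over positive divisors of $k$.
   Context: $B_n$ is the group of bijections $w$ of $\{\pm1,\dots,\pm n\}$ with $w(-i)=-w(i)$; $\chi(w)=\prod_{i=1}^n\mathrm{sign}(w(i))$, and $\mathrm{sroots}_k^{B_n}(y)=\sum_{x\in B_n,\,x^k=y}\chi(x)$. Cycles: if $c$ is a cycle of $w$ on $\{\pm1,\dots,\pm n\}$ of length $\ell$, so is $\bar c$ (negated entries); if $c\ne\bar c$, $c\bar c$ is a cycle of length $\ell$ and class $+1$; if $c=\bar c$, a cycle of length $\ell/2$ and class $-1$. Conjugacy classes are indexed by bipartitions $\underline\mu=(\mu^+,\mu^-)\vdash n$ ($\mu^\theta$ = lengths of cycles of class $\theta$); $b_{j,\theta}$ is the number of parts $j$ of $\mu^\theta$; $\mathbf t^{\mathbf c(\underline\mu)}=\prod_{j,\theta}t_{j,\theta}^{jb_{j,\theta}}$ with indeterminates $t_{j,\theta}$. $\mathrm{sroots}_k^{B_n}(\underline\mu)$ is the value at an element of class $\underline\mu$, $|Z_{\underline\mu}|$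 its centralizer order. $\mathbb Z_2=\{\pm1\}$ and $\mathrm{sroots}_h^{\mathbb Z_2}(\theta)=\sum_{\varepsilon\in\mathbb Z_2,\,\varepsilon^h=\theta}\varepsilon$. -}

module Defs where

open import Data.Bool using (Bool; true; false; not; _∧_; _∨_; _xor_; if_then_else_; T)
open import Data.Nat as ℕ using (ℕ; zero; suc; _∸_; _!; _≡ᵇ_)
open import Data.Nat.Divisibility using (_∣?_)
open import Data.Bool.ListAction using (all; any)
open import Data.Nat.GCD using (gcd)
open import Data.Fin as Fin using (Fin)
open import Data.Product using (_×_; _,_; proj₁; proj₂)
open import Data.List as L using (List; []; _∷_; map; foldr; upTo; allFin; filter; concatMap; length; zipWith)
open import Data.Vec as V using (Vec; lookup; tabulate)
open import Data.Integer as ℤ using (ℤ; +_; -_)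
open import Data.Rational as ℚ using (ℚ; 0ℚ; 1ℚ)
open import Relation.Nullary.Decidable using (⌊_⌋)
open import Relation.Binary.PropositionalEquality using (_≡_)

-- x / d in ℚ, with the (never used) convention x / 0 = 0
divℚ : ℤ → ℕ → ℚ
divℚ p zero    = 0ℚ
divℚ p (suc d) = p ℚ./ suc d

sumℚ : List ℚ → ℚ
sumℚ = foldr ℚ._+_ 0ℚ

sumℤ : List ℤ → ℤ
sumℤ = foldr ℤ._+_ (+ 0)

sumℕ : List ℕ → ℕ
sumℕ = foldr ℕ._+_ 0

_·s_ : Bool → Bool → Bool
s ·s t = not (s xor t)

signℤ : Bool → ℤ
signℤ true  = + 1
signℤ false = - (+ 1)

-- The hyperoctahedral group B_n.
-- The set {±1,…,±n} is encoded as Fin n × Bool : (i , s) stands for s·(i+1).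
-- An element w ∈ B_n is determined by its values on 1,…,n (since
-- w(-i) = -w(i)); we store them in a vector: lookup w i = w(i+1).
-- Such a vector defines a bijection of {±1,…,±n} iff the underlying
-- map i ↦ |w(i)| is injective (hence bijective) on Fin n.

SVec : ℕ → Set
SVec n = Vec (Fin n × Bool) n

eqPt : ∀ {n} → Fin n × Bool → Fin n × Bool → Bool
eqPt (i , s) (j , t) = ⌊ i Fin.≟ j ⌋ ∧ not (s xor t)

eqSV : ∀ {n} → SVec n → SVec n → Bool
eqSV {n} v w = all (λ i → eqPt (lookup v i) (lookup w i)) (allFin n)

isSigned : ∀ {n} → SVec n → Bool
isSigned {n} v =
  all (λ i → all (λ j → not ⌊ proj₁ (lookup v i) Fin.≟ proj₁ (lookup v j) ⌋ ∨ ⌊ i Fin.≟ j ⌋)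
                 (allFin n))
      (allFin n)

InB : ∀ {n} → SVec n → Set
InB v = T (isSigned v)

allVecs : {A : Set} → List A → (n : ℕ) → List (Vec A n)
allVecs xs zero    = V.[] ∷ []
allVecs xs (suc n) = concatMap (λ x → map (x V.∷_) (allVecs xs n)) xs

allPts : (n : ℕ) → List (Fin n × Bool)
allPts n = concatMap (λ i → (i , true) ∷ (i , false) ∷ []) (allFin n)

elemsB : (n : ℕ) → List (SVec n)
elemsB n = filter (λ v → T? (isSigned v)) (allVecs (allPts n) n)
  where
  open import Relation.Nullary.Decidable using () renaming (T? to T?)

act : ∀ {n} → SVec n → Fin n × Bool → Fin n × Bool
act w (i , s) with lookup w i
... | (p , t) = (p , s ·s t)

_∘B_ : ∀ {n} → SVec n → SVec n → SVec n
w ∘B x = tabulate (λ i → act w (lookup x i))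

idB : ∀ {n} → SVec n
idB = tabulate (λ i → (i , true))

_^B_ : ∀ {n} → SVec n → ℕ → SVec n
x ^B zero  = idB
x ^B suc k = x ∘B (x ^B k)

χ : ∀ {n} → SVec n → ℤ
χ {n} w = foldr ℤ._*_ (+ 1) (map (λ i → signℤ (proj₂ (lookup w i))) (allFin n))

srootsB : (k : ℕ) → ∀ {n} → SVec n → ℤ
srootsB k {n} y = sumℤ (map χ (filter (λ x → T? (eqSV (x ^B k) y)) (elemsB n)))
  where
  open import Relation.Nullary.Decidable using () renaming (T? to T?)

centralizerOrder : ∀ {n} → SVec n → ℕ
centralizerOrder {n} y = length (filter (λ x → T? (eqSV (x ∘B y) (y ∘B x))) (elemsB n))
  where
  open import Relation.Nullary.Decidable using () renaming (T? to T?)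

iter : ∀ {n} → SVec n → ℕ → Fin n × Bool → Fin n × Bool
iter w zero    p = p
iter w (suc r) p = act w (iter w r p)

-- length of the cycle c of w (on {±1,…,±n}) containing +(i+1):
-- least r ∈ [1, 2n] with w^r(+(i+1)) = +(i+1)   (every orbit has size ≤ 2n)
cycLen : ∀ {n} → SVec n → Fin n → ℕ
cycLen {n} w i = go (ℕ._*_ 2 n) 1
  where
  go : ℕ → ℕ → ℕ
  go zero    r = r
  go (suc b) r = if eqPt (iter w r (i , true)) (i , true) then r else go b (suc r)

selfConj : ∀ {n} → SVec n → Fin n → Bool
selfConj {n} w i = any (λ r → eqPt (iter w r (i , true)) (i , false)) (upTo (ℕ._*_ 2 n))

-- the B_n-cycle through ±(i+1): (length , class) where class true = +1, false = -1
-- c ≠ c̄ : c c̄ has length ℓ(c), class +1 ;  c = c̄ : length ℓ(c)/2, class -1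
cycleOf : ∀ {n} → SVec n → Fin n → ℕ × Bool
cycleOf w i = if selfConj w i then (cycLen w i ℕ./ 2 , false) else (cycLen w i , true)

-- Monomials in the indeterminates t_{j,θ} (j ≥ 1, θ ∈ ℤ₂ ≅ Bool).
-- A monomial is a list whose (j-1)-th entry is (exponent of t_{j,+1} , exponent of t_{j,-1});
-- missing entries are exponent 0.
Mono : Set
Mono = List (ℕ × ℕ)

expo : Mono → ℕ → Bool → ℕ
expo []             _       _     = 0
expo (_ ∷ _)        zero    _     = 0
expo ((a , b) ∷ m)  (suc zero) θ  = if θ then a else b
expo (_ ∷ m)        (suc (suc j)) θ = expo m (suc j) θ

deg : Mono → ℕ
deg m = sumℕ (map (λ e → proj₁ e ℕ.+ proj₂ e) m)

SameMono : Mono → Mono → Set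
SameMono m m' = ∀ j θ → expo m j θ ≡ expo m' j θ

-- t^{c(μ)} for the class μ of w : exponent of t_{j,θ} is j·b_{j,θ}, i.e. the number of
-- i ∈ {1,…,n} lying (up to sign) in a B_n-cycle of w of length j and class θ.
countCyc : ∀ {n} → SVec n → ℕ → Bool → ℕ
countCyc {n} w j θ =
  length (filter (λ i → T? ((proj₁ (cycleOf w i) ≡ᵇ j) ∧ not (proj₂ (cycleOf w i) xor θ))) (allFin n))
  where
  open import Relation.Nullary.Decidable using () renaming (T? to T?)

typeMono : ∀ {n} → SVec n → Mono
typeMono {n} w = map (λ j′ → (countCyc w (suc j′) true , countCyc w (suc j′) false)) (upTo n)

-- Formal power series in the t_{j,θ} with rational coefficients,
-- given by their coefficient functions on monomials.
PS : Set
PS = Mono → ℚ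

divisorsM : Mono → List Mono
divisorsM []            = [] ∷ []
divisorsM ((a , b) ∷ m) =
  concatMap (λ a′ → concatMap (λ b′ → map ((a′ , b′) ∷_) (divisorsM m)) (upTo (suc b)))
            (upTo (suc a))

quotM : Mono → Mono → Mono
quotM = zipWith (λ e d → (proj₁ e ∸ proj₁ d , proj₂ e ∸ proj₂ d))

onePS : PS
onePS m = if deg m ≡ᵇ 0 then 1ℚ else 0ℚ

_*PS_ : PS → PS → PS
(f *PS g) m = sumℚ (map (λ d → f d ℚ.* g (quotM m d)) (divisorsM m))

powPS : PS → ℕ → PS
powPS f zero    = onePS
powPS f (suc r) = f *PS powPS f r

-- exp f = Σ_{r ≥ 0} f^r / r!  (for f without constant term only r ≤ deg m contributes to [m])
expPS : PS → PS
expPS f m = sumℚ (map (λ r → powPS f r m ℚ.* divℚ (+ 1) (r !)) (upTo (suc (deg m))))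

_^Z2_ : Bool → ℕ → Bool
ε ^Z2 zero  = true
ε ^Z2 suc h = ε ·s (ε ^Z2 h)

srootsZ2 : ℕ → Bool → ℤ
srootsZ2 h θ = sumℤ (map signℤ (filter (λ ε → T? (not ((ε ^Z2 h) xor θ))) (true ∷ false ∷ [])))
  where
  open import Relation.Nullary.Decidable using () renaming (T? to T?)

-- The exponent of the right-hand side:
-- Σ_{j ≥ 1} Σ_{θ} Σ_{h ∣ k, gcd(h,j)=1} t_{j,θ}^{jk/h} / (2jk/h) · sroots_h^{ℤ₂}(θ),
-- as a coefficient function.  A term t_{j,θ}^{d} can only match m if t_{j,θ} occurs in m,
-- so only j ≤ length m contribute; h runs over 1,…,k.
rhsExponent : ℕ → PS
rhsExponent k m =
  sumℚ (map (λ j′ → let j = suc j′ in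
    sumℚ (map (λ θ →
      sumℚ (map (λ h′ → let h = suc h′ ; d = ℕ._*_ j (k ℕ./ h) in
        if ⌊ h ∣? k ⌋ ∧ (gcd h j ≡ᵇ 1) ∧ (expo m j θ ≡ᵇ d) ∧ (deg m ≡ᵇ d)
        then divℚ (srootsZ2 h θ) (ℕ._*_ 2 d) else 0ℚ)
        (upTo k)))
      (true ∷ false ∷ [])))
    (upTo (length m)))

rhsPS : ℕ → PS
rhsPS k = expPS (rhsExponent k)

{-# OPTIONS --safe #-}
{-
Removing a point p from a signed permutation x, by bypassing it in its cycle, gives a signed
permutation on one point fewer; conversely p is inserted either as a new cycle ±(p) or, with one
of two signs, just before any remaining point c, and the latter lengthens the cycle of c by one and
preserves its class and χ.  Iterating the removal of a marked point peels off its whole cycle.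

Summed over B_n with the weight χ(x) and the monomial of xᵏ, where a cycle of x of type (ℓ , ε)
contributes t_{j,θ}^ℓ with (j , θ) = (ℓ / gcd(ℓ,k) , ε^{k / gcd(ℓ,k)}), this says that the averages
U_n over B_n satisfy n U_n = Σ_ℓ ½ Σ_ε ε t_{j,θ}^ℓ U_{n-ℓ}.  If F is the given exponent, exp F satisfies
the same recursion, because the Euler derivation D gives D (exp F) = (D F) exp F.

Removing equally typed points from two elements also shows, by induction, that elements of equal
cycle type are conjugate; counting the pairs (x , z) with xᵏ = z y z⁻¹ then turns the coefficient
of U_n at the type of y into sroots_k(y) / |Z_y|.
-}
module Submission where

open import Defs
open import Data.Nat using (ℕ; _≤_)
open import Data.Product using (_×_; Σ)
open import Data.Rational using (0ℚ)
open import Relation.Binary.PropositionalEquality using (_≡_)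
open import Relation.Nullary using (¬_)

-- Deleting a whole cycle at once would require choosing subsets and renumbering `Fin n`. Deleting
-- one point is an elementary bijection, but what remains no longer shows how much of the cycle is
-- gone. The `r` missing points are therefore kept as phantoms: the marked cycle is counted, and
-- typed, as if it still had them. A removal inside a cycle trades a point for a phantom, and only
-- the closing step, at a point fixed up to sign, produces a factor t_{j,θ}^ℓ. In |B_{n+1}| =
-- 2(n+1)|B_n| the n+1 cancels the choice of the removed point; the 2 cancels the two equal signs
-- when the cycle goes on, and stays behind as the ½ when it closes.
--
-- All types are read off from x and pushed through a map V of types: deleting a point of x is no
-- single deletion in xᵏ, so xᵏ is never taken apart.
--
-- Distinct bipartitions have distinct monomials, so on the left a coefficient is the term of at
-- most one class. Hence the identity takes the shape of a value at each class monomial together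
-- with vanishing at the monomials of no class.

module CycleTypes where

  open import Data.Bool using (Bool; true; false; not; _∨_; T)
  open import Data.Empty using (⊥-elim)
  open import Data.Unit using (tt)
  open import Data.Nat as ℕ using (ℕ; zero; suc; _+_; _*_; _≤_; _<_; z≤n; s≤s; NonZero; >-nonZero)
  import Data.Nat.Properties as ℕ
  open import Data.Nat.DivMod using (_/_; _%_; m≡m%n+[m/n]*n; m%n<n; m*n/n≡m)
  open import Data.Nat.GCD using (gcd; gcd[m,n]∣m; gcd[m,n]∣n; gcd-greatest; gcd[m,n]≢0)
  open import Data.Nat.Divisibility using (_∣_; divides; quotient; *-monoˡ-∣; *-cancelʳ-∣; ∣1⇒≡1; ∣⇒≤; module _∣_)
  open import Data.Nat.Coprimality using (Coprime; coprime-divisor)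
  open import Data.Fin as Fin using (Fin)
  open import Data.Product
  open import Data.Sum using (inj₁; inj₂)
  open import Data.List using (upTo; allFin)
  open import Data.List.Membership.Propositional using (lose)
  open import Data.List.Membership.Propositional.Properties using (∈-upTo⁺; ∈-allFin)
  open import Data.List.Relation.Unary.Any.Properties using (any⁺; any⁻)
  open import Data.List.Relation.Unary.Any using (satisfied)
  open import Data.List.Relation.Unary.All as All using (All)
  open import Data.List.Relation.Unary.All.Properties using (all⁺; all⁻)
  open import Data.Vec using (lookup)
  open import Data.Vec.Properties using (lookup∘tabulate; tabulate-cong; tabulate∘lookup)
  open import Relation.Binary.PropositionalEquality
  open import Relation.Binary.Definitions using (tri<; tri≈; tri>)
  open import Relation.Nullary
  open import Relation.Nullary.Decidable using (⌊_⌋)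

  -- Signs, signed orbits, and the cycle types of powers.

  ·s-assoc : ∀ r s t → (r ·s s) ·s t ≡ r ·s (s ·s t)
  ·s-assoc true  true  true  = refl
  ·s-assoc true  true  false = refl
  ·s-assoc true  false true  = refl
  ·s-assoc true  false false = refl
  ·s-assoc false true  true  = refl
  ·s-assoc false true  false = refl
  ·s-assoc false false true  = refl
  ·s-assoc false false false = refl

  ·s-comm : ∀ s t → s ·s t ≡ t ·s s
  ·s-comm true  true  = refl
  ·s-comm true  false = refl
  ·s-comm false true  = refl
  ·s-comm false false = refl

  ·s-identityʳ : ∀ s → s ·s true ≡ s
  ·s-identityʳ true = refl
  ·s-identityʳ false = refl

  ·s-identityˡ : ∀ s → true ·s s ≡ s
  ·s-identityˡ true = refl
  ·s-identityˡ false = refl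

  ·s-self : ∀ s → s ·s s ≡ true
  ·s-self true = refl
  ·s-self false = refl

  ·s-cancelˡ : ∀ r {s t} → r ·s s ≡ r ·s t → s ≡ t
  ·s-cancelˡ true {true} {true} _ = refl
  ·s-cancelˡ true {false} {false} _ = refl
  ·s-cancelˡ false {true} {true} _ = refl
  ·s-cancelˡ false {false} {false} _ = refl

  T⇒≡ : ∀ {b} → T b → b ≡ true
  T⇒≡ {true} _ = refl

  ≡⇒T : ∀ {b} → b ≡ true → T b
  ≡⇒T refl = tt

  ¬T⇒≡ : ∀ {b} → ¬ T b → b ≡ false
  ¬T⇒≡ {true} h = ⊥-elim (h tt)
  ¬T⇒≡ {false} _ = refl

  Pt : ℕ → Set
  Pt n = Fin n × Bool

  Ty : Set
  Ty = ℕ × Bool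

  infixr 8 _•_
  _•_ : ∀ {n} → Bool → Pt n → Pt n
  s • a = (proj₁ a , s ·s proj₂ a)

  eqPt⇒≡ : ∀ {n} (a b : Pt n) → T (eqPt a b) → a ≡ b
  eqPt⇒≡ (i , s) (j , t) h with i Fin.≟ j
  eqPt⇒≡ (i , true) (.i , true) h | yes refl = refl
  eqPt⇒≡ (i , false) (.i , false) h | yes refl = refl

  eqPt-refl : ∀ {n} (a : Pt n) → T (eqPt a a)
  eqPt-refl (i , s) with i Fin.≟ i
  eqPt-refl (i , true)  | yes _ = tt
  eqPt-refl (i , false) | yes _ = tt
  ... | no i≢i = i≢i refl

  act-• : ∀ {n} (w : SVec n) s a → act w (s • a) ≡ s • act w a
  act-• w s a = cong (_ ,_) (·s-assoc s _ _)

  iter-• : ∀ {n} (w : SVec n) r s a → iter w r (s • a) ≡ s • iter w r a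
  iter-• w zero s a = refl
  iter-• w (suc r) s a = trans (cong (act w) (iter-• w r s a)) (act-• w s (iter w r a))

  iter-sign : ∀ {n} (w : SVec n) r i s → iter w r (i , s) ≡ s • iter w r (i , true)
  iter-sign w r i s = trans (cong (λ t → iter w r (i , t)) (sym (·s-identityʳ s))) (iter-• w r s (i , true))

  iter-+ : ∀ {n} (w : SVec n) r t a → iter w (r + t) a ≡ iter w r (iter w t a)
  iter-+ w zero t a = refl
  iter-+ w (suc r) t a = cong (act w) (iter-+ w r t a)

  iter-comm : ∀ {n} (w : SVec n) r a → iter w r (act w a) ≡ act w (iter w r a)
  iter-comm w r a = trans (sym (iter-+ w r 1 a)) (cong (λ t → iter w t a) (ℕ.+-comm r 1))

  -- A record instead of a bare function type, so that `w` can be inferred from a proof and the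
  -- implicit indices are not instantiated too early.
  record Inj {n} (w : SVec n) : Set where
    constructor mkInj
    field injective : ∀ {i j} → proj₁ (lookup w i) ≡ proj₁ (lookup w j) → i ≡ j
  open Inj public

  InB⇒Inj : ∀ {n} {w : SVec n} → InB w → Inj w
  InB⇒Inj {n} {w} h .injective {i} {j} eq
    with All.lookup (all⁺ _ (allFin n) (All.lookup (all⁺ _ (allFin n) h) (∈-allFin i))) (∈-allFin j)
  ... | q with proj₁ (lookup w i) Fin.≟ proj₁ (lookup w j) | i Fin.≟ j
  ... | _ | yes e = e
  ... | no ne | _ = ⊥-elim (ne eq)

  Inj⇒InB : ∀ {n} {w : SVec n} → Inj w → InB w
  Inj⇒InB {n} {w} h = all⁻ _ (All.universal (λ i → all⁻ _ (All.universal (λ j → cell i j) (allFin n))) (allFin n))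
    where
    cell : ∀ i j → T (not ⌊ proj₁ (lookup w i) Fin.≟ proj₁ (lookup w j) ⌋ ∨ ⌊ i Fin.≟ j ⌋)
    cell i j with proj₁ (lookup w i) Fin.≟ proj₁ (lookup w j) | i Fin.≟ j
    ... | yes eq | no ne = ne (h .injective eq)
    ... | yes eq | yes _ = tt
    ... | no _ | _ = tt

  act-injective : ∀ {n} {w : SVec n} → Inj w → ∀ {a b} → act w a ≡ act w b → a ≡ b
  act-injective {w = w} inj {i , s} {j , t} eq with inj .injective (cong proj₁ eq)
  ... | refl = cong (i ,_) (·s-cancelˡ u (trans (·s-comm u s) (trans (cong proj₂ eq) (·s-comm t u))))
    where u = proj₂ (lookup w i)

  iter-injective : ∀ {n} {w : SVec n} → Inj w → ∀ r {a b} → iter w r a ≡ iter w r b → a ≡ b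
  iter-injective inj zero eq = eq
  iter-injective inj (suc r) eq = iter-injective inj r (act-injective inj eq)

  •-cancel : ∀ {n} {a b : Pt n} → proj₁ a ≡ proj₁ b → ∃ λ s → a ≡ s • b
  •-cancel {a = i , s} {.i , t} refl = s ·s t , cong (i ,_) (sym (trans (·s-assoc s t t) (trans (cong (s ·s_) (·s-self t)) (·s-identityʳ s))))

  -- Signs commute with `iter`, so an equality up to sign becomes an equality of signed points,
  -- which can be cancelled, once the sign is moved inside.
  iter-injective₁ : ∀ {n} {w : SVec n} → Inj w → ∀ r {a b} → proj₁ (iter w r a) ≡ proj₁ (iter w r b) → proj₁ a ≡ proj₁ b
  iter-injective₁ {w = w} inj r {a} {b} eq with •-cancel {a = iter w r a} eq
  ... | s , e = cong proj₁ (iter-injective inj r {a} {s • b} (trans e (sym (iter-• w r s b))))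

  -- The signed point +i first returns to ±i after j steps, at the point θi.
  record HT {n} (w : SVec n) (i : Fin n) (τ : Ty) : Set where
    constructor ht
    field
      pos    : 1 ≤ proj₁ τ
      return : iter w (proj₁ τ) (i , true) ≡ (i , proj₂ τ)
      first  : ∀ t → 1 ≤ t → t < proj₁ τ → proj₁ (iter w t (i , true)) ≢ i
  open HT public

  HT-unique : ∀ {n} {w : SVec n} {i τ τ′} → HT w i τ → HT w i τ′ → τ ≡ τ′
  HT-unique {τ = j , θ} {τ′ = j′ , θ′} h h′ with ℕ.<-cmp j j′
  ... | tri< lt _ _ = ⊥-elim (first h′ j (pos h) lt (cong proj₁ (return h)))
  ... | tri> _ _ gt = ⊥-elim (first h j′ (pos h′) gt (cong proj₁ (return h′)))
  ... | tri≈ _ refl _ = cong (j ,_) (cong proj₂ (trans (sym (return h)) (return h′)))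

  iter-multiple : ∀ {n} {w : SVec n} {i j θ} → HT w i (j , θ) → ∀ q → iter w (q * j) (i , true) ≡ (i , θ ^Z2 q)
  iter-multiple h zero = refl
  iter-multiple {w = w} {i} {j} {θ} h (suc q) = begin
    iter w (j + q * j) (i , true)
      ≡⟨ iter-+ w j (q * j) _ ⟩
    iter w j (iter w (q * j) (i , true))
      ≡⟨ cong (iter w j) (iter-multiple h q) ⟩
    iter w j (i , θ ^Z2 q)
      ≡⟨ iter-sign w j i _ ⟩
    (θ ^Z2 q) • iter w j (i , true)
      ≡⟨ cong ((θ ^Z2 q) •_) (return h) ⟩
    (i , (θ ^Z2 q) ·s θ)
      ≡⟨ cong (i ,_) (·s-comm (θ ^Z2 q) θ) ⟩
    (i , θ ·s (θ ^Z2 q))                   ∎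
    where open ≡-Reasoning

  iter-mod : ∀ {n} {w : SVec n} {i j θ} → HT w i (j , θ) → .{{_ : NonZero j}} → ∀ r →
    proj₁ (iter w r (i , true)) ≡ proj₁ (iter w (r % j) (i , true))
  iter-mod {w = w} {i} {j} {θ} h r = begin
    proj₁ (iter w r (i , true))
      ≡⟨ cong (λ t → proj₁ (iter w t (i , true))) (m≡m%n+[m/n]*n r j) ⟩
    proj₁ (iter w (r % j + r / j * j) (i , true))
      ≡⟨ cong proj₁ (iter-+ w (r % j) _ _) ⟩
    proj₁ (iter w (r % j) (iter w (r / j * j) (i , true)))
      ≡⟨ cong (λ a → proj₁ (iter w (r % j) a)) (iter-multiple h (r / j)) ⟩
    proj₁ (iter w (r % j) (i , θ ^Z2 (r / j)))
      ≡⟨ cong proj₁ (iter-sign w (r % j) i _) ⟩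
    proj₁ (iter w (r % j) (i , true))                          ∎
    where open ≡-Reasoning

  -- A nonzero remainder of `r` modulo `j` would be a return before the first one.
  returns-at-multiples : ∀ {n} {w : SVec n} {i j θ} → HT w i (j , θ) → ∀ r →
    proj₁ (iter w r (i , true)) ≡ i → ∃ λ q → r ≡ q * j × iter w r (i , true) ≡ (i , θ ^Z2 q)
  returns-at-multiples {w = w} {i} {j} h r eq = r / j , r≡ , trans (cong (λ t → iter w t (i , true)) r≡) (iter-multiple h (r / j))
    where
    instance _ = >-nonZero (pos h)
    rem0 : r % j ≡ 0
    rem0 with r % j in e
    ... | zero = refl
    ... | suc t = ⊥-elim (first h (suc t) (s≤s z≤n) (subst (_< j) e (m%n<n r j))
                    (trans (sym (trans (iter-mod h r) (cong (λ u → proj₁ (iter w u (i , true))) e))) eq))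
    r≡ : r ≡ r / j * j
    r≡ = trans (m≡m%n+[m/n]*n r j) (cong (_+ r / j * j) rem0)

  -- The local function of cycLen, recovered by unification so that it can be reasoned about by induction.
  firstReturn : ∀ {n} → SVec n → Fin n → ℕ → ℕ → ℕ
  cycLen-firstReturn : ∀ {n} (w : SVec n) i → cycLen w i ≡ firstReturn w i (2 * n) 1
  firstReturn = _
  cycLen-firstReturn {n} w i with 2 * n | 1
  ... | m | r = refl

  firstReturn≡ : ∀ {n} (w : SVec n) i L b r → r ≤ L → L ≤ r + b → iter w L (i , true) ≡ (i , true) →
    (∀ t → r ≤ t → t < L → iter w t (i , true) ≢ (i , true)) → firstReturn w i b r ≡ L
  -- When the fuel is exhausted the search answers `r` itself, and the two bounds force `r` to be
  -- `L`.
  firstReturn≡ w i L zero r r≤L L≤ ret min = ℕ.≤-antisym r≤L (subst (L ≤_) (ℕ.+-identityʳ r) L≤)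
  firstReturn≡ w i L (suc b) r r≤L L≤ ret min with eqPt (iter w r (i , true)) (i , true) in e | ℕ.m≤n⇒m<n∨m≡n r≤L
  ... | true  | inj₁ r<L = ⊥-elim (min r ℕ.≤-refl r<L (eqPt⇒≡ _ _ (≡⇒T e)))
  ... | true  | inj₂ eq = eq
  ... | false | inj₂ refl = ⊥-elim (subst T e (subst (λ a → T (eqPt a (i , true))) (sym ret) (eqPt-refl (i , true))))
  ... | false | inj₁ r<L = firstReturn≡ w i L b (suc r) r<L (subst (L ≤_) (ℕ.+-suc r b) L≤) ret
                             (λ t h → min t (ℕ.<⇒≤ h))

  cycLen≡ : ∀ {n} (w : SVec n) i L → 1 ≤ L → L ≤ 2 * n → iter w L (i , true) ≡ (i , true) →
    (∀ t → 1 ≤ t → t < L → iter w t (i , true) ≢ (i , true)) → cycLen w i ≡ L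
  cycLen≡ {n} w i L 1≤L L≤ ret min =
    trans (cycLen-firstReturn w i) (firstReturn≡ w i L (2 * n) 1 1≤L (ℕ.m≤n⇒m≤1+n L≤) ret min)

  ^Z2-true : ∀ q → true ^Z2 q ≡ true
  ^Z2-true zero = refl
  ^Z2-true (suc q) = trans (·s-identityˡ _) (^Z2-true q)

  -- Every return to ±i happens at a multiple of j and carries a power of θ. For θ = +1 the search
  -- for -i therefore fails; for θ = -1 the orbit closes only after 2j steps, which accounts for the
  -- halving. The bound by `n` keeps the relevant times within the search range 2n.
  cycleOf≡ : ∀ {n} {w : SVec n} {i τ} → HT w i τ → proj₁ τ ≤ n → cycleOf w i ≡ τ
  cycleOf≡ {n} {w} {i} {j , true} h j≤n with selfConj w i in sc
  ... | true  = ⊥-elim (notSelf (proj₁ found) (eqPt⇒≡ _ _ (proj₂ found)))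
    where
    found = satisfied (any⁻ _ (upTo (2 * n)) (≡⇒T sc))
    notSelf : ∀ r → iter w r (i , true) ≢ (i , false)
    notSelf r eq with returns-at-multiples h r (cong proj₁ eq)
    ... | q , _ , eq′ with trans (sym (cong proj₂ eq)) (trans (cong proj₂ eq′) (^Z2-true q))
    ... | ()
  ... | false = cong (_, true) (cycLen≡ w i j (pos h) (ℕ.≤-trans j≤n (ℕ.m≤m+n n _)) (return h)
                   (λ t 1≤t t<j eq → first h t 1≤t t<j (cong proj₁ eq)))
  cycleOf≡ {suc n} {w} {i} {j , false} h j≤n with selfConj w i in sc
  ... | false = ⊥-elim (subst T sc (any⁺ _ (lose (∈-upTo⁺ {i = j} j<2n)
                   (subst (λ a → T (eqPt a (i , false))) (sym (return h)) (eqPt-refl (i , false))))))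
    where
    j<2n : j < 2 * suc n
    j<2n = s≤s (ℕ.≤-trans j≤n (ℕ.≤-trans (ℕ.m≤m+n (suc n) 0) (ℕ.m≤n+m (suc n + 0) n)))
  ... | true = cong (_, false) (trans (cong (_/ 2) len) (trans (cong (_/ 2) (ℕ.*-comm 2 j)) (m*n/n≡m j 2)))
    where
    noReturn : ∀ t → 1 ≤ t → t < 2 * j → iter w t (i , true) ≢ (i , true)
    noReturn t 1≤t t<2j eq with returns-at-multiples h t (cong proj₁ eq)
    noReturn t 1≤t t<2j eq | zero , refl , _ = ⊥-elim (ℕ.<-irrefl refl 1≤t)
    noReturn t 1≤t t<2j eq | suc zero , _ , eq′ with trans (sym eq) eq′
    ... | ()
    noReturn t 1≤t t<2j eq | suc (suc q) , refl , _ = ⊥-elim (ℕ.<⇒≱ t<2j (ℕ.*-monoˡ-≤ j (s≤s (s≤s (z≤n {q})))))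
    len : cycLen w i ≡ 2 * j
    len = cycLen≡ w i (2 * j) (ℕ.≤-trans (pos h) (ℕ.m≤m+n j _)) (ℕ.*-monoʳ-≤ 2 j≤n) (iter-multiple h 2) noReturn

  ∘B-act : ∀ {n} (w x : SVec n) a → act (w ∘B x) a ≡ act w (act x a)
  ∘B-act w x (i , s) rewrite lookup∘tabulate (λ i → act w (lookup x i)) i = cong (_ ,_) (sym (·s-assoc s _ _))

  idB-act : ∀ {n} (a : Pt n) → act idB a ≡ a
  idB-act (i , s) rewrite lookup∘tabulate (λ i → (i , true)) i = cong (i ,_) (·s-identityʳ s)

  ^B-act : ∀ {n} (x : SVec n) k a → act (x ^B k) a ≡ iter x k a
  ^B-act x zero a = idB-act a
  ^B-act x (suc k) a = trans (∘B-act x (x ^B k) a) (cong (act x) (^B-act x k a))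

  ^B-iter : ∀ {n} (x : SVec n) k r a → iter (x ^B k) r a ≡ iter x (r * k) a
  ^B-iter x k zero a = refl
  ^B-iter x k (suc r) a = begin
    act (x ^B k) (iter (x ^B k) r a)
      ≡⟨ ^B-act x k _ ⟩
    iter x k (iter (x ^B k) r a)
      ≡⟨ cong (iter x k) (^B-iter x k r a) ⟩
    iter x k (iter x (r * k) a)
      ≡⟨ sym (iter-+ x k (r * k) a) ⟩
    iter x (k + r * k) a              ∎
    where open ≡-Reasoning

  act-lookup : ∀ {n} (w : SVec n) i → act w (i , true) ≡ lookup w i
  act-lookup w i = cong (proj₁ (lookup w i) ,_) (·s-identityˡ _)

  SVec-ext : ∀ {n} {v w : SVec n} → (∀ i → lookup v i ≡ lookup w i) → v ≡ w
  SVec-ext {v = v} {w} h = trans (sym (tabulate∘lookup v)) (trans (tabulate-cong h) (tabulate∘lookup w))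

  act-ext : ∀ {n} {v w : SVec n} → (∀ a → act v a ≡ act w a) → v ≡ w
  act-ext {v = v} {w} h = SVec-ext (λ i → trans (sym (act-lookup v i)) (trans (h (i , true)) (act-lookup w i)))

  Inj-∘B : ∀ {n} {w x : SVec n} → Inj w → Inj x → Inj (w ∘B x)
  Inj-∘B {w = w} {x} iw ix .injective {i} {j} eq
    rewrite lookup∘tabulate (λ i → act w (lookup x i)) i | lookup∘tabulate (λ i → act w (lookup x i)) j = ix .injective (iw .injective eq)

  Inj-idB : ∀ {n} → Inj (idB {n})
  Inj-idB .injective {i} {j} eq = trans (sym (cong proj₁ (lookup∘tabulate (λ i → (i , true)) i)))
                                 (trans eq (cong proj₁ (lookup∘tabulate (λ i → (i , true)) j)))

  Inj-^B : ∀ {n} {x : SVec n} → Inj x → ∀ k → Inj (x ^B k)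
  Inj-^B ix zero = Inj-idB
  Inj-^B {x = x} ix (suc k) = Inj-∘B {w = x} {x ^B k} ix (Inj-^B ix k)

  -- A cycle of type (ℓ , ε) breaks into gcd ℓ k cycles of this type in the k-th power.
  powType : ℕ → Ty → Ty
  powType k (ℓ , ε) = quotient (gcd[m,n]∣m ℓ k) , ε ^Z2 quotient (gcd[m,n]∣n ℓ k)

  -- If `d` divides both quotients, then `d * gcd ℓ k` is a common divisor of `ℓ` and `k`, hence
  -- divides the gcd; cancelling the nonzero gcd leaves `d` dividing 1.
  quotients-coprime : ∀ ℓ k → 1 ≤ k → Coprime (quotient (gcd[m,n]∣m ℓ k)) (quotient (gcd[m,n]∣n ℓ k))
  quotients-coprime ℓ (suc k) _ {d} (d∣q₁ , d∣q₂) =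
    ∣1⇒≡1 (*-cancelʳ-∣ (gcd ℓ (suc k)) (subst (d * gcd ℓ (suc k) ∣_) (sym (ℕ.*-identityˡ _)) (gcd-greatest
      (subst (d * gcd ℓ (suc k) ∣_) (sym (_∣_.equality (gcd[m,n]∣m ℓ (suc k)))) (*-monoˡ-∣ _ d∣q₁))
      (subst (d * gcd ℓ (suc k) ∣_) (sym (_∣_.equality (gcd[m,n]∣n ℓ (suc k)))) (*-monoˡ-∣ _ d∣q₂)))))
    where instance _ = ℕ.≢-nonZero (gcd[m,n]≢0 ℓ (suc k) (inj₂ λ ()))

  -- `t` steps of the power are `t * k` steps of `x`, a return exactly when ℓ divides t k, that is,
  -- when q₁ divides t q₂, that is, when q₁ divides t by coprimality. At t = q₁ the walk has made q₂
  -- full rounds, so the sign is ε to the q₂.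
  HT-^B : ∀ {n} {x : SVec n} {i τ} k → 1 ≤ k → HT x i τ → HT (x ^B k) i (powType k τ)
  HT-^B {x = x} {i} {ℓ , ε} k 1≤k h = ht pos′ return′ first′
    where
    g = gcd ℓ k
    q₁ = quotient (gcd[m,n]∣m ℓ k)
    q₂ = quotient (gcd[m,n]∣n ℓ k)
    ℓ≡ : ℓ ≡ q₁ * g
    ℓ≡ = _∣_.equality (gcd[m,n]∣m ℓ k)
    k≡ : k ≡ q₂ * g
    k≡ = _∣_.equality (gcd[m,n]∣n ℓ k)
    instance
      _ : NonZero g
      _ = ℕ.≢-nonZero (gcd[m,n]≢0 ℓ k (inj₂ λ k≡0 → ℕ.<-irrefl (sym k≡0) 1≤k))
    swap-g : ∀ t → t * k ≡ (t * q₂) * g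
    swap-g t = trans (cong (t *_) k≡) (sym (ℕ.*-assoc t q₂ g))
    q₁k≡q₂ℓ : q₁ * k ≡ q₂ * ℓ
    q₁k≡q₂ℓ = trans (swap-g q₁) (trans (cong (_* g) (ℕ.*-comm q₁ q₂)) (trans (ℕ.*-assoc q₂ q₁ g) (cong (q₂ *_) (sym ℓ≡))))
    pos′ : 1 ≤ q₁
    pos′ with q₁ in e
    ... | suc _ = s≤s z≤n
    ... | zero  = ⊥-elim (ℕ.<-irrefl (sym (trans ℓ≡ (cong (_* g) e))) (pos h))
    return′ : iter (x ^B k) q₁ (i , true) ≡ (i , ε ^Z2 q₂)
    return′ = trans (^B-iter x k q₁ _) (trans (cong (λ t → iter x t (i , true)) q₁k≡q₂ℓ) (iter-multiple h q₂))
    first′ : ∀ t → 1 ≤ t → t < q₁ → proj₁ (iter (x ^B k) t (i , true)) ≢ i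
    first′ t@(suc _) _ t<q₁ eq with returns-at-multiples h (t * k) (trans (cong proj₁ (sym (^B-iter x k t _))) eq)
    ... | q , tk≡qℓ , _ = ℕ.<⇒≱ t<q₁ (∣⇒≤ (coprime-divisor {o = t} (quotients-coprime ℓ k 1≤k) (divides q q₂t≡)))
      where
      q₂t≡ : q₂ * t ≡ q * q₁
      q₂t≡ = ℕ.*-cancelʳ-≡ _ _ g (trans (cong (_* g) (ℕ.*-comm q₂ t)) (trans (sym (swap-g t))
               (trans tk≡qℓ (trans (cong (q *_) ℓ≡) (sym (ℕ.*-assoc q q₁ g))))))

-- Inserting and removing one point, and the effect on cycles.

module Insertion where

  open CycleTypes
  open import Data.Bool using (Bool; true)
  open import Data.Empty using (⊥-elim)
  open import Data.Nat as ℕ using (ℕ; zero; suc; _+_; _*_; _≤_; _<_; z≤n; s≤s; >-nonZero)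
  import Data.Nat.Properties as ℕ
  open import Data.Nat.DivMod using (_%_; m%n<n)
  open import Data.Fin as Fin using (Fin; punchIn; punchOut)
  open import Data.Fin.Properties as Fin using (punchInᵢ≢i; punchIn-injective; punchIn-punchOut)
  open import Data.Product
  open import Data.Vec as V using (lookup; tabulate; insertAt)
  open import Data.Vec.Properties using (lookup∘tabulate; insertAt-lookup; insertAt-punchIn; lookup-map)
  open import Relation.Binary.PropositionalEquality
  open import Relation.Nullary

  up : ∀ {n} → Fin (suc n) → Pt n → Pt (suc n)
  up p (i , s) = punchIn p i , s

  -- An edge into ±c is led to `p` with an extra sign `s`. Since `p` is then sent to `c` with the
  -- same sign, the two cancel and the walk leaves `p` with its old sign.
  redirect : ∀ {n} → Fin (suc n) → Fin n → Bool → Pt n → Pt (suc n)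
  redirect p c s (i , t) with i Fin.≟ c
  ... | yes _ = p , t ·s s
  ... | no _  = punchIn p i , t

  -- insF adds p as a fixed point (up to the sign s); insC inserts p into a cycle,
  -- just before the point ±c.
  insF : ∀ {n} → Fin (suc n) → Bool → SVec n → SVec (suc n)
  insF p s x = insertAt (V.map (up p) x) p (p , s)

  insC : ∀ {n} → Fin (suc n) → Fin n → Bool → SVec n → SVec (suc n)
  insC p c s x = insertAt (V.map (redirect p c s) x) p (punchIn p c , s)

  data PunchView {n} (p : Fin (suc n)) : Fin (suc n) → Set where
    here  : PunchView p p
    there : ∀ i → PunchView p (punchIn p i)

  punchView : ∀ {n} (p i : Fin (suc n)) → PunchView p i
  punchView p i with p Fin.≟ i
  ... | yes refl = here
  ... | no p≢i   = subst (PunchView p) (punchIn-punchOut p≢i) (there (punchOut p≢i))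

  module _ {n} (p : Fin (suc n)) where

    lookup-insF-p : ∀ s (x : SVec n) → lookup (insF p s x) p ≡ (p , s)
    lookup-insF-p s x = insertAt-lookup (V.map (up p) x) p _

    lookup-insF : ∀ s (x : SVec n) i → lookup (insF p s x) (punchIn p i) ≡ up p (lookup x i)
    lookup-insF s x i = trans (insertAt-punchIn (V.map (up p) x) p _ i) (lookup-map i (up p) x)

    lookup-insC-p : ∀ c s (x : SVec n) → lookup (insC p c s x) p ≡ (punchIn p c , s)
    lookup-insC-p c s x = insertAt-lookup (V.map (redirect p c s) x) p _

    lookup-insC : ∀ c s (x : SVec n) i → lookup (insC p c s x) (punchIn p i) ≡ redirect p c s (lookup x i)
    lookup-insC c s x i = trans (insertAt-punchIn (V.map (redirect p c s) x) p _ i) (lookup-map i (redirect p c s) x)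

    up-injective : ∀ {a b : Pt n} → up p a ≡ up p b → a ≡ b
    up-injective {i , s} {j , t} eq = cong₂ _,_ (punchIn-injective p i j (cong proj₁ eq)) (cong proj₂ eq)

    redirect-hit : ∀ {c s} {a : Pt n} → proj₁ a ≡ c → redirect p c s a ≡ (p , proj₂ a ·s s)
    redirect-hit {c} {s} {i , t} eq with i Fin.≟ c
    ... | yes _ = refl
    ... | no ne = ⊥-elim (ne eq)

    redirect-miss : ∀ {c s} {a : Pt n} → proj₁ a ≢ c → redirect p c s a ≡ up p a
    redirect-miss {c} {s} {i , t} ne with i Fin.≟ c
    ... | yes eq = ⊥-elim (ne eq)
    ... | no _ = refl

    redirect-injective₁ : ∀ {c s} {a b : Pt n} → proj₁ (redirect p c s a) ≡ proj₁ (redirect p c s b) → proj₁ a ≡ proj₁ b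
    redirect-injective₁ {c} {s} {i , t} {j , u} eq with i Fin.≟ c | j Fin.≟ c
    ... | yes refl | yes refl = refl
    ... | yes _    | no _     = ⊥-elim (punchInᵢ≢i p j (sym eq))
    ... | no _     | yes _    = ⊥-elim (punchInᵢ≢i p i eq)
    ... | no _     | no _     = punchIn-injective p i j eq

    redirect-injective : ∀ {c s} {a b : Pt n} → redirect p c s a ≡ redirect p c s b → a ≡ b
    redirect-injective {c} {s} {a@(i , t)} {b@(j , u)} eq with redirect-injective₁ {c} {s} {a} {b} (cong proj₁ eq)
    ... | refl with i Fin.≟ c
    ... | yes _ = cong (i ,_) (·s-cancelˡ s (trans (·s-comm s t) (trans (cong proj₂ eq) (·s-comm u s))))
    ... | no _  = cong (i ,_) (cong proj₂ eq)

    redirect≢ : ∀ {c s} {a : Pt n} → proj₁ (redirect p c s a) ≢ punchIn p c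
    redirect≢ {c} {s} {i , t} eq with i Fin.≟ c
    ... | yes _ = punchInᵢ≢i p c (sym eq)
    ... | no ne = ne (punchIn-injective p i c eq)

    insF-injective : ∀ {s t} {x y : SVec n} → insF p s x ≡ insF p t y → s ≡ t × x ≡ y
    insF-injective {s} {t} {x} {y} eq =
      cong proj₂ (trans (sym (lookup-insF-p s x)) (trans (cong (λ z → lookup z p) eq) (lookup-insF-p t y))) ,
      SVec-ext (λ i → up-injective (trans (sym (lookup-insF s x i))
        (trans (cong (λ z → lookup z (punchIn p i)) eq) (lookup-insF t y i))))

    insC-injective : ∀ {c d s t} {x y : SVec n} → insC p c s x ≡ insC p d t y → (c ≡ d × s ≡ t) × x ≡ y
    insC-injective {c} {d} {s} {t} {x} {y} eq
      with trans (sym (lookup-insC-p c s x)) (trans (cong (λ z → lookup z p) eq) (lookup-insC-p d t y))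
    ... | e with punchIn-injective p c d (cong proj₁ e) | cong proj₂ e
    ... | refl | refl = (refl , refl) ,
      SVec-ext (λ i → redirect-injective (trans (sym (lookup-insC c s x i))
        (trans (cong (λ z → lookup z (punchIn p i)) eq) (lookup-insC d t y i))))

    insF≢insC : ∀ {c s t} {x y : SVec n} → insF p s x ≢ insC p c t y
    insF≢insC {c} {s} {t} {x} {y} eq = punchInᵢ≢i p c (cong proj₁
      (trans (sym (lookup-insC-p c t y)) (trans (cong (λ z → lookup z p) (sym eq)) (lookup-insF-p s x))))

    Inj-insF : ∀ {s} {x : SVec n} → Inj x → Inj (insF p s x)
    Inj-insF {s} {x} ix .injective {i} {j} eq with punchView p i | punchView p j
    ... | here     | here = refl
    ... | here     | there j′ rewrite lookup-insF-p s x | lookup-insF s x j′ = ⊥-elim (punchInᵢ≢i p _ (sym eq))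
    ... | there i′ | here rewrite lookup-insF-p s x | lookup-insF s x i′ = ⊥-elim (punchInᵢ≢i p _ eq)
    ... | there i′ | there j′ rewrite lookup-insF s x i′ | lookup-insF s x j′ =
      cong (punchIn p) (ix .injective (punchIn-injective p _ _ eq))

    Inj-insC : ∀ {c s} {x : SVec n} → Inj x → Inj (insC p c s x)
    Inj-insC {c} {s} {x} ix .injective {i} {j} eq with punchView p i | punchView p j
    ... | here     | here = refl
    ... | here     | there j′ rewrite lookup-insC-p c s x | lookup-insC c s x j′ = ⊥-elim (redirect≢ {a = lookup x j′} (sym eq))
    ... | there i′ | here rewrite lookup-insC-p c s x | lookup-insC c s x i′ = ⊥-elim (redirect≢ {a = lookup x i′} eq)
    ... | there i′ | there j′ rewrite lookup-insC c s x i′ | lookup-insC c s x j′ =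
      cong (punchIn p) (ix .injective (redirect-injective₁ {a = lookup x i′} {lookup x j′} eq))

    Inj-insF⁻ : ∀ {s} {x : SVec n} → Inj (insF p s x) → Inj x
    Inj-insF⁻ {s} {x} ix .injective {i} {j} eq = punchIn-injective p i j (ix .injective
      (trans (cong proj₁ (lookup-insF s x i)) (trans (cong (punchIn p) eq) (sym (cong proj₁ (lookup-insF s x j))))))

    redirect₁ : ∀ {c s} {a b : Pt n} → proj₁ a ≡ proj₁ b → proj₁ (redirect p c s a) ≡ proj₁ (redirect p c s b)
    redirect₁ {c} {s} {i , t} {.i , u} refl with i Fin.≟ c
    ... | yes _ = refl
    ... | no _  = refl

    Inj-insC⁻ : ∀ {c s} {x : SVec n} → Inj (insC p c s x) → Inj x
    Inj-insC⁻ {c} {s} {x} ix .injective {i} {j} eq = punchIn-injective p i j (ix .injective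
      (trans (cong proj₁ (lookup-insC c s x i)) (trans (redirect₁ eq) (sym (cong proj₁ (lookup-insC c s x j))))))

    data Removal : SVec (suc n) → Set where
      fixed : ∀ s x → Inj x → Removal (insF p s x)
      cyclic : ∀ c s x → Inj x → Removal (insC p c s x)

    -- The image of `p` decides between the two insertions and supplies `c` and `s`. The smaller
    -- element is read off entry by entry, each entry of `x` away from `p` being shown to lie in the
    -- image of `up` or `redirect`; injectivity excludes a second edge into the image of `p`.
    removal : ∀ x → Inj x → Removal x
    removal x ix with lookup x p in xp
    ... | q , s with punchView p q
    ... | here = subst Removal eq (fixed s x′ (Inj-insF⁻ (subst Inj (sym eq) ix)))
      where
      preimage : ∀ i → ∃ λ b → lookup x (punchIn p i) ≡ up p b
      preimage i with lookup x (punchIn p i) in e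
      ... | r , t with punchView p r
      ... | here    = ⊥-elim (punchInᵢ≢i p i (ix .injective (trans (cong proj₁ e) (cong proj₁ (sym xp)))))
      ... | there j = (j , t) , refl
      x′ = tabulate (λ i → proj₁ (preimage i))
      lookup≡ : ∀ i → lookup (insF p s x′) i ≡ lookup x i
      lookup≡ i with punchView p i
      ... | here     = trans (lookup-insF-p s x′) (sym xp)
      ... | there i′ = trans (lookup-insF s x′ i′) (trans (cong (up p) (lookup∘tabulate _ i′)) (sym (proj₂ (preimage i′))))
      eq : insF p s x′ ≡ x
      eq = SVec-ext lookup≡
    ... | there c = subst Removal eq (cyclic c s x′ (Inj-insC⁻ (subst Inj (sym eq) ix)))
      where
      preimage : ∀ i → ∃ λ b → lookup x (punchIn p i) ≡ redirect p c s b
      preimage i with lookup x (punchIn p i) in e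
      ... | r , t with punchView p r
      -- The edge into `p` is prolonged to `c` and takes over the sign `s` of the edge that leaves
      -- `p`.
      ... | here    = (c , t ·s s) , trans (cong (p ,_) (sym (trans (·s-assoc t s s)
                        (trans (cong (t ·s_) (·s-self s)) (·s-identityʳ t))))) (sym (redirect-hit refl))
      ... | there j = (j , t) , sym (redirect-miss (λ { refl → punchInᵢ≢i p i (ix .injective (trans (cong proj₁ e) (cong proj₁ (sym xp)))) }))
      x′ = tabulate (λ i → proj₁ (preimage i))
      lookup≡ : ∀ i → lookup (insC p c s x′) i ≡ lookup x i
      lookup≡ i with punchView p i
      ... | here     = trans (lookup-insC-p c s x′) (sym xp)
      ... | there i′ = trans (lookup-insC c s x′ i′) (trans (cong (redirect p c s) (lookup∘tabulate _ i′)) (sym (proj₂ (preimage i′))))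
      eq : insC p c s x′ ≡ x
      eq = SVec-ext lookup≡

  InCyc : ∀ {n} → SVec n → Fin n → Fin n → Set
  InCyc x p i = ∃ λ u → proj₁ (iter x u (p , true)) ≡ i

  module Fixed {n} (p : Fin (suc n)) (s : Bool) (x : SVec n) where

    y : SVec (suc n)
    y = insF p s x

    act-p : ∀ t → act y (p , t) ≡ (p , t ·s s)
    act-p t rewrite lookup-insF-p p s x = refl

    act-up : ∀ a → act y (up p a) ≡ up p (act x a)
    act-up (i , t) rewrite lookup-insF p s x i = refl

    iter-up : ∀ r a → iter y r (up p a) ≡ up p (iter x r a)
    iter-up zero a = refl
    iter-up (suc r) a = trans (cong (act y) (iter-up r a)) (act-up (iter x r a))

    HT-p : HT y p (1 , s)
    HT-p = ht (s≤s z≤n) (trans (act-p true) (cong (p ,_) (·s-identityˡ s))) (λ t 1≤t t<1 → ⊥-elim (ℕ.<⇒≱ t<1 1≤t))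

    HT-up : ∀ {i τ} → HT x i τ → HT y (punchIn p i) τ
    HT-up {i} {τ} h = ht (pos h) (trans (iter-up (proj₁ τ) (i , true)) (cong (up p) (return h)))
      λ t 1≤t t<j eq → first h t 1≤t t<j (punchIn-injective p _ _ (trans (cong proj₁ (sym (iter-up t (i , true)))) eq))

    InCyc-p : ∀ {i} → ¬ InCyc y p (punchIn p i)
    InCyc-p {i} (u , eq) = punchInᵢ≢i p i (trans (sym eq) (stay u))
      where
      stay : ∀ u → proj₁ (iter y u (p , true)) ≡ p
      stay zero = refl
      stay (suc u) with iter y u (p , true) | stay u
      ... | .p , t | refl = cong proj₁ (act-p t)

  InCyc-HT-bounded : ∀ {n} {x : SVec n} {p j θ i} → HT x p (j , θ) → InCyc x p i →
    ∃ λ u → u < j × proj₁ (iter x u (p , true)) ≡ i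
  InCyc-HT-bounded {j = j} h (u , eq) = u % j , m%n<n u j , trans (sym (iter-mod h u)) eq
    where instance _ = >-nonZero (pos h)

  InCyc-sym : ∀ {n} {x : SVec n} {i τ c} → HT x i τ → InCyc x i c → InCyc x c i
  -- The return time is `suc j`, so after the first `u` steps another `u * j` complete `u` full
  -- rounds.
  InCyc-sym {x = x} {i} {suc j , θ} {c} h (u , eq) = u * j , (begin
    proj₁ (iter x (u * j) (c , true))
      ≡⟨ cong (λ d → proj₁ (iter x (u * j) (d , true))) (sym eq) ⟩
    proj₁ (iter x (u * j) (proj₁ b , true))
      ≡⟨ sym (cong proj₁ (iter-sign x (u * j) (proj₁ b) (proj₂ b))) ⟩
    proj₁ (iter x (u * j) b)
      ≡⟨ cong proj₁ (sym (iter-+ x (u * j) u _)) ⟩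
    proj₁ (iter x (u * j + u) (i , true))
      ≡⟨ cong (λ r → proj₁ (iter x r (i , true))) (trans (ℕ.+-comm (u * j) u) (sym (ℕ.*-suc u j))) ⟩
    proj₁ (iter x (u * suc j) (i , true))
      ≡⟨ cong proj₁ (iter-multiple h u) ⟩
    i                                                        ∎)
    where
    open ≡-Reasoning
    b = iter x u (i , true)
  InCyc-sym {τ = zero , θ} h _ = ⊥-elim (ℕ.<-irrefl refl (pos h))

  HT-act : ∀ {n} {x : SVec n} → Inj x → ∀ {i τ} → HT x i τ → HT x (proj₁ (lookup x i)) τ
  HT-act {x = x} ix {i} {j , θ} h = ht (pos h) ret λ t 1≤t t<j eq →
    first h t 1≤t t<j (iter-injective₁ ix 1 {iter x t (i , true)} {i , true}
      (trans (cong proj₁ (sym (iter-comm x t (i , true)))) (trans (cong proj₁ (trans (cong (iter x t) (act-lookup x i)) (iter-sign x t d s))) eq)))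
    where
    d = proj₁ (lookup x i)
    s = proj₂ (lookup x i)
    ret : iter x j (d , true) ≡ (d , θ)
    ret = trans (cong (λ r → iter x j (d , r)) (sym (·s-self s))) (trans (iter-• x j s (d , s))
          (trans (cong (λ a → s • iter x j a) (sym (act-lookup x i)))
          (trans (cong (s •_) (trans (iter-comm x j (i , true)) (cong (act x) (return h))))
          (cong (d ,_) (trans (cong (s ·s_) (·s-comm θ s)) (trans (sym (·s-assoc s s θ)) (trans (cong (_·s θ) (·s-self s)) (·s-identityˡ θ))))))))

  HT-InCyc : ∀ {n} {x : SVec n} → Inj x → ∀ {p i τ} → HT x p τ → InCyc x p i → HT x i τ
  HT-InCyc ix h (zero , refl) = h
  HT-InCyc {x = x} ix {p} h (suc u , refl) = HT-act ix (HT-InCyc ix h (u , refl))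

  module Cyclic {n} (p : Fin (suc n)) (c : Fin n) (s : Bool) (x : SVec n) where

    y : SVec (suc n)
    y = insC p c s x

    act-p : ∀ t → act y (p , t) ≡ up p (c , t ·s s)
    act-p t rewrite lookup-insC-p p c s x = refl

    act-miss : ∀ a → proj₁ (act x a) ≢ c → act y (up p a) ≡ up p (act x a)
    act-miss (i , t) ne rewrite lookup-insC p c s x i | redirect-miss p {c} {s} {lookup x i} ne = refl

    act-hit : ∀ a → proj₁ (act x a) ≡ c → act y (up p a) ≡ (p , proj₂ (act x a) ·s s)
    act-hit (i , t) eq rewrite lookup-insC p c s x i | redirect-hit p {c} {s} {lookup x i} eq = cong (p ,_) (sym (·s-assoc t _ s))

    iter-miss : ∀ r a → (∀ u → 1 ≤ u → u ≤ r → proj₁ (iter x u a) ≢ c) → iter y r (up p a) ≡ up p (iter x r a)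
    iter-miss zero a h = refl
    iter-miss (suc r) a h = trans (cong (act y) (iter-miss r a (λ u 1≤u u≤r → h u 1≤u (ℕ.m≤n⇒m≤1+n u≤r))))
                                  (act-miss (iter x r a) (h (suc r) (s≤s z≤n) ℕ.≤-refl))

    -- Starting at p, the walk follows x from c and is back at p when x first returns to c.
    HT-p : ∀ {j θ} → HT x c (j , θ) → HT y p (suc j , θ)
    HT-p {suc j} {θ} h = ht (s≤s z≤n) ret′ first′
      where
      b : Pt n
      b = (c , s)
      ret-b : iter x (suc j) b ≡ (c , s ·s θ)
      ret-b = trans (iter-sign x (suc j) c s) (cong (s •_) (return h))
      first-b : ∀ u → 1 ≤ u → u ≤ j → proj₁ (iter x u b) ≢ c
      first-b u 1≤u u≤j eq = first h u 1≤u (s≤s u≤j) (trans (sym (cong proj₁ (iter-sign x u c s))) eq)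
      start : ∀ r → iter y (suc r) (p , true) ≡ iter y r (up p b)
      start r = trans (sym (iter-comm y r (p , true))) (cong (iter y r) (trans (act-p true) (cong (up p) (cong (c ,_) (·s-identityˡ s)))))
      ret′ : iter y (suc (suc j)) (p , true) ≡ (p , θ)
      ret′ = trans (start (suc j)) (trans (cong (act y) (iter-miss j b first-b))
        (trans (act-hit (iter x j b) (cong proj₁ ret-b)) (cong (p ,_) (trans (cong (_·s s) (cong proj₂ ret-b))
          (trans (cong (_·s s) (·s-comm s θ)) (trans (·s-assoc θ s s) (trans (cong (θ ·s_) (·s-self s)) (·s-identityʳ θ))))))))
      first′ : ∀ t → 1 ≤ t → t < suc (suc j) → proj₁ (iter y t (p , true)) ≢ p
      first′ (suc t) _ (s≤s (s≤s t≤j)) eq = punchInᵢ≢i p (proj₁ (iter x t b)) (trans (sym (cong proj₁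
        (trans (start t) (iter-miss t b (λ u 1≤u u≤t → first-b u 1≤u (ℕ.≤-trans u≤t t≤j)))))) eq)

    InCyc-up : ∀ {i} → InCyc x c i → InCyc y p (punchIn p i)
    InCyc-up (zero , refl) = 1 , cong proj₁ (act-p true)
    InCyc-up (suc u , refl) with InCyc-up (u , refl) | proj₁ (iter x (suc u) (c , true)) Fin.≟ c
    ... | _      | yes eq = 1 , trans (cong proj₁ (act-p true)) (cong (punchIn p) (sym eq))
    ... | v , eq | no ne = suc v , trans (cong proj₁ (cong (act y) (proj₂ (•-cancel {a = iter y v (p , true)} {b = up p (iter x u (c , true))} eq))))
                                         (trans (cong proj₁ (act-• y (proj₁ (•-cancel {a = iter y v (p , true)} {b = up p (iter x u (c , true))} eq)) (up p (iter x u (c , true))))) (cong proj₁ (act-miss (iter x u (c , true)) ne)))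

    InCyc-up⁻ : ∀ {i} → InCyc y p (punchIn p i) → InCyc x c i
    InCyc-up⁻ {i} (u , eq) = inside (onWalk u) eq
      where
      -- The invariant of the walk of `y` from `p`: it is at `p`, or at a point coming from the
      -- cycle of `c` in `x`.
      data Inside : Pt (suc n) → Set where
        at-p  : ∀ {t} → Inside (p , t)
        at-up : ∀ {a} → InCyc x c (proj₁ a) → Inside (up p a)
      step : ∀ {b} → Inside b → Inside (act y b)
      step (at-p {t}) = subst Inside (sym (act-p t)) (at-up (0 , refl))
      step (at-up {a} (v , e)) with proj₁ (act x a) Fin.≟ c
      ... | yes hit = subst Inside (sym (act-hit a hit)) at-p
      ... | no miss = subst Inside (sym (act-miss a miss)) (at-up (suc v , cong (λ d → proj₁ (lookup x d)) e))
      onWalk : ∀ u → Inside (iter y u (p , true))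
      onWalk zero = at-p
      onWalk (suc u) = step (onWalk u)
      inside : ∀ {b} → Inside b → proj₁ b ≡ punchIn p i → InCyc x c i
      inside at-p e = ⊥-elim (punchInᵢ≢i p i (sym e))
      inside (at-up {a} h) e = subst (InCyc x c) (punchIn-injective p _ _ e) h

    -- A walk that met `c` would, by `InCyc-sym`, put its starting point in the cycle of `c`; so
    -- this walk is never redirected.
    HT-up : ∀ {i τ} → ¬ InCyc x c i → HT x i τ → HT y (punchIn p i) τ
    HT-up {i} {τ} out h = ht (pos h) (trans (walk (proj₁ τ)) (cong (up p) (return h)))
      λ t 1≤t t<j eq → first h t 1≤t t<j (punchIn-injective p _ _ (trans (cong proj₁ (sym (walk t))) eq))
      where
      walk : ∀ r → iter y r (up p (i , true)) ≡ up p (iter x r (i , true))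
      walk r = iter-miss r (i , true) (λ u _ _ eq → out (InCyc-sym h (u , eq)))

  -- Removing p itself bounds its type without any appeal to the pigeonhole principle.
  ∃HT : ∀ {n} {x : SVec n} → Inj x → ∀ p → ∃ λ τ → HT x p τ × proj₁ τ ≤ n
  ∃HT {suc n} {x} ix p with removal p x ix
  ... | fixed s x′ _ = (1 , s) , Fixed.HT-p p s x′ , s≤s z≤n
  ... | cyclic c s x′ ix′ with ∃HT ix′ c
  ... | (j , θ) , h , j≤n = (suc j , θ) , Cyclic.HT-p p c s x′ h , s≤s j≤n

  HT-cycleOf : ∀ {n} {x : SVec n} → Inj x → ∀ p → HT x p (cycleOf x p)
  HT-cycleOf {x = x} ix p with ∃HT ix p
  ... | τ , h , τ≤n = subst (HT x p) (sym (cycleOf≡ h τ≤n)) h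

  cycleOf-unique : ∀ {n} {x : SVec n} → Inj x → ∀ {p τ} → HT x p τ → cycleOf x p ≡ τ
  cycleOf-unique ix h = HT-unique (HT-cycleOf ix _) h

  cycleOf-bounded : ∀ {n} {x : SVec n} → Inj x → ∀ p → proj₁ (cycleOf x p) ≤ n
  cycleOf-bounded ix p with ∃HT ix p
  ... | τ , h , τ≤n = subst (λ σ → proj₁ σ ≤ _) (sym (cycleOf-unique ix h)) τ≤n

-- Inverses, and counting points by the type of their cycle.

module CycleStatistics where

  open CycleTypes
  open Insertion
  open import Algebra.Bundles using (CommutativeMonoid)
  import Algebra.Properties.CommutativeMonoid.Sum as CMSum
  open import Data.Bool using (Bool; true; false; not; _∧_; _xor_; if_then_else_)
  open import Data.Empty using (⊥-elim)
  open import Data.Nat as ℕ using (ℕ; zero; suc; _+_; _*_; _<_; _≡ᵇ_)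
  import Data.Nat.Properties as ℕ
  open import Data.Fin as Fin using (Fin; punchIn)
  import Data.Fin.Properties as Fin
  open import Data.Fin.Permutation using (Permutation; permutation)
  open import Data.Product
  open import Data.Vec using (lookup; tabulate)
  open import Data.Vec.Properties using (lookup∘tabulate)
  open import Function using (_∘_)
  open import Level using (0ℓ)
  open import Relation.Binary.PropositionalEquality
  open import Relation.Nullary
  open import Relation.Nullary.Decidable using (⌊_⌋)

  ·s-commutativeMonoid : CommutativeMonoid 0ℓ 0ℓ
  ·s-commutativeMonoid = record
    { Carrier = Bool ; _≈_ = _≡_ ; _∙_ = _·s_ ; ε = true
    ; isCommutativeMonoid = record
      { isMonoid = record
        { isSemigroup = record
          { isMagma = record { isEquivalence = isEquivalence ; ∙-cong = cong₂ _·s_ }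
          ; assoc = ·s-assoc }
        ; identity = ·s-identityˡ , ·s-identityʳ }
      ; comm = ·s-comm } }

  module Σℕ = CMSum ℕ.+-0-commutativeMonoid
  module Πs = CMSum ·s-commutativeMonoid

  -- If w^j sends i to θi, then the inverse image of i under w is θ times the point reached after j
  -- - 1 steps.
  invB : ∀ {n} → SVec n → SVec n
  invB w = tabulate (λ i → proj₂ (cycleOf w i) • iter w (ℕ.pred (proj₁ (cycleOf w i))) (i , true))

  act-invB : ∀ {n} {w : SVec n} → Inj w → ∀ a → act w (act (invB w) a) ≡ a
  act-invB {w = w} iw (i , s) rewrite lookup∘tabulate (λ i → proj₂ (cycleOf w i) • iter w (ℕ.pred (proj₁ (cycleOf w i))) (i , true)) i
    with cycleOf w i | HT-cycleOf iw i
  ... | suc j , θ | h = begin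
    act w (s • θ • b)
      ≡⟨ act-• w s (θ • b) ⟩
    s • act w (θ • b)
      ≡⟨ cong (s •_) (act-• w θ b) ⟩
    s • θ • act w b
      ≡⟨ cong (λ a → s • θ • a) (return h) ⟩
    (i , s ·s (θ ·s θ))
      ≡⟨ cong (λ t → i , s ·s t) (·s-self θ) ⟩
    (i , s ·s true)
      ≡⟨ cong (i ,_) (·s-identityʳ s) ⟩
    (i , s)              ∎
    where
    open ≡-Reasoning
    b = iter w j (i , true)
  ... | zero , θ | h = ⊥-elim (ℕ.<-irrefl refl (pos h))

  invB-act : ∀ {n} {w : SVec n} → Inj w → ∀ a → act (invB w) (act w a) ≡ a
  invB-act {w = w} iw a = act-injective iw (act-invB iw (act w a))

  Inj-invB : ∀ {n} {w : SVec n} → Inj w → Inj (invB w)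
  Inj-invB {w = w} iw .injective {i} {j} eq with •-cancel {a = lookup (invB w) i} {lookup (invB w) j} eq
  ... | s , e = cong proj₁ (begin
    (i , true)
      ≡⟨ act-invB iw (i , true) ⟨
    act w (act (invB w) (i , true))
      ≡⟨ cong (act w) (trans (act-lookup (invB w) i) (trans e (cong (s •_) (sym (act-lookup (invB w) j))))) ⟩
    act w (s • act (invB w) (j , true))
      ≡⟨ act-• w s _ ⟩
    s • act w (act (invB w) (j , true))
      ≡⟨ cong (s •_) (act-invB iw (j , true)) ⟩
    s • (j , true)                          ∎)
    where open ≡-Reasoning

  perm : ∀ {n} {w : SVec n} → Inj w → Permutation n n
  perm {w = w} iw = permutation (λ i → proj₁ (lookup w i)) (λ i → proj₁ (lookup (invB w) i))
    (λ i → cong proj₁ (act-invB iw (i , true))) (λ i → cong proj₁ (invB-act iw (i , true)))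

  -- Uses the same Boolean test as `countCyc`, so that filtering and summing `hit` agree point by
  -- point.
  hit : Ty → Ty → ℕ
  hit τ σ = if (proj₁ τ ≡ᵇ proj₁ σ) ∧ not (proj₂ τ xor proj₂ σ) then 1 else 0

  hit-refl : ∀ τ → hit τ τ ≡ 1
  hit-refl (j , θ) rewrite T⇒≡ (ℕ.≡⇒≡ᵇ j j refl) | ·s-self θ = refl

  hit⇒≡ : ∀ τ σ → hit τ σ ≢ 0 → τ ≡ σ
  hit⇒≡ (j , θ) (j′ , θ′) h with j ≡ᵇ j′ in e
  hit⇒≡ (j , true)  (j′ , true)  h | true = cong (_, true) (ℕ.≡ᵇ⇒≡ j j′ (≡⇒T e))
  hit⇒≡ (j , false) (j′ , false) h | true = cong (_, false) (ℕ.≡ᵇ⇒≡ j j′ (≡⇒T e))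
  hit⇒≡ (j , true)  (j′ , false) h | true = ⊥-elim (h refl)
  hit⇒≡ (j , false) (j′ , true)  h | true = ⊥-elim (h refl)
  hit⇒≡ (j , θ)     (j′ , θ′)    h | false = ⊥-elim (h refl)

  hit≢ : ∀ τ σ → τ ≢ σ → hit τ σ ≡ 0
  hit≢ τ σ ne with hit τ σ in e
  ... | zero = refl
  ... | suc _ = ⊥-elim (ne (hit⇒≡ τ σ (λ e′ → case trans (sym e) e′ of λ ())))
    where open import Function using (case_of_)

  module _ {n} (x : SVec n) (p : Fin n) where

    inCyc? : ∀ i → Dec (∃ λ u → u < proj₁ (cycleOf x p) × proj₁ (iter x u (p , true)) ≡ i)
    inCyc? i = ℕ.anyUpTo? (λ u → proj₁ (iter x u (p , true)) Fin.≟ i) _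

    inCyc : Fin n → Bool
    inCyc i = ⌊ inCyc? i ⌋

    inCyc-true : ∀ {i} → Inj x → InCyc x p i → inCyc i ≡ true
    inCyc-true {i} ix h with inCyc? i
    ... | yes _ = refl
    ... | no ne = ⊥-elim (ne (InCyc-HT-bounded (HT-cycleOf ix p) h))

    inCyc-false : ∀ {i} → ¬ InCyc x p i → inCyc i ≡ false
    inCyc-false {i} out with inCyc? i
    ... | yes (u , _ , eq) = ⊥-elim (out (u , eq))
    ... | no _ = refl

    InCyc? : ∀ i → Inj x → Dec (InCyc x p i)
    InCyc? i ix with inCyc? i
    ... | yes (u , _ , eq) = yes (u , eq)
    ... | no ne = no (λ h → ne (InCyc-HT-bounded (HT-cycleOf ix p) h))

  inflate : ℕ → Ty → Ty
  inflate r (j , θ) = j + r , θ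

  -- With `V` the identity, `stat` describes `x`; with `V = powType k` it describes the k-th power.
  -- Points are counted instead of cycles, so that the counts are directly the exponents j b_{j,θ}.
  module Statistics (V : Ty → Ty) where

    stat : ∀ {n} → SVec n → Ty → ℕ
    stat x τ = Σℕ.sum (λ i → hit (V (cycleOf x i)) τ)

    label : ∀ {n} → SVec n → Fin n → ℕ → Fin n → Ty
    label x p r i = V (if inCyc x p i then inflate r (cycleOf x p) else cycleOf x i)

    -- The statistic of x with r phantom points added to the cycle of p.
    statI : ∀ {n} → SVec n → Fin n → ℕ → Ty → ℕ
    statI x p r τ = Σℕ.sum (λ i → hit (label x p r i) τ) + r * hit (V (inflate r (cycleOf x p))) τ

    statI-0 : ∀ {n} {x : SVec n} → Inj x → ∀ p τ → statI x p 0 τ ≡ stat x τ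
    statI-0 {x = x} ix p τ = trans (ℕ.+-identityʳ _) (Σℕ.sum-cong-≗ (λ i → cong (λ σ → hit (V σ) τ) (label-0 i)))
      where
      label-0 : ∀ i → (if inCyc x p i then inflate 0 (cycleOf x p) else cycleOf x i) ≡ cycleOf x i
      label-0 i with inCyc? x p i
      ... | yes (u , _ , eq) = trans (cong (_, proj₂ (cycleOf x p)) (ℕ.+-identityʳ _)) (sym (cycleOf-unique ix (HT-InCyc ix (HT-cycleOf ix p) (u , eq))))
      ... | no _ = refl

    label-self : ∀ {n} {x : SVec n} → Inj x → ∀ p r → label x p r p ≡ V (inflate r (cycleOf x p))
    label-self {x = x} ix p r = cong (λ b → V (if b then inflate r (cycleOf x p) else cycleOf x p)) (inCyc-true x p ix (0 , refl))

    statI-split : ∀ {n} {x : SVec (suc n)} → Inj x → ∀ p r τ →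
      statI x p r τ ≡ Σℕ.sum (λ i → hit (label x p r (punchIn p i)) τ) + suc r * hit (V (inflate r (cycleOf x p))) τ
    statI-split {x = x} ix p r τ = begin
      Σℕ.sum (λ i → hit (label x p r i) τ) + r * h
        ≡⟨ cong (_+ r * h) (Σℕ.sum-remove {i = p} (λ i → hit (label x p r i) τ)) ⟩
      (hit (label x p r p) τ + rest) + r * h
        ≡⟨ cong (λ σ → (hit σ τ + rest) + r * h) (label-self ix p r) ⟩
      (h + rest) + r * h
        ≡⟨ cong (_+ r * h) (ℕ.+-comm h rest) ⟩
      (rest + h) + r * h
        ≡⟨ ℕ.+-assoc rest h _ ⟩
      rest + (h + r * h)                               ∎
      where
      open ≡-Reasoning
      h = hit (V (inflate r (cycleOf x p))) τ
      rest = Σℕ.sum (λ i → hit (label x p r (punchIn p i)) τ)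

    -- The cycle of `p` consists of `p` and its `r` phantoms, r + 1 points of length r + 1 and class
    -- `s`; all other points keep their cycles.
    statI-insF : ∀ {n} {x : SVec n} → Inj x → ∀ p s r τ →
      statI (insF p s x) p r τ ≡ stat x τ + suc r * hit (V (suc r , s)) τ
    statI-insF {x = x} ix p s r τ = trans (statI-split iy p r τ)
      (cong₂ _+_ (Σℕ.sum-cong-≗ (λ i → cong (λ σ → hit (V σ) τ) (label-up i)))
                 (cong (λ σ → suc r * hit (V (inflate r σ)) τ) (cycleOf-unique iy HT-p)))
      where
      open Fixed p s x
      iy : Inj y
      iy = Inj-insF p ix
      label-up : ∀ i → (if inCyc y p (punchIn p i) then inflate r (cycleOf y p) else cycleOf y (punchIn p i)) ≡ cycleOf x i
      label-up i rewrite inCyc-false y p (InCyc-p {i}) = cycleOf-unique iy (HT-up (HT-cycleOf ix i))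

    -- The removed point joins the phantoms of its cycle, which is from now on represented by `c`.
    -- This identity is what makes the recursion on marked elements close up.
    statI-insC : ∀ {n} {x : SVec n} → Inj x → ∀ p c s r τ →
      statI (insC p c s x) p r τ ≡ statI x c (suc r) τ
    statI-insC {x = x} ix p c s r τ = trans (statI-split iy p r τ)
      (cong₂ _+_ (Σℕ.sum-cong-≗ (λ i → cong (λ σ → hit (V σ) τ) (label-up i)))
                 (cong (λ σ → suc r * hit (V σ) τ) inflate-p))
      where
      open Cyclic p c s x
      iy : Inj y
      iy = Inj-insC p ix
      inflate-p : inflate r (cycleOf y p) ≡ inflate (suc r) (cycleOf x c)
      inflate-p = trans (cong (inflate r) (cycleOf-unique iy (HT-p (HT-cycleOf ix c)))) (cong (_, proj₂ (cycleOf x c)) (sym (ℕ.+-suc _ r)))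
      label-up : ∀ i → (if inCyc y p (punchIn p i) then inflate r (cycleOf y p) else cycleOf y (punchIn p i)) ≡
                       (if inCyc x c i then inflate (suc r) (cycleOf x c) else cycleOf x i)
      label-up i with InCyc? x c i ix
      ... | yes h rewrite inCyc-true x c ix h | inCyc-true y p iy (InCyc-up h) = inflate-p
      ... | no out rewrite inCyc-false x c out | inCyc-false y p (out ∘ InCyc-up⁻ {i}) =
        cycleOf-unique iy (HT-up out (HT-cycleOf ix i))

    stat-insF : ∀ {n} {x : SVec n} → Inj x → ∀ p s τ →
      stat (insF p s x) τ ≡ stat x τ + hit (V (1 , s)) τ
    stat-insF {x = x} ix p s τ = trans (sym (statI-0 (Inj-insF p ix) p τ))
      (trans (statI-insF ix p s 0 τ) (cong (stat x τ +_) (ℕ.+-identityʳ _)))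

  bit : Bool → ℕ
  bit b = if b then 1 else 0

  sum≡0 : ∀ n → Σℕ.sum {n} (λ _ → 0) ≡ 0
  sum≡0 n = Σℕ.sum-replicate-zero n

  -- Ties the number of points on a cycle to the return time: removing `p` lowers both by one.
  cycle-size : ∀ {n} {x : SVec n} → Inj x → ∀ p → Σℕ.sum (λ i → bit (inCyc x p i)) ≡ proj₁ (cycleOf x p)
  cycle-size {suc n} {x} ix p with removal p x ix
  ... | fixed s x′ ix′ = begin
    Σℕ.sum (λ i → bit (inCyc y p i))
      ≡⟨ Σℕ.sum-remove {i = p} (λ i → bit (inCyc y p i)) ⟩
    bit (inCyc y p p) + Σℕ.sum (λ i → bit (inCyc y p (punchIn p i)))
      ≡⟨ cong₂ (λ b t → bit b + t) (inCyc-true y p ix (0 , refl)) (Σℕ.sum-cong-≗ (λ i → cong bit (inCyc-false y p (InCyc-p {i})))) ⟩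
    1 + Σℕ.sum {n} (λ _ → 0)
      ≡⟨ cong suc (sum≡0 n) ⟩
    1
      ≡⟨ cong proj₁ (sym (cycleOf-unique ix HT-p)) ⟩
    proj₁ (cycleOf y p)                                                  ∎
    where
    open ≡-Reasoning
    open Fixed p s x′
  ... | cyclic c s x′ ix′ = begin
    Σℕ.sum (λ i → bit (inCyc y p i))
      ≡⟨ Σℕ.sum-remove {i = p} (λ i → bit (inCyc y p i)) ⟩
    bit (inCyc y p p) + Σℕ.sum (λ i → bit (inCyc y p (punchIn p i)))
      ≡⟨ cong₂ (λ b t → bit b + t) (inCyc-true y p ix (0 , refl)) (Σℕ.sum-cong-≗ (λ i → cong bit (same i))) ⟩
    1 + Σℕ.sum (λ i → bit (inCyc x′ c i))
      ≡⟨ cong suc (cycle-size ix′ c) ⟩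
    1 + proj₁ (cycleOf x′ c)
      ≡⟨ cong proj₁ (sym (cycleOf-unique ix (HT-p (HT-cycleOf ix′ c)))) ⟩
    proj₁ (cycleOf y p)                                                  ∎
    where
    open ≡-Reasoning
    open Cyclic p c s x′
    same : ∀ i → inCyc y p (punchIn p i) ≡ inCyc x′ c i
    same i with InCyc? x′ c i ix′
    ... | yes h = trans (inCyc-true y p ix (InCyc-up h)) (sym (inCyc-true x′ c ix′ h))
    ... | no out = trans (inCyc-false y p (out ∘ InCyc-up⁻ {i})) (sym (inCyc-false x′ c out))

-- Equal cycle statistics imply conjugacy, and conversely.

module Conjugacy where

  open CycleTypes
  open Insertion
  open CycleStatistics
  import Algebra.Properties.Semiring.Sum as SRSum
  open import Data.Bool using (Bool; true)
  open import Data.Empty using (⊥-elim)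
  open import Data.Nat as ℕ using (ℕ; zero; suc; _+_; _*_)
  import Data.Nat.Properties as ℕ
  open import Data.Fin as Fin using (Fin; punchIn)
  open import Data.Fin.Properties as Fin using (punchInᵢ≢i; punchIn-injective)
  open import Data.Product
  open import Data.Vec as V using (lookup; insertAt)
  open import Data.Vec.Properties using (insertAt-lookup; insertAt-punchIn; lookup-map)
  open import Function using (_∘_; id)
  open import Relation.Binary.PropositionalEquality
  open import Relation.Nullary

  module Σ*ℕ = SRSum ℕ.+-*-semiring

  open Statistics id

  -- Lengthening the cycle of `c` replaces its a points of type (a , θ) by a + 1 points of type (a +
  -- 1 , θ). The balance avoids truncated subtraction: each side receives the points that the other
  -- one has and it lacks.
  statI-1 : ∀ {n} {x : SVec n} → Inj x → ∀ c τ →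
    statI x c 1 τ + proj₁ (cycleOf x c) * hit (cycleOf x c) τ ≡
    stat x τ + suc (proj₁ (cycleOf x c)) * hit (inflate 1 (cycleOf x c)) τ
  statI-1 {x = x} ix c τ = begin
    (S + 1 * h′) + a * h
      ≡⟨ cong (λ t → S + t + a * h) (ℕ.*-identityˡ h′) ⟩
    (S + h′) + a * h
      ≡⟨ ℕ.+-assoc (S) h′ _ ⟩
    S + (h′ + a * h)
      ≡⟨ cong (S +_) (ℕ.+-comm h′ _) ⟩
    S + (a * h + h′)
      ≡⟨ sym (ℕ.+-assoc (S) _ h′) ⟩
    (S + a * h) + h′
      ≡⟨ cong (_+ h′) sums ⟩
    (stat x τ + a * h′) + h′
      ≡⟨ ℕ.+-assoc (stat x τ) _ h′ ⟩
    stat x τ + (a * h′ + h′)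
      ≡⟨ cong (stat x τ +_) (ℕ.+-comm (a * h′) h′) ⟩
    stat x τ + suc a * h′                                                        ∎
    where
    open ≡-Reasoning
    a = proj₁ (cycleOf x c)
    h = hit (cycleOf x c) τ
    S = Σℕ.sum (λ i → hit (label x c 1 i) τ)
    h′ = hit (inflate 1 (cycleOf x c)) τ
    spread : ∀ g → a * g ≡ Σℕ.sum (λ i → bit (inCyc x c i) * g)
    spread g = trans (cong (_* g) (sym (cycle-size ix c))) (Σ*ℕ.*-distribʳ-sum g (λ i → bit (inCyc x c i)))
    pointwise : ∀ i → hit (label x c 1 i) τ + bit (inCyc x c i) * h ≡ hit (cycleOf x i) τ + bit (inCyc x c i) * h′
    pointwise i with InCyc? x c i ix
    ... | no out rewrite inCyc-false x c out = refl
    ... | yes h rewrite inCyc-true x c ix h | cycleOf-unique ix (HT-InCyc ix (HT-cycleOf ix c) h) =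
      trans (cong (h′ +_) (ℕ.+-identityʳ _)) (trans (ℕ.+-comm h′ _) (cong (hit (cycleOf x c) τ +_) (sym (ℕ.+-identityʳ h′))))
    sums : S + a * h ≡ stat x τ + a * h′
    sums = begin
      S + a * h
        ≡⟨ cong (S +_) (spread h) ⟩
      S + Σℕ.sum (λ i → bit (inCyc x c i) * h)
        ≡⟨ sym (Σℕ.∑-distrib-+ (λ i → hit (label x c 1 i) τ) _) ⟩
      Σℕ.sum (λ i → hit (label x c 1 i) τ + bit (inCyc x c i) * h)
        ≡⟨ Σℕ.sum-cong-≗ pointwise ⟩
      Σℕ.sum (λ i → hit (cycleOf x i) τ + bit (inCyc x c i) * h′)
        ≡⟨ Σℕ.∑-distrib-+ (λ i → hit (cycleOf x i) τ) _ ⟩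
      stat x τ + Σℕ.sum (λ i → bit (inCyc x c i) * h′)
        ≡⟨ cong (stat x τ +_) (sym (spread h′)) ⟩
      stat x τ + a * h′                                                                          ∎

  SameStat : ∀ {n} → SVec n → SVec n → Set
  SameStat x y = ∀ τ → stat x τ ≡ stat y τ

  SameStat-insF⁻ : ∀ {n} {x y : SVec n} → Inj x → Inj y → ∀ p q s → SameStat (insF p s x) (insF q s y) → SameStat x y
  SameStat-insF⁻ {x = x} {y} ix iy p q s same τ = ℕ.+-cancelʳ-≡ (hit (1 , s) τ) _ _
    (trans (sym (stat-insF ix p s τ)) (trans (same τ) (stat-insF iy q s τ)))

  -- As `c` and `d` have the same type, both insertions change the statistics by the same amount,
  -- given by `statI-1`, and this amount cancels.
  SameStat-insC⁻ : ∀ {n} {x y : SVec n} → Inj x → Inj y → ∀ p q c d s t → cycleOf x c ≡ cycleOf y d →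
    SameStat (insC p c s x) (insC q d t y) → SameStat x y
  SameStat-insC⁻ {x = x} {y} ix iy p q c d s t eq same τ = ℕ.+-cancelʳ-≡ (suc (proj₁ (cycleOf y d)) * hit (inflate 1 (cycleOf y d)) τ) _ _ (begin
    stat x τ + suc (proj₁ (cycleOf y d)) * hit (inflate 1 (cycleOf y d)) τ
      ≡⟨ cong (λ σ → stat x τ + suc (proj₁ σ) * hit (inflate 1 σ) τ) (sym eq) ⟩
    stat x τ + suc (proj₁ (cycleOf x c)) * hit (inflate 1 (cycleOf x c)) τ
      ≡⟨ sym (statI-1 ix c τ) ⟩
    statI x c 1 τ + proj₁ (cycleOf x c) * hit (cycleOf x c) τ
      ≡⟨ cong₂ (λ u σ → u + proj₁ σ * hit σ τ) inserted eq ⟩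
    statI y d 1 τ + proj₁ (cycleOf y d) * hit (cycleOf y d) τ
      ≡⟨ statI-1 iy d τ ⟩
    stat y τ + suc (proj₁ (cycleOf y d)) * hit (inflate 1 (cycleOf y d)) τ     ∎)
    where
    open ≡-Reasoning
    inserted : statI x c 1 τ ≡ statI y d 1 τ
    inserted = trans (sym (trans (sym (statI-0 (Inj-insC p ix) p τ)) (statI-insC ix p c s 0 τ)))
               (trans (same τ) (trans (sym (statI-0 (Inj-insC q iy) q τ)) (statI-insC iy q d t 0 τ)))

  sum-nonZero : ∀ {n} (f : Fin n → ℕ) → Σℕ.sum f ≢ 0 → ∃ λ i → f i ≢ 0
  sum-nonZero {zero} f h = ⊥-elim (h refl)
  sum-nonZero {suc n} f h with f Fin.zero in e
  ... | suc _ = Fin.zero , λ e′ → case trans (sym e) e′ of λ ()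
    where open import Function using (case_of_)
  ... | zero with sum-nonZero (f ∘ Fin.suc) h
  ... | i , fi = Fin.suc i , fi

  sum-zero : ∀ {n} (f : Fin n → ℕ) → Σℕ.sum f ≡ 0 → ∀ i → f i ≡ 0
  sum-zero f h Fin.zero = ℕ.m+n≡0⇒m≡0 (f Fin.zero) h
  sum-zero f h (Fin.suc i) = sum-zero (f ∘ Fin.suc) (ℕ.m+n≡0⇒n≡0 (f Fin.zero) h) i

  SameStat-mark : ∀ {n} {x y : SVec n} → SameStat x y → ∀ p → ∃ λ q → cycleOf x p ≡ cycleOf y q
  SameStat-mark {x = x} {y} same p with sum-nonZero (λ i → hit (cycleOf y i) (cycleOf x p))
    (λ h → case trans (sym (hit-refl (cycleOf x p))) (sum-zero (λ i → hit (cycleOf x i) (cycleOf x p)) (trans (same _) h) p) of λ ())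
    where open import Function using (case_of_)
  ... | q , h = q , sym (hit⇒≡ _ _ h)

  join : ∀ {n} → Fin (suc n) → Fin (suc n) → Bool → SVec n → SVec (suc n)
  join p q e z = insertAt (V.map (up q) z) p (q , e)

  module Join {n} (p q : Fin (suc n)) (e : Bool) (z : SVec n) where

    lookup-join-p : lookup (join p q e z) p ≡ (q , e)
    lookup-join-p = insertAt-lookup (V.map (up q) z) p _

    lookup-join : ∀ i → lookup (join p q e z) (punchIn p i) ≡ up q (lookup z i)
    lookup-join i = trans (insertAt-punchIn (V.map (up q) z) p _ i) (lookup-map i (up q) z)

    join-p : ∀ t → act (join p q e z) (p , t) ≡ (q , t ·s e)
    join-p t rewrite lookup-join-p = refl

    join-up : ∀ a → act (join p q e z) (up p a) ≡ up q (act z a)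
    join-up (i , t) rewrite lookup-join i = refl

    Inj-join : Inj z → Inj (join p q e z)
    Inj-join iz .injective {i} {j} eq with punchView p i | punchView p j
    ... | here     | here = refl
    ... | here     | there j′ rewrite lookup-join-p | lookup-join j′ = ⊥-elim (punchInᵢ≢i q _ (sym eq))
    ... | there i′ | here rewrite lookup-join-p | lookup-join i′ = ⊥-elim (punchInᵢ≢i q _ eq)
    ... | there i′ | there j′ rewrite lookup-join i′ | lookup-join j′ =
      cong (punchIn p) (iz .injective (punchIn-injective q _ _ eq))

  Intertwines : ∀ {n} → SVec n → SVec n → SVec n → Set
  Intertwines z x y = ∀ a → act z (act x a) ≡ act y (act z a)

  ·s-double : ∀ s t → s ·s (s ·s t) ≡ t
  ·s-double s t = trans (sym (·s-assoc s s t)) (trans (cong (_·s t) (·s-self s)) (·s-identityˡ t))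

  intertwines-insF : ∀ {n} {x y z : SVec n} p q s → Intertwines z x y →
    Intertwines (join p q true z) (insF p s x) (insF q s y)
  intertwines-insF {x = x} {y} {z} p q s h (i , t) with punchView p i
  ... | here = begin
    act w (act (insF p s x) (p , t))
      ≡⟨ cong (act w) (X.act-p t) ⟩
    act w (p , t ·s s)
      ≡⟨ join-p (t ·s s) ⟩
    (q , (t ·s s) ·s true)
      ≡⟨ cong (q ,_) (trans (·s-identityʳ _) (cong (_·s s) (sym (·s-identityʳ t)))) ⟩
    (q , (t ·s true) ·s s)
      ≡⟨ sym (Y.act-p (t ·s true)) ⟩
    act (insF q s y) (q , t ·s true)
      ≡⟨ cong (act (insF q s y)) (sym (join-p t)) ⟩
    act (insF q s y) (act w (p , t))       ∎
    where
    open ≡-Reasoning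
    open Join p q true z
    module X = Fixed p s x
    module Y = Fixed q s y
    w = join p q true z
  ... | there i′ = begin
    act w (act (insF p s x) (up p (i′ , t)))
      ≡⟨ cong (act w) (X.act-up (i′ , t)) ⟩
    act w (up p (act x (i′ , t)))
      ≡⟨ join-up (act x (i′ , t)) ⟩
    up q (act z (act x (i′ , t)))
      ≡⟨ cong (up q) (h (i′ , t)) ⟩
    up q (act y (act z (i′ , t)))
      ≡⟨ sym (Y.act-up (act z (i′ , t))) ⟩
    act (insF q s y) (up q (act z (i′ , t)))
      ≡⟨ cong (act (insF q s y)) (sym (join-up (i′ , t))) ⟩
    act (insF q s y) (act w (up p (i′ , t)))  ∎
    where
    open ≡-Reasoning
    open Join p q true z
    module X = Fixed p s x
    module Y = Fixed q s y
    w = join p q true z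

  -- Origin of the sign of the new entry: if `p` goes to e q, then p ↦ s c ↦ s u d has to agree with
  -- p ↦ e q ↦ e t d, which forces e = s u t. The same value matches the edges into `p` and `q`.
  intertwines-insC : ∀ {n} {x y z : SVec n} p q c d s t u → Inj z → lookup z c ≡ (d , u) → Intertwines z x y →
    Intertwines (join p q (s ·s (u ·s t)) z) (insC p c s x) (insC q d t y)
  intertwines-insC {x = x} {y} {z} p q c d s t u iz zc h (i , v) with punchView p i
  ... | here = begin
    act w (act (insC p c s x) (p , v))
      ≡⟨ cong (act w) (X.act-p v) ⟩
    act w (up p (c , v ·s s))
      ≡⟨ join-up (c , v ·s s) ⟩
    up q (act z (c , v ·s s))
      ≡⟨ cong (λ b → up q (proj₁ b , (v ·s s) ·s proj₂ b)) zc ⟩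
    up q (d , (v ·s s) ·s u)
      ≡⟨ cong (λ r → up q (d , r)) sign ⟩
    up q (d , (v ·s e) ·s t)
      ≡⟨ sym (Y.act-p (v ·s e)) ⟩
    act (insC q d t y) (q , v ·s e)
      ≡⟨ cong (act (insC q d t y)) (sym (join-p v)) ⟩
    act (insC q d t y) (act w (p , v))       ∎
    where
    open ≡-Reasoning
    e = s ·s (u ·s t)
    open Join p q e z
    module X = Cyclic p c s x
    module Y = Cyclic q d t y
    w = join p q e z
    sign : (v ·s s) ·s u ≡ (v ·s e) ·s t
    sign = trans (·s-assoc v s u) (trans (cong (v ·s_) (sym (trans (·s-assoc s _ t) (cong (s ·s_)
             (trans (·s-assoc u t t) (trans (cong (u ·s_) (·s-self t)) (·s-identityʳ u))))))) (sym (·s-assoc v e t)))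
  ... | there i′ = body (proj₁ (act x a) Fin.≟ c)
    where
    open ≡-Reasoning
    a = (i′ , v)
    e = s ·s (u ·s t)
    open Join p q e z
    module X = Cyclic p c s x
    module Y = Cyclic q d t y
    w = join p q e z
    body : Dec (proj₁ (act x a) ≡ c) → act w (act (insC p c s x) (up p a)) ≡ act (insC q d t y) (act w (up p a))
    body (yes xa≡c) = begin
      act w (act (insC p c s x) (up p a))
        ≡⟨ cong (act w) (X.act-hit a xa≡c) ⟩
      act w (p , r ·s s)
        ≡⟨ join-p (r ·s s) ⟩
      (q , (r ·s s) ·s (s ·s (u ·s t)))
        ≡⟨ cong (q ,_) sign ⟩
      (q , (r ·s u) ·s t)
        ≡⟨ cong (λ g → q , g ·s t) (sym (cong proj₂ yza)) ⟩
      (q , proj₂ (act y (act z a)) ·s t)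
        ≡⟨ sym (Y.act-hit (act z a) (cong proj₁ yza)) ⟩
      act (insC q d t y) (up q (act z a))
        ≡⟨ cong (act (insC q d t y)) (sym (join-up a)) ⟩
      act (insC q d t y) (act w (up p a))         ∎
      where
      r = proj₂ (act x a)
      yza : act y (act z a) ≡ (d , r ·s u)
      yza = trans (sym (h a)) (trans (cong (λ g → act z (g , r)) xa≡c) (cong (λ b → proj₁ b , r ·s proj₂ b) zc))
      sign : (r ·s s) ·s (s ·s (u ·s t)) ≡ (r ·s u) ·s t
      sign = trans (·s-assoc r s _) (trans (cong (r ·s_) (·s-double s _)) (sym (·s-assoc r u t)))
    body (no miss) = begin
      act w (act (insC p c s x) (up p a))
        ≡⟨ cong (act w) (X.act-miss a miss) ⟩
      act w (up p (act x a))
        ≡⟨ join-up (act x a) ⟩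
      up q (act z (act x a))
        ≡⟨ cong (up q) (h a) ⟩
      up q (act y (act z a))
        ≡⟨ sym (Y.act-miss (act z a) miss′) ⟩
      act (insC q d t y) (up q (act z a))
        ≡⟨ cong (act (insC q d t y)) (sym (join-up a)) ⟩
      act (insC q d t y) (act w (up p a))         ∎
      where
      miss′ : proj₁ (act y (act z a)) ≢ d
      miss′ eq = miss (iz .injective (trans (cong proj₁ (h a)) (trans eq (sym (cong proj₁ zc)))))

  Conjugator : ∀ {n} → SVec n → SVec n → Set
  Conjugator x y = ∃ λ z → Inj z × Intertwines z x y

  -- In the induction the edge from `p` to `c` must be matched with the edge from `q` to `d`, so the
  -- conjugator of the smaller elements has to carry `c` to ±d. For this reason a prescribed pair of
  -- points of equal type belongs to the statement.
  ConjugateMarked : ℕ → Set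
  ConjugateMarked n = ∀ {x y : SVec n} → Inj x → Inj y → SameStat x y → ∀ p q → cycleOf x p ≡ cycleOf y q →
    ∃ λ z → (Inj z × Intertwines z x y) × proj₁ (lookup z p) ≡ q

  -- Once a whole cycle has been peeled off, no successor of the marked point remains; a fresh pair
  -- is chosen, which exists because the statistics agree.
  unmark : ∀ {n} → ConjugateMarked n → ∀ {x y : SVec n} → Inj x → Inj y → SameStat x y → Conjugator x y
  unmark {zero} _ ix iy same = V.[] , mkInj (λ {i} → λ {}) , λ ()
  unmark {suc n} marked ix iy same = proj₁ rec , proj₁ (proj₂ rec)
    where
    mark = SameStat-mark same Fin.zero
    rec = marked ix iy same Fin.zero (proj₁ mark) (proj₂ mark)

  -- Removing the marked points leaves elements with equal statistics, in which the
  -- points following the marked ones have equal types again.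
  conjugate-marked : ∀ n → ConjugateMarked n
  conjugate-marked (suc n) {x} {y} ix iy same p q eq with removal p x ix | removal q y iy
  ... | fixed s x′ ix′ | fixed t y′ iy′
    with trans (sym (cycleOf-unique ix (Fixed.HT-p p s x′))) (trans eq (cycleOf-unique iy (Fixed.HT-p q t y′)))
  ... | refl with unmark (conjugate-marked n) ix′ iy′ (SameStat-insF⁻ ix′ iy′ p q s same)
  ... | z , iz , h = join p q true z , (Join.Inj-join p q true z iz , intertwines-insF p q s h) , cong proj₁ (Join.lookup-join-p p q true z)
  -- The mixed cases would equate a cycle of length one with a cycle of length at least two.
  conjugate-marked (suc n) {x} {y} ix iy same p q eq | fixed s x′ ix′ | cyclic d t y′ iy′
    with pos (HT-cycleOf iy′ d) | trans (sym (cycleOf-unique ix (Fixed.HT-p p s x′))) (trans eq (cycleOf-unique iy (Cyclic.HT-p q d t y′ (HT-cycleOf iy′ d))))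
  ... | h | e = ⊥-elim (ℕ.<-irrefl (ℕ.suc-injective (cong proj₁ e)) h)
  conjugate-marked (suc n) {x} {y} ix iy same p q eq | cyclic c s x′ ix′ | fixed t y′ iy′
    with pos (HT-cycleOf ix′ c) | trans (sym (cycleOf-unique iy (Fixed.HT-p q t y′))) (trans (sym eq) (cycleOf-unique ix (Cyclic.HT-p p c s x′ (HT-cycleOf ix′ c))))
  ... | h | e = ⊥-elim (ℕ.<-irrefl (ℕ.suc-injective (cong proj₁ e)) h)
  conjugate-marked (suc n) {x} {y} ix iy same p q eq | cyclic c s x′ ix′ | cyclic d t y′ iy′ =
    join p q e z , (Join.Inj-join p q e z iz , intertwines-insC p q c d s t u iz zc h) , cong proj₁ (Join.lookup-join-p p q e z)
    where
    types≡ : (suc (proj₁ (cycleOf x′ c)) , proj₂ (cycleOf x′ c)) ≡ (suc (proj₁ (cycleOf y′ d)) , proj₂ (cycleOf y′ d))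
    types≡ = trans (sym (cycleOf-unique ix (Cyclic.HT-p p c s x′ (HT-cycleOf ix′ c)))) (trans eq (cycleOf-unique iy (Cyclic.HT-p q d t y′ (HT-cycleOf iy′ d))))
    eq′ : cycleOf x′ c ≡ cycleOf y′ d
    eq′ = cong₂ _,_ (ℕ.suc-injective (cong proj₁ types≡)) (cong proj₂ types≡)
    rec = conjugate-marked n ix′ iy′ (SameStat-insC⁻ ix′ iy′ p q c d s t eq′ same) c d eq′
    z = proj₁ rec
    iz = proj₁ (proj₁ (proj₂ rec))
    h = proj₂ (proj₁ (proj₂ rec))
    u = proj₂ (lookup z c)
    zc : lookup z c ≡ (d , u)
    zc = cong (_, u) (proj₂ (proj₂ rec))
    e = s ·s (u ·s t)

  conjugate : ∀ {n} {x y : SVec n} → Inj x → Inj y → SameStat x y → Conjugator x y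
  conjugate = unmark (conjugate-marked _)

  HT-intertwines : ∀ {n} {x y z : SVec n} → Inj z → Intertwines z x y → ∀ {i τ} → HT x i τ → HT y (proj₁ (lookup z i)) τ
  HT-intertwines {x = x} {y} {z} iz h {i} {j , θ} hx = ht (pos hx) ret λ t 1≤t t<j eq →
    first hx t 1≤t t<j (iz .injective (trans (cong proj₁ (walk t (i , true))) (trans (cong (λ a → proj₁ (iter y t a)) (act-lookup z i)) (trans (cong proj₁ (iter-sign y t _ s)) eq))))
    where
    s = proj₂ (lookup z i)
    walk : ∀ t a → act z (iter x t a) ≡ iter y t (act z a)
    walk zero a = refl
    walk (suc t) a = trans (h (iter x t a)) (cong (act y) (walk t a))
    signed : iter y j (proj₁ (lookup z i) , s) ≡ (proj₁ (lookup z i) , θ ·s s)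
    signed = trans (cong (iter y j) (sym (act-lookup z i))) (trans (sym (walk j (i , true))) (cong (act z) (return hx)))
    ret : iter y j (proj₁ (lookup z i) , true) ≡ (proj₁ (lookup z i) , θ)
    ret = trans (cong (λ r → iter y j (proj₁ (lookup z i) , r)) (sym (·s-self s))) (trans (iter-• y j s (proj₁ (lookup z i) , s))
          (trans (cong (s •_) signed) (cong (proj₁ (lookup z i) ,_) (trans (cong (s ·s_) (·s-comm θ s)) (·s-double s θ)))))

  -- An intertwiner carries points to points of the same type, so it only reorders the sum.
  SameStat-conjugate : ∀ {n} {x y z : SVec n} → Inj x → Inj y → Inj z → Intertwines z x y → SameStat x y
  SameStat-conjugate {x = x} {y} {z} ix iy iz h τ = trans
    (Σℕ.sum-cong-≗ (λ i → cong (λ σ → hit σ τ) (sym (cycleOf-unique iy (HT-intertwines iz h (HT-cycleOf ix i))))))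
    (sym (Σℕ.sum-permute (λ i → hit (cycleOf y i) τ) (perm iz)))

-- Rational sums over finite lists and over B_n.

module Summation where

  open CycleTypes
  open Insertion
  open CycleStatistics
  open import Data.Bool using (Bool; true; false; if_then_else_)
  open import Data.Empty using (⊥)
  open import Data.Nat as ℕ using (ℕ; zero; suc; _≤_)
  import Data.Nat.Properties as ℕ
  open import Data.Integer as ℤ using (ℤ)
  import Data.Integer.Properties as ℤ
  open import Data.Integer.Solver using () renaming (module +-*-Solver to ℤSolver)
  open import Data.Rational as ℚ using (ℚ; 0ℚ; 1ℚ; _+_; _*_; toℚᵘ)
  import Data.Rational.Properties as ℚ
  open import Data.Rational.Unnormalised as ℚᵘ using (mkℚᵘ; *≡*)
  import Data.Rational.Unnormalised.Properties as ℚᵘ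
  open import Data.Fin using (Fin)
  open import Data.Product hiding (map)
  open import Data.Sum using (inj₁; inj₂)
  open import Data.List using (List; []; _∷_; map; filter; concatMap; cartesianProductWith; length; _++_; allFin)
  open import Data.List.Properties using (map-∘)
  open import Data.List.Membership.Propositional using (_∈_)
  open import Data.List.Membership.Propositional.Properties
  open import Data.List.Relation.Unary.Any using (here; there)
  open import Data.List.Relation.Unary.Unique.Propositional using (Unique; []; _∷_)
  import Data.List.Relation.Unary.Unique.Propositional.Properties as Unique
  import Data.List.Relation.Unary.All as All
  open import Data.List.Relation.Binary.Permutation.Propositional using (_↭_)
  import Data.List.Relation.Binary.Permutation.Propositional as Perm
  open import Data.List.Relation.Binary.BagAndSetEquality using (∼bag⇒↭)
  open import Data.List.Membership.Propositional.Properties.WithK using (unique∧set⇒bag)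
  open import Function using (_∘_; mk⇔)
  open import Relation.Binary.PropositionalEquality
  open import Relation.Nullary
  open import Relation.Nullary.Decidable using (T?)
  open import Data.Vec as V using (Vec)
  import Data.Vec.Properties as V

  ∑ : ∀ {A : Set} → List A → (A → ℚ) → ℚ
  ∑ xs f = sumℚ (map f xs)

  module _ {A : Set} where

    ∑-cong-∈ : ∀ (xs : List A) {f g} → (∀ {x} → x ∈ xs → f x ≡ g x) → ∑ xs f ≡ ∑ xs g
    ∑-cong-∈ [] h = refl
    ∑-cong-∈ (x ∷ xs) h = cong₂ _+_ (h (here refl)) (∑-cong-∈ xs (h ∘ there))

    ∑-cong : ∀ (xs : List A) {f g} → (∀ x → f x ≡ g x) → ∑ xs f ≡ ∑ xs g
    ∑-cong xs h = ∑-cong-∈ xs (λ {x} _ → h x)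

    ∑-++ : ∀ (xs ys : List A) f → ∑ (xs ++ ys) f ≡ ∑ xs f + ∑ ys f
    ∑-++ [] ys f = sym (ℚ.+-identityˡ _)
    ∑-++ (x ∷ xs) ys f = trans (cong (f x +_) (∑-++ xs ys f)) (sym (ℚ.+-assoc (f x) _ _))

    ∑-0 : ∀ (xs : List A) → ∑ xs (λ _ → 0ℚ) ≡ 0ℚ
    ∑-0 [] = refl
    ∑-0 (x ∷ xs) = trans (ℚ.+-identityˡ _) (∑-0 xs)

    ∑-≡0 : ∀ (xs : List A) {f} → (∀ {x} → x ∈ xs → f x ≡ 0ℚ) → ∑ xs f ≡ 0ℚ
    ∑-≡0 xs h = trans (∑-cong-∈ xs h) (∑-0 xs)

    ∑-+ : ∀ (xs : List A) f g → ∑ xs (λ x → f x + g x) ≡ ∑ xs f + ∑ xs g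
    ∑-+ [] f g = refl
    ∑-+ (x ∷ xs) f g = begin
      (f x + g x) + ∑ xs (λ x → f x + g x)
        ≡⟨ cong ((f x + g x) +_) (∑-+ xs f g) ⟩
      (f x + g x) + (∑ xs f + ∑ xs g)
        ≡⟨ ℚ.+-assoc (f x) (g x) _ ⟩
      f x + (g x + (∑ xs f + ∑ xs g))
        ≡⟨ cong (f x +_) (trans (sym (ℚ.+-assoc (g x) (∑ xs f) _)) (trans (cong (_+ ∑ xs g) (ℚ.+-comm (g x) (∑ xs f))) (ℚ.+-assoc (∑ xs f) (g x) _))) ⟩
      f x + (∑ xs f + (g x + ∑ xs g))
        ≡⟨ sym (ℚ.+-assoc (f x) (∑ xs f) _) ⟩
      (f x + ∑ xs f) + (g x + ∑ xs g)         ∎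
      where open ≡-Reasoning

    ∑-*ˡ : ∀ (xs : List A) c f → ∑ xs (λ x → c * f x) ≡ c * ∑ xs f
    ∑-*ˡ [] c f = sym (ℚ.*-zeroʳ c)
    ∑-*ˡ (x ∷ xs) c f = trans (cong (c * f x +_) (∑-*ˡ xs c f)) (sym (ℚ.*-distribˡ-+ c (f x) _))

    ∑-*ʳ : ∀ (xs : List A) c f → ∑ xs (λ x → f x * c) ≡ ∑ xs f * c
    ∑-*ʳ xs c f = trans (∑-cong xs (λ x → ℚ.*-comm (f x) c)) (trans (∑-*ˡ xs c f) (ℚ.*-comm c _))

    ∑-↭ : ∀ {xs ys : List A} f → xs ↭ ys → ∑ xs f ≡ ∑ ys f
    ∑-↭ f Perm.refl = refl
    ∑-↭ f (Perm.prep x p) = cong (f x +_) (∑-↭ f p)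
    ∑-↭ {x ∷ y ∷ xs} f (Perm.swap x y p) = trans (sym (ℚ.+-assoc (f x) (f y) _))
      (trans (cong₂ _+_ (ℚ.+-comm (f x) (f y)) (∑-↭ f p)) (ℚ.+-assoc (f y) (f x) _))
    ∑-↭ f (Perm.trans p q) = trans (∑-↭ f p) (∑-↭ f q)

    ∑-map : ∀ {B : Set} (g : A → B) xs f → ∑ (map g xs) f ≡ ∑ xs (f ∘ g)
    ∑-map g xs f = cong sumℚ (sym (map-∘ xs))

  module _ {A B : Set} where

    ∑-swap : ∀ (xs : List A) (ys : List B) (f : A → B → ℚ) → ∑ xs (λ x → ∑ ys (f x)) ≡ ∑ ys (λ y → ∑ xs (λ x → f x y))
    ∑-swap [] ys f = sym (∑-0 ys)
    ∑-swap (x ∷ xs) ys f = trans (cong (∑ ys (f x) +_) (∑-swap xs ys f)) (sym (∑-+ ys (f x) (λ y → ∑ xs (λ x → f x y))))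

    ∑-cartesian : ∀ {C : Set} (g : A → B → C) xs ys f → ∑ (cartesianProductWith g xs ys) f ≡ ∑ xs (λ x → ∑ ys (λ y → f (g x y)))
    ∑-cartesian g [] ys f = refl
    ∑-cartesian g (x ∷ xs) ys f = trans (∑-++ (map (g x) ys) _ f) (cong₂ _+_ (∑-map (g x) ys f) (∑-cartesian g xs ys f))

    concatMap-cartesian : ∀ {C : Set} (g : A → B → C) xs ys → concatMap (λ x → map (g x) ys) xs ≡ cartesianProductWith g xs ys
    concatMap-cartesian g [] ys = refl
    concatMap-cartesian g (x ∷ xs) ys = cong (map (g x) ys ++_) (concatMap-cartesian g xs ys)

  ⟦_⟧ : Bool → ℚ
  ⟦ b ⟧ = if b then 1ℚ else 0ℚ

  ∑-filter : ∀ {A : Set} (p : A → Bool) xs f → ∑ (filter (λ x → T? (p x)) xs) f ≡ ∑ xs (λ x → ⟦ p x ⟧ * f x)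
  ∑-filter p [] f = refl
  ∑-filter p (x ∷ xs) f with p x
  ... | true  = cong₂ _+_ (sym (ℚ.*-identityˡ (f x))) (∑-filter p xs f)
  ... | false = trans (∑-filter p xs f) (trans (sym (ℚ.+-identityˡ _)) (cong (_+ _) (sym (ℚ.*-zeroˡ (f x)))))

  ι : ℤ → ℚ
  ι p = p ℚ./ 1

  -- `ℚ./` reduces to lowest terms, which blocks computation on open terms; identities are therefore
  -- checked by cross-multiplication of unnormalised representatives.
  toℚᵘ-/ : ∀ p d → toℚᵘ (p ℚ./ suc d) ℚᵘ.≃ mkℚᵘ p d
  toℚᵘ-/ p d = ℚ.toℚᵘ-fromℚᵘ (mkℚᵘ p d)

  ι-+ : ∀ p q → ι (p ℤ.+ q) ≡ ι p + ι q
  ι-+ p q = ℚ.toℚᵘ-injective (ℚᵘ.≃-trans (toℚᵘ-/ (p ℤ.+ q) 0) (ℚᵘ.≃-trans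
    (*≡* (ℤSolver.solve 2 (λ p q → (p :+ q) :* con (ℤ.+ 1) := (p :* con (ℤ.+ 1) :+ q :* con (ℤ.+ 1)) :* con (ℤ.+ 1)) refl p q))
    (ℚᵘ.≃-sym (ℚᵘ.≃-trans (ℚ.toℚᵘ-homo-+ (ι p) (ι q)) (ℚᵘ.+-cong (toℚᵘ-/ p 0) (toℚᵘ-/ q 0))))))
    where open ℤSolver

  ι-* : ∀ p q → ι (p ℤ.* q) ≡ ι p * ι q
  ι-* p q = ℚ.toℚᵘ-injective (ℚᵘ.≃-trans (toℚᵘ-/ (p ℤ.* q) 0)
    (ℚᵘ.≃-sym (ℚᵘ.≃-trans (ℚ.toℚᵘ-homo-* (ι p) (ι q)) (ℚᵘ.*-cong (toℚᵘ-/ p 0) (toℚᵘ-/ q 0)))))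

  divℚ-* : ∀ p d → 1 ≤ d → divℚ p d * ι (ℤ.+ d) ≡ ι p
  divℚ-* p (suc d) _ = ℚ.toℚᵘ-injective (ℚᵘ.≃-trans (ℚ.toℚᵘ-homo-* (p ℚ./ suc d) (ι (ℤ.+ suc d)))
    (ℚᵘ.≃-trans (ℚᵘ.*-cong (toℚᵘ-/ p d) (toℚᵘ-/ (ℤ.+ suc d) 0)) (ℚᵘ.≃-trans (*≡* cross) (ℚᵘ.≃-sym (toℚᵘ-/ p 0)))))
    where
    cross : (p ℤ.* ℤ.+ suc d) ℤ.* ℤ.+ 1 ≡ p ℤ.* ℤ.+ (suc d ℕ.* 1)
    cross = trans (ℤ.*-identityʳ _) (cong (λ e → p ℤ.* ℤ.+ e) (sym (ℕ.*-identityʳ (suc d))))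

  ιℕ : ℕ → ℚ
  ιℕ n = ι (ℤ.+ n)

  ιℕ-+ : ∀ m n → ιℕ (m ℕ.+ n) ≡ ιℕ m + ιℕ n
  ιℕ-+ m n = ι-+ (ℤ.+ m) (ℤ.+ n)

  ιℕ-* : ∀ m n → ιℕ (m ℕ.* n) ≡ ιℕ m * ιℕ n
  ιℕ-* m n = trans (cong ι (ℤ.pos-* m n)) (ι-* (ℤ.+ m) (ℤ.+ n))

  1/ : ℕ → ℚ
  1/ = divℚ (ℤ.+ 1)

  1/-* : ∀ d → 1 ≤ d → 1/ d * ιℕ d ≡ 1ℚ
  1/-* d 1≤d = divℚ-* (ℤ.+ 1) d 1≤d

  *-cancelʳ-ιℕ : ∀ d → 1 ≤ d → ∀ {a b} → a * ιℕ d ≡ b * ιℕ d → a ≡ b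
  *-cancelʳ-ιℕ d 1≤d {a} {b} eq = trans (sym (undo a)) (trans (cong (_* 1/ d) eq) (undo b))
    where
    undo : ∀ c → (c * ιℕ d) * 1/ d ≡ c
    undo c = trans (ℚ.*-assoc c (ιℕ d) (1/ d)) (trans (cong (c *_) (trans (ℚ.*-comm (ιℕ d) (1/ d)) (1/-* d 1≤d))) (ℚ.*-identityʳ c))

  divℚ-unique : ∀ p d → 1 ≤ d → ∀ {q} → q * ιℕ d ≡ ι p → divℚ p d ≡ q
  divℚ-unique p d 1≤d eq = *-cancelʳ-ιℕ d 1≤d (trans (divℚ-* p d 1≤d) (sym eq))

  ∑-const : ∀ {A : Set} (xs : List A) c → ∑ xs (λ _ → c) ≡ ιℕ (length xs) * c
  ∑-const [] c = sym (ℚ.*-zeroˡ c)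
  ∑-const (x ∷ xs) c = trans (cong₂ _+_ (sym (ℚ.*-identityˡ c)) (∑-const xs c))
    (trans (sym (ℚ.*-distribʳ-+ c 1ℚ (ιℕ (length xs)))) (cong (_* c) (sym (ιℕ-+ 1 (length xs)))))

  ι-sumℤ : ∀ {A : Set} (xs : List A) f → ι (sumℤ (map f xs)) ≡ ∑ xs (ι ∘ f)
  ι-sumℤ [] f = refl
  ι-sumℤ (x ∷ xs) f = trans (ι-+ (f x) _) (cong (ι (f x) +_) (ι-sumℤ xs f))

  -- Changes of the summation variable rest on this: the order in which `elemsB` enumerates is
  -- irrelevant, and only membership has to be compared.
  ↭-members : ∀ {A : Set} {xs ys : List A} → Unique xs → Unique ys → (∀ {x} → x ∈ xs → x ∈ ys) → (∀ {x} → x ∈ ys → x ∈ xs) → xs ↭ ys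
  ↭-members ux uy to from = ∼bag⇒↭ (unique∧set⇒bag ux uy (mk⇔ to from))

  signs : List Bool
  signs = true ∷ false ∷ []

  signs-unique : Unique signs
  signs-unique = ((λ ()) All.∷ All.[]) ∷ (All.[] ∷ [])

  ∈-signs : ∀ s → s ∈ signs
  ∈-signs true = here refl
  ∈-signs false = there (here refl)

  allPts≡ : ∀ n → allPts n ≡ cartesianProductWith _,_ (allFin n) signs
  allPts≡ n = concatMap-cartesian _,_ (allFin n) signs

  allPts-unique : ∀ n → Unique (allPts n)
  allPts-unique n = subst Unique (sym (allPts≡ n))
    (Unique.cartesianProductWith⁺ _,_ (λ { refl → refl , refl }) (Unique.allFin⁺ n) signs-unique)

  ∈-allPts : ∀ {n} (a : Pt n) → a ∈ allPts n
  ∈-allPts {n} (i , s) = subst (_ ∈_) (sym (allPts≡ n)) (∈-cartesianProductWith⁺ _,_ (∈-allFin i) (∈-signs s))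

  ∑-allPts : ∀ n f → ∑ (allPts n) f ≡ ∑ (allFin n) (λ i → ∑ signs (λ s → f (i , s)))
  ∑-allPts n f = trans (cong (λ xs → ∑ xs f) (allPts≡ n)) (∑-cartesian _,_ (allFin n) signs f)

  allVecs-unique : ∀ {A : Set} {xs : List A} → Unique xs → ∀ n → Unique (allVecs xs n)
  allVecs-unique ux zero = All.[] ∷ []
  allVecs-unique {xs = xs} ux (suc n) = subst Unique (sym (concatMap-cartesian V._∷_ xs (allVecs xs n)))
    (Unique.cartesianProductWith⁺ V._∷_ V.∷-injective ux (allVecs-unique ux n))

  ∈-allVecs : ∀ {A : Set} {xs : List A} → (∀ a → a ∈ xs) → ∀ {n} (v : Vec A n) → v ∈ allVecs xs n
  ∈-allVecs all V.[] = here refl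
  ∈-allVecs {xs = xs} all {suc n} (a V.∷ v) = subst (_ ∈_) (sym (concatMap-cartesian V._∷_ xs (allVecs xs n)))
    (∈-cartesianProductWith⁺ V._∷_ (all a) (∈-allVecs all v))

  elemsB-unique : ∀ n → Unique (elemsB n)
  elemsB-unique n = Unique.filter⁺ _ (allVecs-unique (allPts-unique n) n)

  ∈-elemsB : ∀ {n} {x : SVec n} → Inj x → x ∈ elemsB n
  ∈-elemsB {x = x} ix = ∈-filter⁺ _ (∈-allVecs ∈-allPts x) (Inj⇒InB ix)

  ∈-elemsB⁻ : ∀ {n} {x : SVec n} → x ∈ elemsB n → Inj x
  ∈-elemsB⁻ {n} {x} x∈ = InB⇒Inj {w = x} (proj₂ (∈-filter⁻ (λ v → T? (isSigned v)) {xs = allVecs (allPts n) n} x∈))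

  ∑-elemsB-bijection : ∀ {n} (f g : SVec n → SVec n) → (∀ {x} → Inj x → Inj (f x)) → (∀ {x} → Inj x → Inj (g x)) →
    (∀ x → g (f x) ≡ x) → (∀ x → f (g x) ≡ x) → ∀ h → ∑ (elemsB n) h ≡ ∑ (elemsB n) (h ∘ f)
  ∑-elemsB-bijection {n} f g inj-f inj-g gf fg h = trans (sym (∑-↭ h images)) (∑-map f (elemsB n) h)
    where
    images : map f (elemsB n) ↭ elemsB n
    images = ↭-members (Unique.map⁺ (λ {x} {y} eq → trans (sym (gf x)) (trans (cong g eq) (gf y))) (elemsB-unique n)) (elemsB-unique n) to from
      where
      to : ∀ {x} → x ∈ map f (elemsB n) → x ∈ elemsB n
      to x∈ with ∈-map⁻ f x∈
      ... | y , y∈ , refl = ∈-elemsB (inj-f (∈-elemsB⁻ y∈))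
      from : ∀ {x} → x ∈ elemsB n → x ∈ map f (elemsB n)
      from {x} x∈ = subst (_∈ map f (elemsB n)) (fg x) (∈-map⁺ f (∈-elemsB (inj-g (∈-elemsB⁻ x∈))))

  insertions : ∀ {n} → Fin (suc n) → List (SVec (suc n))
  insertions {n} p = cartesianProductWith (insF p) signs (elemsB n) ++
                     cartesianProductWith (λ a → insC p (proj₁ a) (proj₂ a)) (allPts n) (elemsB n)

  -- `removal` shows that every element occurs; injectivity of the two insertions, and their
  -- disjointness at the image of `p`, show that none occurs twice.
  elemsB-insertions : ∀ {n} (p : Fin (suc n)) → elemsB (suc n) ↭ insertions p
  elemsB-insertions {n} p = ↭-members (elemsB-unique (suc n)) unique to from
    where
    insC′ = λ (a : Pt n) → insC p (proj₁ a) (proj₂ a)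
    unique : Unique (insertions p)
    unique = Unique.++⁺
      (Unique.cartesianProductWith⁺ (insF p) (insF-injective p) signs-unique (elemsB-unique n))
      (Unique.cartesianProductWith⁺ insC′ (λ eq → let (c≡ , s≡) , x≡ = insC-injective p eq in cong₂ _,_ c≡ s≡ , x≡) (allPts-unique n) (elemsB-unique n))
      λ (x∈F , x∈C) → disjoint (∈-cartesianProductWith⁻ (insF p) signs (elemsB n) x∈F) (∈-cartesianProductWith⁻ insC′ (allPts n) (elemsB n) x∈C)
      where
      disjoint : ∀ {x} → (∃₂ λ s y → s ∈ signs × y ∈ elemsB n × x ≡ insF p s y) → (∃₂ λ a y → a ∈ allPts n × y ∈ elemsB n × x ≡ insC′ a y) → ⊥
      disjoint (_ , _ , _ , _ , eq) (_ , _ , _ , _ , eq′) = insF≢insC p (trans (sym eq) eq′)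
    to : ∀ {x} → x ∈ elemsB (suc n) → x ∈ insertions p
    to {x} x∈ with removal p x (∈-elemsB⁻ x∈)
    ... | fixed s y iy = ∈-++⁺ˡ (∈-cartesianProductWith⁺ (insF p) (∈-signs s) (∈-elemsB iy))
    ... | cyclic c s y iy = ∈-++⁺ʳ _ (∈-cartesianProductWith⁺ insC′ (∈-allPts (c , s)) (∈-elemsB iy))
    from : ∀ {x} → x ∈ insertions p → x ∈ elemsB (suc n)
    from x∈ with ∈-++⁻ (cartesianProductWith (insF p) signs (elemsB n)) x∈
    ... | inj₁ x∈F with ∈-cartesianProductWith⁻ (insF p) signs (elemsB n) x∈F
    ... | s , y , _ , y∈ , refl = ∈-elemsB (Inj-insF p (∈-elemsB⁻ y∈))
    from x∈ | inj₂ x∈C with ∈-cartesianProductWith⁻ insC′ (allPts n) (elemsB n) x∈C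
    ... | a , y , _ , y∈ , refl = ∈-elemsB (Inj-insC p (∈-elemsB⁻ y∈))

  ∑-insertions : ∀ {n} (p : Fin (suc n)) f → ∑ (elemsB (suc n)) f ≡
    ∑ signs (λ s → ∑ (elemsB n) (λ x → f (insF p s x))) +
    ∑ (allFin n) (λ c → ∑ signs (λ s → ∑ (elemsB n) (λ x → f (insC p c s x))))
  ∑-insertions {n} p f = trans (∑-↭ f (elemsB-insertions p)) (trans (∑-++ (cartesianProductWith (insF p) signs (elemsB n)) _ f)
    (cong₂ _+_ (∑-cartesian (insF p) signs (elemsB n) f) (trans (∑-cartesian insC′ (allPts n) (elemsB n) f) (∑-allPts n _))))
    where insC′ = λ (a : Pt n) → insC p (proj₁ a) (proj₂ a)

-- The character χ and the recursion for signed averages.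

module SignedAverages where

  open CycleTypes
  open Insertion
  open CycleStatistics
  open Conjugacy
  open Summation
  open import Data.Bool using (Bool; true; false)
  open import Data.Empty using (⊥-elim)
  open import Data.Nat as ℕ using (ℕ; zero; suc; z≤n; s≤s)
  import Data.Nat.Properties as ℕ
  open import Data.Integer as ℤ using (ℤ)
  open import Data.Rational as ℚ using (ℚ; 0ℚ; 1ℚ; _+_; _*_)
  import Data.Rational.Properties as ℚ
  open import Data.Rational.Solver using (module +-*-Solver)
  open import Data.Fin as Fin using (Fin; punchIn)
  open import Data.Fin.Properties as Fin using (punchInᵢ≢i)
  open import Data.Product hiding (map)
  open import Data.List as L using (allFin; foldr)
  open import Data.List.Properties as L using (map-tabulate; length-tabulate)
  open import Data.Vec using (lookup)
  open import Function using (_∘_; id)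
  open import Relation.Binary.PropositionalEquality
  open import Relation.Nullary

  -- `χ` in the multiplicative monoid `Bool`, as a product over `Fin n` in which an index can be
  -- split off and which can be reindexed by a permutation.
  sg : ∀ {n} → SVec n → Bool
  sg x = Πs.sum (λ i → proj₂ (lookup x i))

  signℤ-·s : ∀ s t → signℤ (s ·s t) ≡ signℤ s ℤ.* signℤ t
  signℤ-·s true true = refl
  signℤ-·s true false = refl
  signℤ-·s false true = refl
  signℤ-·s false false = refl

  χ≡ : ∀ {n} (x : SVec n) → χ x ≡ signℤ (sg x)
  χ≡ x = trans (cong (foldr ℤ._*_ (ℤ.+ 1)) (map-tabulate id (λ i → signℤ (proj₂ (lookup x i))))) (product (λ i → proj₂ (lookup x i)))
    where
    product : ∀ {n} (f : Fin n → Bool) → foldr ℤ._*_ (ℤ.+ 1) (L.tabulate (signℤ ∘ f)) ≡ signℤ (Πs.sum f)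
    product {zero} f = refl
    product {suc n} f = trans (cong (signℤ (f Fin.zero) ℤ.*_) (product (f ∘ Fin.suc))) (sym (signℤ-·s (f Fin.zero) _))

  sg-insF : ∀ {n} p s (x : SVec n) → sg (insF p s x) ≡ s ·s sg x
  sg-insF p s x = trans (Πs.sum-remove {i = p} (λ i → proj₂ (lookup (insF p s x) i)))
    (cong₂ _·s_ (cong proj₂ (lookup-insF-p p s x)) (Πs.sum-cong-≗ (λ i → cong proj₂ (lookup-insF p s x i))))

  mark : ∀ {n} → Fin n → Bool → Fin n → Bool
  mark c s i with i Fin.≟ c
  ... | yes _ = s
  ... | no _ = true

  sum-mark : ∀ {n} (c : Fin n) s → Πs.sum (mark c s) ≡ s
  sum-mark {suc n} c s = trans (Πs.sum-remove {i = c} (mark c s))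
    (trans (cong₂ _·s_ at-c (trans (Πs.sum-cong-≗ off-c) (Πs.sum-replicate-zero n))) (·s-identityʳ s))
    where
    at-c : mark c s c ≡ s
    at-c with c Fin.≟ c
    ... | yes _ = refl
    ... | no ne = ⊥-elim (ne refl)
    off-c : ∀ i → mark c s (punchIn c i) ≡ true
    off-c i with punchIn c i Fin.≟ c
    ... | yes eq = ⊥-elim (punchInᵢ≢i c i eq)
    ... | no _ = refl

  -- Both new edges carry the sign s, so that it cancels.
  sg-insC : ∀ {n} p c s {x : SVec n} → Inj x → sg (insC p c s x) ≡ sg x
  sg-insC p c s {x} ix = begin
    sg (insC p c s x)
      ≡⟨ Πs.sum-remove {i = p} (λ i → proj₂ (lookup (insC p c s x) i)) ⟩
    proj₂ (lookup (insC p c s x) p) ·s _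
      ≡⟨ cong₂ _·s_ (cong proj₂ (lookup-insC-p p c s x)) (Πs.sum-cong-≗ entry) ⟩
    s ·s Πs.sum (λ i → proj₂ (lookup x i) ·s mark c s (proj₁ (lookup x i)))
      ≡⟨ cong (s ·s_) (Πs.∑-distrib-+ (λ i → proj₂ (lookup x i)) _) ⟩
    s ·s (sg x ·s Πs.sum (λ i → mark c s (proj₁ (lookup x i))))
      ≡⟨ cong (λ t → s ·s (sg x ·s t)) (trans (sym (Πs.sum-permute (mark c s) (perm ix))) (sum-mark c s)) ⟩
    s ·s (sg x ·s s)
      ≡⟨ cong (s ·s_) (·s-comm (sg x) s) ⟩
    s ·s (s ·s sg x)
      ≡⟨ ·s-double s (sg x) ⟩
    sg x                                                                          ∎
    where
    open ≡-Reasoning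
    redirect-sign : ∀ a → proj₂ (redirect p c s a) ≡ proj₂ a ·s mark c s (proj₁ a)
    redirect-sign (i , t) with i Fin.≟ c
    ... | yes _ = refl
    ... | no _ = sym (·s-identityʳ t)
    entry : ∀ i → proj₂ (lookup (insC p c s x) (punchIn p i)) ≡ proj₂ (lookup x i) ·s mark c s (proj₁ (lookup x i))
    entry i = trans (cong proj₂ (lookup-insC p c s x i)) (redirect-sign (lookup x i))

  -- Both composites have the same product of signs. Reindexing along the underlying permutations of
  -- `x` and `z` splits it once as `sg z` times `sg x` and once as `sg z` times `sg y`.
  sg-intertwines : ∀ {n} {x y z : SVec n} → Inj x → Inj z → Intertwines z x y → sg x ≡ sg y
  sg-intertwines {x = x} {y} {z} ix iz h = ·s-cancelˡ (sg z) (begin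
    sg z ·s sg x
      ≡⟨ ·s-comm (sg z) (sg x) ⟩
    sg x ·s sg z
      ≡⟨ cong (sg x ·s_) (Πs.sum-permute (λ i → proj₂ (lookup z i)) (perm ix)) ⟩
    sg x ·s Πs.sum (λ i → proj₂ (lookup z (proj₁ (lookup x i))))
      ≡⟨ sym (Πs.∑-distrib-+ (λ i → proj₂ (lookup x i)) _) ⟩
    Πs.sum (λ i → proj₂ (act z (lookup x i)))
      ≡⟨ Πs.sum-cong-≗ (λ i → cong proj₂ (trans (cong (act z) (sym (act-lookup x i))) (trans (h (i , true)) (cong (act y) (act-lookup z i))))) ⟩
    Πs.sum (λ i → proj₂ (act y (lookup z i)))
      ≡⟨ Πs.∑-distrib-+ (λ i → proj₂ (lookup z i)) _ ⟩
    sg z ·s Πs.sum (λ i → proj₂ (lookup y (proj₁ (lookup z i))))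
      ≡⟨ cong (sg z ·s_) (sym (Πs.sum-permute (λ i → proj₂ (lookup y i)) (perm iz))) ⟩
    sg z ·s sg y                                                                       ∎)
    where open ≡-Reasoning

  sgn : Bool → ℚ
  sgn s = ι (signℤ s)

  sgn-·s : ∀ s t → sgn (s ·s t) ≡ sgn s * sgn t
  sgn-·s s t = trans (cong ι (signℤ-·s s t)) (ι-* (signℤ s) (signℤ t))

  module Recursion (V : Ty → Ty) where

    open Statistics V

    -- Averaging functions of the counts, instead of monomials, turns the addition of a cycle into a
    -- plain shift of the argument; extracting a coefficient is one such function.
    Functional : Set
    Functional = (Ty → ℕ) → ℚ

    -- Counts are functions on `Ty` and are known to agree only pointwise; this condition stands in
    -- for function extensionality.
    Ext : Functional → Set
    Ext φ = ∀ {c c′} → (∀ τ → c τ ≡ c′ τ) → φ c ≡ φ c′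

    shift : ℕ → Ty → Functional → Functional
    shift ℓ τ φ c = φ (λ σ → c σ ℕ.+ ℓ ℕ.* hit τ σ)

    total : ∀ n → Functional → ℚ
    total n φ = ∑ (elemsB n) (λ x → sgn (sg x) * φ (stat x))

    totalI : ∀ n → ℕ → Functional → ℚ
    totalI n r φ = ∑ (allFin n) (λ p → ∑ (elemsB n) (λ x → sgn (sg x) * φ (statI x p r)))

    ∑-allFin-const : ∀ n c → ∑ (allFin n) (λ _ → c) ≡ ιℕ n * c
    ∑-allFin-const n c = trans (∑-const (allFin n) c) (cong (λ m → ιℕ m * c) (length-tabulate {n = n} id))

    -- Without phantoms the mark leaves no trace, so each element is counted once for each of its n
    -- points.
    totalI-0 : ∀ n {φ} → Ext φ → totalI n 0 φ ≡ ιℕ n * total n φ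
    totalI-0 n {φ} ext = trans (∑-cong (allFin n) (λ p → ∑-cong-∈ (elemsB n) (λ {x} x∈ →
      cong (sgn (sg x) *_) (ext (statI-0 (∈-elemsB⁻ x∈) p))))) (∑-allFin-const n (total n φ))

    -- The contribution does not depend on which of the n + 1 points is marked. If its cycle closes,
    -- the sign `s` enters χ and the type; if it continues before `c`, neither χ nor the counts see
    -- `s`, so the two signs contribute the same amount twice.
    totalI-suc : ∀ n r {φ} → Ext φ → totalI (suc n) r φ ≡
      ιℕ (suc n) * (∑ signs (λ s → sgn s * total n (shift (suc r) (V (suc r , s)) φ)) + (totalI n (suc r) φ + totalI n (suc r) φ))
    totalI-suc n r {φ} ext = trans (∑-cong (allFin (suc n)) (λ p → trans (∑-insertions p _) (cong₂ _+_
      (∑-cong signs (λ s → trans (∑-cong-∈ (elemsB n) (λ {x} x∈ → inserted-F p s (∈-elemsB⁻ x∈))) (∑-*ˡ (elemsB n) (sgn s) _)))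
      (trans (∑-cong (allFin n) (λ c → trans (∑-cong signs (λ s → ∑-cong-∈ (elemsB n) (λ {x} x∈ → inserted-C p c s (∈-elemsB⁻ x∈)))) (twice (∑ (elemsB n) _)))) (∑-+ (allFin n) _ _)))))
      (∑-allFin-const (suc n) _)
      where
      twice : ∀ a → ∑ signs (λ _ → a) ≡ a + a
      twice a = cong (a +_) (ℚ.+-identityʳ a)
      inserted-F : ∀ p s {x} → Inj x → sgn (sg (insF p s x)) * φ (statI (insF p s x) p r) ≡
                   sgn s * (sgn (sg x) * shift (suc r) (V (suc r , s)) φ (stat x))
      inserted-F p s {x} ix = trans (cong₂ _*_ (trans (cong sgn (sg-insF p s x)) (sgn-·s s (sg x))) (ext (statI-insF ix p s r))) (ℚ.*-assoc (sgn s) _ _)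
      inserted-C : ∀ p c s {x} → Inj x → sgn (sg (insC p c s x)) * φ (statI (insC p c s x) p r) ≡ sgn (sg x) * φ (statI x c (suc r))
      inserted-C p c s ix = cong₂ _*_ (cong sgn (sg-insC p c s ix)) (ext (statI-insC ix p c s r))

  ½ : ℚ
  ½ = 1/ 2

  -- β n = 1 / |B_n|
  β : ℕ → ℚ
  β zero = 1ℚ
  β (suc n) = β n * (½ * 1/ (suc n))

  ½-double : ∀ a → ½ * (a + a) ≡ a
  ½-double a = trans (cong (½ *_) (trans (sym (cong₂ _+_ (ℚ.*-identityˡ a) (ℚ.*-identityˡ a))) (sym (ℚ.*-distribʳ-+ a 1ℚ 1ℚ))))
    (trans (sym (ℚ.*-assoc ½ (1ℚ + 1ℚ) a)) (ℚ.*-identityˡ a))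

  β-suc : ∀ n a → β (suc n) * (ιℕ (suc n) * a) ≡ ½ * (β n * a)
  β-suc n a = begin
    (β n * (½ * 1/ (suc n))) * (ιℕ (suc n) * a)
      ≡⟨ solve 5 (λ b h i j a → (b :* (h :* i)) :* (j :* a) := h :* (b :* ((i :* j) :* a))) refl (β n) ½ (1/ (suc n)) (ιℕ (suc n)) a ⟩
    ½ * (β n * ((1/ (suc n) * ιℕ (suc n)) * a))
      ≡⟨ cong (λ e → ½ * (β n * (e * a))) (1/-* (suc n) (s≤s z≤n)) ⟩
    ½ * (β n * (1ℚ * a))
      ≡⟨ cong (λ e → ½ * (β n * e)) (ℚ.*-identityˡ a) ⟩
    ½ * (β n * a)                                    ∎
    where
    open ≡-Reasoning
    open +-*-Solver

  order : ℕ → ℚ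
  order n = ∑ (elemsB n) (λ _ → 1ℚ)

  -- An element extends in 2 ways by a new cycle and in 2n ways within an old one, 2(n + 1) in all.
  β-order : ∀ n → β n * order n ≡ 1ℚ
  β-order zero = refl
  β-order (suc n) = begin
    β (suc n) * order (suc n)
      ≡⟨ cong (β (suc n) *_) (∑-insertions {n} Fin.zero _) ⟩
    β (suc n) * ((b + (b + 0ℚ)) + ∑ (allFin n) (λ _ → b + (b + 0ℚ)))
      ≡⟨ cong (λ e → β (suc n) * ((b + (b + 0ℚ)) + e)) (trans (∑-const (allFin n) _) (cong (λ m → ιℕ m * (b + (b + 0ℚ))) (length-tabulate {n = n} id))) ⟩
    β (suc n) * ((b + (b + 0ℚ)) + ιℕ n * (b + (b + 0ℚ)))
      ≡⟨ cong (β (suc n) *_) (solve 2 (λ b m → (b :+ (b :+ con 0ℚ)) :+ m :* (b :+ (b :+ con 0ℚ)) := (con 1ℚ :+ m) :* (b :+ b)) refl b (ιℕ n)) ⟩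
    β (suc n) * ((1ℚ + ιℕ n) * (b + b))
      ≡⟨ cong (λ e → β (suc n) * (e * (b + b))) (sym (ιℕ-+ 1 n)) ⟩
    β (suc n) * (ιℕ (suc n) * (b + b))
      ≡⟨ β-suc n (b + b) ⟩
    ½ * (β n * (b + b))
      ≡⟨ cong (½ *_) (ℚ.*-distribˡ-+ (β n) b b) ⟩
    ½ * (β n * b + β n * b)
      ≡⟨ ½-double (β n * b) ⟩
    β n * b
      ≡⟨ β-order n ⟩
    1ℚ                                                         ∎
    where
    open ≡-Reasoning
    open +-*-Solver
    b = order n

  module Averages (V : Ty → Ty) where

    open Recursion V

    average : ∀ n → Functional → ℚ
    average n φ = β n * total n φ

    averageI : ∀ n → ℕ → Functional → ℚ
    averageI n r φ = β n * totalI n r φ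

    averageI-0 : ∀ n {φ} → Ext φ → averageI n 0 φ ≡ ιℕ n * average n φ
    averageI-0 n {φ} ext = trans (cong (β n *_) (totalI-0 n ext)) (trans (sym (ℚ.*-assoc (β n) (ιℕ n) _))
      (trans (cong (_* total n φ) (ℚ.*-comm (β n) (ιℕ n))) (ℚ.*-assoc (ιℕ n) (β n) _)))

    newCycle : ∀ n → ℕ → Functional → ℚ
    newCycle n ℓ φ = ½ * ∑ signs (λ s → sgn s * average n (shift ℓ (V (ℓ , s)) φ))

    -- Dividing by |B_{n+1}| removes the factor n + 1, and its ½ undoes the doubling of the second
    -- summand. The recursion is then free of coefficients and unfolds into one `newCycle` for each
    -- length.
    averageI-suc : ∀ n r {φ} → Ext φ → averageI (suc n) r φ ≡ newCycle n (suc r) φ + averageI n (suc r) φ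
    averageI-suc n r {φ} ext = begin
      β (suc n) * totalI (suc n) r φ
        ≡⟨ cong (β (suc n) *_) (totalI-suc n r ext) ⟩
      β (suc n) * (ιℕ (suc n) * (S + (t + t)))
        ≡⟨ β-suc n (S + (t + t)) ⟩
      ½ * (β n * (S + (t + t)))
        ≡⟨ solve 4 (λ h b S t → h :* (b :* (S :+ (t :+ t))) := h :* (b :* S) :+ h :* (b :* t :+ b :* t)) refl ½ (β n) S t ⟩
      ½ * (β n * S) + ½ * (β n * t + β n * t)
        ≡⟨ cong₂ _+_ (cong (½ *_) inside) (½-double (β n * t)) ⟩
      newCycle n (suc r) φ + averageI n (suc r) φ              ∎
      where
      open ≡-Reasoning
      open +-*-Solver
      T : Bool → ℚ
      T s = total n (shift (suc r) (V (suc r , s)) φ)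
      S = ∑ signs (λ s → sgn s * T s)
      t = totalI n (suc r) φ
      inside : β n * S ≡ ∑ signs (λ s → sgn s * average n (shift (suc r) (V (suc r , s)) φ))
      inside = trans (sym (∑-*ˡ signs (β n) (λ s → sgn s * T s))) (∑-cong signs (λ s → solve 3 (λ b g u → b :* (g :* u) := g :* (b :* u)) refl (β n) (sgn s) (T s)))

-- Double counting of roots and conjugators.

module ClassEquation where

  open CycleTypes
  open Insertion
  open CycleStatistics
  open Conjugacy
  open Summation
  open SignedAverages
  open import Data.Bool using (Bool; true; false; T)
  open import Data.Empty using (⊥-elim)
  open import Data.Nat using (zero; suc; _≤_; z≤n; s≤s)
  open import Data.Rational as ℚ using (ℚ; 1ℚ; _*_)
  import Data.Rational.Properties as ℚ
  open import Data.Product hiding (map)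
  open import Data.List using (List; length; allFin; filter)
  open import Data.List.Membership.Propositional using (_∈_)
  open import Data.List.Membership.Propositional.Properties using (∈-allFin)
  open import Data.List.Relation.Unary.All as All using (All)
  open import Data.List.Relation.Unary.All.Properties using (all⁺; all⁻)
  open import Data.Vec using (lookup)
  open import Function using (_∘_)
  open import Relation.Binary.PropositionalEquality
  open import Relation.Nullary
  open import Relation.Nullary.Decidable using (T?)

  T-ext : ∀ {a b} → (T a → T b) → (T b → T a) → a ≡ b
  T-ext {true}  {true}  f g = refl
  T-ext {true}  {false} f g = ⊥-elim (f _)
  T-ext {false} {true}  f g = ⊥-elim (g _)
  T-ext {false} {false} f g = refl

  eqSV⇒≡ : ∀ {n} {v w : SVec n} → T (eqSV v w) → v ≡ w
  eqSV⇒≡ {n} h = SVec-ext (λ i → eqPt⇒≡ _ _ (All.lookup (all⁺ _ (allFin n) h) (∈-allFin i)))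

  ≡⇒eqSV : ∀ {n} {v w : SVec n} → v ≡ w → T (eqSV v w)
  ≡⇒eqSV {n} {v} refl = all⁻ _ (All.universal (λ i → eqPt-refl (lookup v i)) (allFin n))

  eqSV⇒Intertwines : ∀ {n} (w y z : SVec n) → T (eqSV (w ∘B z) (z ∘B y)) → Intertwines z y w
  eqSV⇒Intertwines w y z h a = trans (sym (∘B-act z y a)) (trans (cong (λ v → act v a) (sym (eqSV⇒≡ {v = w ∘B z} {w = z ∘B y} h))) (∘B-act w z a))

  Intertwines⇒eqSV : ∀ {n} (w y z : SVec n) → Intertwines z y w → T (eqSV (w ∘B z) (z ∘B y))
  Intertwines⇒eqSV w y z h = ≡⇒eqSV (act-ext {v = w ∘B z} {w = z ∘B y} (λ a → trans (∘B-act w z a) (trans (sym (h a)) (sym (∘B-act z y a)))))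

  iter-Intertwines : ∀ {n} {x y z : SVec n} → Intertwines z x y → ∀ k a → act z (iter x k a) ≡ iter y k (act z a)
  iter-Intertwines h zero a = refl
  iter-Intertwines {x = x} {y} {z} h (suc k) a = trans (h (iter x k a)) (cong (act y) (iter-Intertwines {x = x} {y} {z} h k a))

  module Conjugation {n} {z : SVec n} (iz : Inj z) where

    left left⁻¹ conj conj⁻¹ : SVec n → SVec n
    left x = z ∘B x
    left⁻¹ x = invB z ∘B x
    conj x = invB z ∘B (x ∘B z)
    conj⁻¹ x = z ∘B (x ∘B invB z)

    left⁻¹-left : ∀ x → left⁻¹ (left x) ≡ x
    left⁻¹-left x = act-ext (λ a → trans (∘B-act (invB z) (left x) a) (trans (cong (act (invB z)) (∘B-act z x a)) (invB-act iz (act x a))))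

    left-left⁻¹ : ∀ x → left (left⁻¹ x) ≡ x
    left-left⁻¹ x = act-ext (λ a → trans (∘B-act z (left⁻¹ x) a) (trans (cong (act z) (∘B-act (invB z) x a)) (act-invB iz (act x a))))

    conj-act : ∀ x a → act (conj x) a ≡ act (invB z) (act x (act z a))
    conj-act x a = trans (∘B-act (invB z) (x ∘B z) a) (cong (act (invB z)) (∘B-act x z a))

    conj⁻¹-act : ∀ x a → act (conj⁻¹ x) a ≡ act z (act x (act (invB z) a))
    conj⁻¹-act x a = trans (∘B-act z (x ∘B invB z) a) (cong (act z) (∘B-act x (invB z) a))

    conj⁻¹-conj : ∀ x → conj⁻¹ (conj x) ≡ x
    conj⁻¹-conj x = act-ext (λ a → trans (conj⁻¹-act (conj x) a) (trans (cong (act z) (conj-act x (act (invB z) a)))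
      (trans (act-invB iz (act x (act z (act (invB z) a)))) (cong (act x) (act-invB iz a)))))

    conj-conj⁻¹ : ∀ x → conj (conj⁻¹ x) ≡ x
    conj-conj⁻¹ x = act-ext (λ a → trans (conj-act (conj⁻¹ x) a) (trans (cong (act (invB z)) (conj⁻¹-act x (act z a)))
      (trans (invB-act iz (act x (act (invB z) (act z a)))) (cong (act x) (invB-act iz a)))))

    Inj-left : ∀ {x} → Inj x → Inj (left x)
    Inj-left = Inj-∘B iz

    Inj-left⁻¹ : ∀ {x} → Inj x → Inj (left⁻¹ x)
    Inj-left⁻¹ = Inj-∘B (Inj-invB iz)

    Inj-conj : ∀ {x} → Inj x → Inj (conj x)
    Inj-conj ix = Inj-∘B (Inj-invB iz) (Inj-∘B ix iz)

    Inj-conj⁻¹ : ∀ {x} → Inj x → Inj (conj⁻¹ x)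
    Inj-conj⁻¹ ix = Inj-∘B iz (Inj-∘B ix (Inj-invB iz))

    conj-intertwines : ∀ x → Intertwines z (conj x) x
    conj-intertwines x a = trans (cong (act z) (conj-act x a)) (act-invB iz (act x (act z a)))

    sg-conj : ∀ {x} → Inj x → sg (conj x) ≡ sg x
    sg-conj {x} ix = sg-intertwines {x = conj x} {x} {z} (Inj-conj ix) iz (conj-intertwines x)

    -- The k-th power of z⁻¹xz is z⁻¹xᵏz; multiplying by `z` on the left gives a condition on the
    -- pair (x , z) without inverses, ready for exchanging the two sums.
    conj-root : ∀ k x y → eqSV (conj x ^B k) y ≡ eqSV ((x ^B k) ∘B z) (z ∘B y)
    conj-root k x y = T-ext
      (λ h → Intertwines⇒eqSV (x ^B k) y z (λ a → trans (cong (λ v → act z (act v a)) (sym (eqSV⇒≡ {v = conj x ^B k} {w = y} h))) (walk a)))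
      (λ h → ≡⇒eqSV (act-ext {v = conj x ^B k} {w = y} (λ a → act-injective iz (trans (walk a) (sym (eqSV⇒Intertwines (x ^B k) y z h a))))))
      where
      walk : ∀ a → act z (act (conj x ^B k) a) ≡ act (x ^B k) (act z a)
      walk a = trans (cong (act z) (^B-act (conj x) k a)) (trans (iter-Intertwines {x = conj x} {x} {z} (conj-intertwines x) k a) (sym (^B-act x k (act z a))))

    -- One solution `z` of wz = zy being fixed, every other one is `z` times an element of the
    -- centralizer of `y`.
    left-commutes : ∀ {w y} → Intertwines z y w → ∀ x → eqSV (w ∘B left x) (left x ∘B y) ≡ eqSV (x ∘B y) (y ∘B x)
    left-commutes {w} {y} h x = T-ext
      (λ e → ≡⇒eqSV (act-ext {v = x ∘B y} {w = y ∘B x} (λ a → trans (∘B-act x y a) (trans (act-injective iz (begin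
        act z (act x (act y a))
          ≡⟨ sym (∘B-act z x (act y a)) ⟩
        act (left x) (act y a)
          ≡⟨ eqSV⇒Intertwines w y (left x) e a ⟩
        act w (act (left x) a)
          ≡⟨ cong (act w) (∘B-act z x a) ⟩
        act w (act z (act x a))
          ≡⟨ sym (h (act x a)) ⟩
        act z (act y (act x a))      ∎)) (sym (∘B-act y x a))))))
      (λ e → Intertwines⇒eqSV w y (left x) (λ a → begin
        act (left x) (act y a)
          ≡⟨ ∘B-act z x (act y a) ⟩
        act z (act x (act y a))
          ≡⟨ cong (act z) (trans (sym (∘B-act x y a)) (trans (cong (λ v → act v a) (eqSV⇒≡ {v = x ∘B y} {w = y ∘B x} e)) (∘B-act y x a))) ⟩
        act z (act y (act x a))
          ≡⟨ h (act x a) ⟩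
        act w (act z (act x a))
          ≡⟨ cong (act w) (sym (∘B-act z x a)) ⟩
        act w (act (left x) a)       ∎))
      where open ≡-Reasoning

  srootsB-∑ : ∀ k {n} (y : SVec n) → ι (srootsB k y) ≡ ∑ (elemsB n) (λ x → ⟦ eqSV (x ^B k) y ⟧ * sgn (sg x))
  srootsB-∑ k {n} y = trans (ι-sumℤ (filter (λ x → T? (eqSV (x ^B k) y)) (elemsB n)) χ)
    (trans (∑-filter (λ x → eqSV (x ^B k) y) (elemsB n) (ι ∘ χ))
      (∑-cong (elemsB n) (λ x → cong (λ c → ⟦ eqSV (x ^B k) y ⟧ * ι c) (χ≡ x))))

  centralizer-∑ : ∀ {n} (y : SVec n) → ιℕ (centralizerOrder y) ≡ ∑ (elemsB n) (λ z → ⟦ eqSV (z ∘B y) (y ∘B z) ⟧)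
  centralizer-∑ {n} y = trans (sym (ℚ.*-identityʳ _)) (trans (sym (∑-const (filter (λ z → T? (eqSV (z ∘B y) (y ∘B z))) (elemsB n)) 1ℚ))
    (trans (∑-filter (λ z → eqSV (z ∘B y) (y ∘B z)) (elemsB n) (λ _ → 1ℚ)) (∑-cong (elemsB n) (λ z → ℚ.*-identityʳ _))))

  -- For conjugate elements the intertwiners form a coset of the centralizer of `y`; otherwise there
  -- are none. `b` is any Boolean that decides equality of the statistics, later the match of a
  -- monomial.
  intertwiners-∑ : ∀ {n} {w y : SVec n} → Inj w → Inj y → ∀ b → (T b → SameStat w y) → (SameStat w y → T b) →
    ∑ (elemsB n) (λ z → ⟦ eqSV (w ∘B z) (z ∘B y) ⟧) ≡ ιℕ (centralizerOrder y) * ⟦ b ⟧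
  intertwiners-∑ {n} {w} {y} iw iy true same _ = begin
    ∑ (elemsB n) (λ z → ⟦ eqSV (w ∘B z) (z ∘B y) ⟧)
      ≡⟨ ∑-elemsB-bijection left left⁻¹ Inj-left Inj-left⁻¹ left⁻¹-left left-left⁻¹ _ ⟩
    ∑ (elemsB n) (λ z → ⟦ eqSV (w ∘B left z) (left z ∘B y) ⟧)
      ≡⟨ ∑-cong (elemsB n) (λ x → cong ⟦_⟧ (left-commutes {w} {y} (proj₂ (proj₂ c)) x)) ⟩
    ∑ (elemsB n) (λ x → ⟦ eqSV (x ∘B y) (y ∘B x) ⟧)
      ≡⟨ sym (centralizer-∑ y) ⟩
    ιℕ (centralizerOrder y)
      ≡⟨ sym (ℚ.*-identityʳ _) ⟩
    ιℕ (centralizerOrder y) * 1ℚ                                  ∎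
    where
    open ≡-Reasoning
    c = conjugate iy iw (λ τ → sym (same _ τ))
    open Conjugation (proj₁ (proj₂ c))
  intertwiners-∑ {n} {w} {y} iw iy false _ same = trans (∑-≡0 (elemsB n) (λ {z} z∈ →
    cong ⟦_⟧ (¬T⇒≡ (λ h → same (λ τ → sym (SameStat-conjugate iy iw (∈-elemsB⁻ z∈) (eqSV⇒Intertwines w y z h) τ))))))
    (sym (ℚ.*-zeroʳ (ιℕ (centralizerOrder y))))

  -- Both sides count, with sign, the pairs (x , z) such that xᵏ = z y z⁻¹.
  class-equation : ∀ k {n} {y : SVec n} → Inj y → ∀ (d : SVec n → Bool) →
    (∀ {x} → Inj x → T (d x) → SameStat (x ^B k) y) → (∀ {x} → Inj x → SameStat (x ^B k) y → T (d x)) →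
    order n * ι (srootsB k y) ≡ ιℕ (centralizerOrder y) * ∑ (elemsB n) (λ x → sgn (sg x) * ⟦ d x ⟧)
  class-equation k {n} {y} iy d d⇒ ⇒d = begin
    order n * R
      ≡⟨ sym (∑-*ʳ (elemsB n) R (λ _ → 1ℚ)) ⟩
    ∑ (elemsB n) (λ z → 1ℚ * R)
      ≡⟨ ∑-cong-∈ (elemsB n) (λ {z} z∈ → trans (ℚ.*-identityˡ R) (conjugated (∈-elemsB⁻ z∈))) ⟩
    ∑ (elemsB n) (λ z → ∑ (elemsB n) (λ x → ⟦ E x z ⟧ * sgn (sg x)))
      ≡⟨ ∑-swap (elemsB n) (elemsB n) (λ z x → ⟦ E x z ⟧ * sgn (sg x)) ⟩
    ∑ (elemsB n) (λ x → ∑ (elemsB n) (λ z → ⟦ E x z ⟧ * sgn (sg x)))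
      ≡⟨ ∑-cong-∈ (elemsB n) (λ {x} x∈ → trans (∑-*ʳ (elemsB n) (sgn (sg x)) (λ z → ⟦ E x z ⟧))
                                                                                         (trans (cong (_* sgn (sg x)) (intertwiners-∑ (Inj-^B (∈-elemsB⁻ x∈) k) iy (d x) (d⇒ (∈-elemsB⁻ x∈)) (⇒d (∈-elemsB⁻ x∈))))
                                                                                           (trans (ℚ.*-assoc Z ⟦ d x ⟧ (sgn (sg x))) (cong (Z *_) (ℚ.*-comm ⟦ d x ⟧ (sgn (sg x))))))) ⟩
    ∑ (elemsB n) (λ x → Z * (sgn (sg x) * ⟦ d x ⟧))
      ≡⟨ ∑-*ˡ (elemsB n) Z _ ⟩
    Z * ∑ (elemsB n) (λ x → sgn (sg x) * ⟦ d x ⟧)                                   ∎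
    where
    open ≡-Reasoning
    R = ι (srootsB k y)
    Z = ιℕ (centralizerOrder y)
    E : SVec n → SVec n → Bool
    E x z = eqSV ((x ^B k) ∘B z) (z ∘B y)
    conjugated : ∀ {z} → Inj z → R ≡ ∑ (elemsB n) (λ x → ⟦ E x z ⟧ * sgn (sg x))
    conjugated {z} iz = trans (srootsB-∑ k y) (trans
      (∑-elemsB-bijection conj conj⁻¹ Inj-conj Inj-conj⁻¹ conj⁻¹-conj conj-conj⁻¹ _)
      (∑-cong-∈ (elemsB n) (λ {x} x∈ → cong₂ (λ b s → ⟦ b ⟧ * sgn s) (conj-root k x y) (sg-conj (∈-elemsB⁻ x∈)))))
      where open Conjugation iz

  centralizer-pos : ∀ {n} {y : SVec n} → 1 ≤ centralizerOrder y
  centralizer-pos {n} {y} = nonempty (filter-∈ (∈-elemsB Inj-idB) (≡⇒eqSV (act-ext {v = idB ∘B y} {w = y ∘B idB} (λ a →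
    trans (∘B-act idB y a) (trans (idB-act (act y a)) (sym (trans (∘B-act y idB a) (cong (act y) (idB-act a)))))))))
    where
    open import Data.List.Membership.Propositional.Properties using (∈-filter⁺)
    open import Data.List.Relation.Unary.Any using (here; there)
    filter-∈ : ∀ {z} → z ∈ elemsB n → T (eqSV (z ∘B y) (y ∘B z)) → z ∈ filter (λ z → T? (eqSV (z ∘B y) (y ∘B z))) (elemsB n)
    filter-∈ = ∈-filter⁺ (λ z → T? (eqSV (z ∘B y) (y ∘B z)))
    nonempty : ∀ {A : Set} {x : A} {xs} → x ∈ xs → 1 ≤ length xs
    nonempty (here _) = s≤s z≤n
    nonempty (there _) = s≤s z≤n

-- Cauchy products, the Euler derivation and the exponential.

module PowerSeries where

  open Summation
  open SignedAverages using (½)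
  open import Data.Bool using (if_then_else_)
  open import Data.Nat as ℕ using (ℕ; zero; suc; _≤_; _<_; z≤n; s≤s; _∸_; _!; _≡ᵇ_)
  import Data.Nat.Properties as ℕ
  open import Data.Nat.Solver using () renaming (module +-*-Solver to ℕSolver)
  open import Data.Integer as ℤ using (ℤ)
  open import Data.Rational as ℚ using (ℚ; 0ℚ; 1ℚ; _+_; _*_)
  import Data.Rational.Properties as ℚ
  open import Data.Rational.Solver using (module +-*-Solver)
  open import Data.Product using (_,_)
  open import Data.List using (List; []; _∷_; map; upTo; concatMap)
  open import Data.List.Properties using (map-applyUpTo)
  open import Function using (_∘_; id)
  open import Relation.Binary.PropositionalEquality

  ∑-concatMap : ∀ {A B : Set} (g : A → List B) xs f → ∑ (concatMap g xs) f ≡ ∑ xs (λ x → ∑ (g x) f)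
  ∑-concatMap g [] f = refl
  ∑-concatMap g (x ∷ xs) f = trans (∑-++ (g x) (concatMap g xs) f) (cong (∑ (g x) f +_) (∑-concatMap g xs f))

  ∑-upTo-suc : ∀ n f → ∑ (upTo (suc n)) f ≡ f 0 + ∑ (upTo n) (f ∘ suc)
  ∑-upTo-suc n f = cong (f 0 +_) (trans (cong (λ xs → ∑ xs f) (sym (map-applyUpTo id suc n))) (∑-map suc (upTo n) f))

  ∑-upTo-extend : ∀ {M N} f → M ≤ N → (∀ r → M ≤ r → f r ≡ 0ℚ) → ∑ (upTo N) f ≡ ∑ (upTo M) f
  ∑-upTo-extend {zero} {N} f _ h = ∑-≡0 (upTo N) (λ {r} _ → h r z≤n)
  ∑-upTo-extend {suc M} {suc N} f (s≤s M≤N) h = trans (∑-upTo-suc N f)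
    (trans (cong (f 0 +_) (∑-upTo-extend (f ∘ suc) M≤N (λ r M≤r → h (suc r) (s≤s M≤r)))) (sym (∑-upTo-suc M f)))

  opaque

    -- The sum over x + y = a. Being opaque, it is handled through its recursion on `a`, and the
    -- truncated difference stays hidden.
    splitN : ℕ → (ℕ → ℕ → ℚ) → ℚ
    splitN a F = ∑ (upTo (suc a)) (λ x → F x (a ∸ x))

    splitN-suc : ∀ a F → splitN (suc a) F ≡ F 0 (suc a) + splitN a (λ x y → F (suc x) y)
    splitN-suc a F = ∑-upTo-suc (suc a) (λ x → F x (suc a ∸ x))

    splitN-zero : ∀ F → splitN 0 F ≡ F 0 0
    splitN-zero F = ℚ.+-identityʳ (F 0 0)

    splitN-*ˡ : ∀ a c F → splitN a (λ x y → c * F x y) ≡ c * splitN a F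
    splitN-*ˡ a c F = ∑-*ˡ (upTo (suc a)) c (λ x → F x (a ∸ x))

    splitN-*ʳ : ∀ a c F → splitN a (λ x y → F x y * c) ≡ splitN a F * c
    splitN-*ʳ a c F = ∑-*ʳ (upTo (suc a)) c (λ x → F x (a ∸ x))

    splitN-swap : ∀ a b (F : ℕ → ℕ → ℕ → ℕ → ℚ) → splitN a (λ x x′ → splitN b (F x x′)) ≡ splitN b (λ y y′ → splitN a (λ x x′ → F x x′ y y′))
    splitN-swap a b F = ∑-swap (upTo (suc a)) (upTo (suc b)) (λ x y → F x (a ∸ x) y (b ∸ y))

  splitN-cong : ∀ a {F G} → (∀ x y → x ℕ.+ y ≡ a → F x y ≡ G x y) → splitN a F ≡ splitN a G
  splitN-cong zero {F} {G} h = trans (splitN-zero F) (trans (h 0 0 refl) (sym (splitN-zero G)))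
  splitN-cong (suc a) {F} {G} h = trans (splitN-suc a F) (trans (cong₂ _+_ (h 0 (suc a) refl)
    (splitN-cong a (λ x y eq → h (suc x) y (cong suc eq)))) (sym (splitN-suc a G)))

  split₃ : ℕ → (ℕ → ℕ → ℕ → ℚ) → ℚ
  split₃ a K = splitN a (λ x r → splitN r (K x))

  split₃-suc : ∀ a K → split₃ (suc a) K ≡ splitN (suc a) (K 0) + split₃ a (λ x → K (suc x))
  split₃-suc a K = splitN-suc a (λ x r → splitN r (K x))

  -- The nesting of `split₃` gives the recursion in the first variable directly; the same recursion
  -- in the second is what its symmetry needs.
  split₃-suc′ : ∀ a K → split₃ (suc a) K ≡ splitN (suc a) (λ x → K x 0) + split₃ a (λ x y → K x (suc y))
  split₃-suc′ zero K = begin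
    split₃ 1 K
      ≡⟨ split₃-suc 0 K ⟩
    splitN 1 (K 0) + split₃ 0 (λ x → K (suc x))
      ≡⟨ cong₂ _+_ (one (K 0)) (zero₃ (λ x → K (suc x))) ⟩
    (K 0 0 1 + K 0 1 0) + K 1 0 0
      ≡⟨ solve 3 (λ a b c → (a :+ b) :+ c := (a :+ c) :+ b) refl (K 0 0 1) (K 0 1 0) (K 1 0 0) ⟩
    (K 0 0 1 + K 1 0 0) + K 0 1 0
      ≡⟨ sym (cong₂ _+_ (one (λ x → K x 0)) (zero₃ (λ x y → K x (suc y)))) ⟩
    splitN 1 (λ x → K x 0) + split₃ 0 (λ x y → K x (suc y))             ∎
    where
    open ≡-Reasoning
    open +-*-Solver
    one : ∀ F → splitN 1 F ≡ F 0 1 + F 1 0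
    one F = trans (splitN-suc 0 F) (cong (F 0 1 +_) (splitN-zero (λ x y → F (suc x) y)))
    zero₃ : ∀ K → split₃ 0 K ≡ K 0 0 0
    zero₃ K = trans (splitN-zero (λ x r → splitN r (K x))) (splitN-zero (K 0))
  split₃-suc′ (suc a) K = begin
    split₃ (suc (suc a)) K
      ≡⟨ split₃-suc (suc a) K ⟩
    splitN (suc (suc a)) (K 0) + split₃ (suc a) (λ x → K (suc x))
      ≡⟨ cong₂ _+_ (splitN-suc (suc a) (K 0)) (split₃-suc′ a (λ x → K (suc x))) ⟩
    (K 0 0 (suc (suc a)) + splitN (suc a) (λ y → K 0 (suc y))) + (splitN (suc a) (λ x → K (suc x) 0) + split₃ a (λ x y → K (suc x) (suc y)))
      ≡⟨ solve 4 (λ p q r s → (p :+ q) :+ (r :+ s) := (p :+ r) :+ (q :+ s)) refl (K 0 0 (suc (suc a))) (splitN (suc a) (λ y → K 0 (suc y))) (splitN (suc a) (λ x → K (suc x) 0)) (split₃ a (λ x y → K (suc x) (suc y))) ⟩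
    (K 0 0 (suc (suc a)) + splitN (suc a) (λ x → K (suc x) 0)) + (splitN (suc a) (λ y → K 0 (suc y)) + split₃ a (λ x y → K (suc x) (suc y)))
      ≡⟨ cong₂ _+_ (sym (splitN-suc (suc a) (λ x → K x 0))) (sym (split₃-suc a (λ x y → K x (suc y)))) ⟩
    splitN (suc (suc a)) (λ x → K x 0) + split₃ (suc a) (λ x y → K x (suc y))
      ∎
    where
    open ≡-Reasoning
    open +-*-Solver

  split₃-swap : ∀ a K → split₃ a K ≡ split₃ a (λ x y → K y x)
  split₃-swap zero K = splitN-cong 0 (λ { zero zero refl → splitN-cong 0 (λ { zero zero refl → refl }) })
  split₃-swap (suc a) K = trans (split₃-suc a K) (trans (cong (splitN (suc a) (K 0) +_) (split₃-swap a (λ x → K (suc x)))) (sym (split₃-suc′ a (λ x y → K y x))))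

  opaque
    unfolding splitN

    -- A general integrand, not only a product f d * g q, so that scalars, finite sums and nested
    -- products can be moved in and out.
    conv : Mono → (Mono → Mono → ℚ) → ℚ
    conv m F = ∑ (divisorsM m) (λ d → F d (quotM m d))

    *PS-conv : ∀ f g m → (f *PS g) m ≡ conv m (λ d q → f d * g q)
    *PS-conv f g m = refl

    conv-[] : ∀ F → conv [] F ≡ F [] []
    conv-[] F = ℚ.+-identityʳ (F [] [])

    conv-∷ : ∀ a b m F → conv ((a , b) ∷ m) F ≡ splitN a (λ x x′ → splitN b (λ y y′ → conv m (λ d q → F ((x , y) ∷ d) ((x′ , y′) ∷ q))))
    conv-∷ a b m F = trans (∑-concatMap (λ x → concatMap (λ y → map ((x , y) ∷_) (divisorsM m)) (upTo (suc b))) (upTo (suc a)) (λ d → F d (quotM ((a , b) ∷ m) d))) (∑-cong (upTo (suc a)) (λ x →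
      trans (∑-concatMap (λ y → map ((x , y) ∷_) (divisorsM m)) (upTo (suc b)) (λ d → F d (quotM ((a , b) ∷ m) d))) (∑-cong (upTo (suc b)) (λ y → ∑-map ((x , y) ∷_) (divisorsM m) (λ d → F d (quotM ((a , b) ∷ m) d))))))

    conv-+ : ∀ m F G → conv m (λ d q → F d q + G d q) ≡ conv m F + conv m G
    conv-+ m F G = ∑-+ (divisorsM m) (λ d → F d (quotM m d)) (λ d → G d (quotM m d))

    conv-*ˡ : ∀ m c F → conv m (λ d q → c * F d q) ≡ c * conv m F
    conv-*ˡ m c F = ∑-*ˡ (divisorsM m) c (λ d → F d (quotM m d))

    conv-zero : ∀ m → conv m (λ _ _ → 0ℚ) ≡ 0ℚ
    conv-zero m = ∑-0 (divisorsM m)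

    conv-∑ : ∀ {A : Set} m (xs : List A) (F : A → Mono → Mono → ℚ) → conv m (λ d q → ∑ xs (λ x → F x d q)) ≡ ∑ xs (λ x → conv m (F x))
    conv-∑ m xs F = ∑-swap (divisorsM m) xs (λ d x → F x d (quotM m d))

    conv-splitN : ∀ m a (F : ℕ → ℕ → Mono → Mono → ℚ) → conv m (λ d q → splitN a (λ x y → F x y d q)) ≡ splitN a (λ x y → conv m (F x y))
    conv-splitN m a F = conv-∑ m (upTo (suc a)) (λ x → F x (a ∸ x))

  -- What is retained of a factorisation is that the degrees add up; the vanishing arguments and the
  -- inductions on the degree draw on this.
  conv-cong : ∀ m {F G} → (∀ d q → deg d ℕ.+ deg q ≡ deg m → F d q ≡ G d q) → conv m F ≡ conv m G
  conv-cong [] {F} {G} h = trans (conv-[] F) (trans (h [] [] refl) (sym (conv-[] G)))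
  conv-cong ((a , b) ∷ m) {F} {G} h = trans (conv-∷ a b m F) (trans (splitN-cong a (λ x x′ a≡ → splitN-cong b (λ y y′ b≡ →
    conv-cong m (λ d q m≡ → h _ _ (trans
      (ℕSolver.solve 6 (λ x y d x′ y′ q → (x :+ y :+ d) :+ (x′ :+ y′ :+ q) := (x :+ x′) :+ (y :+ y′) :+ (d :+ q)) refl x y (deg d) x′ y′ (deg q))
      (cong₂ ℕ._+_ (cong₂ ℕ._+_ a≡ b≡) m≡)))))) (sym (conv-∷ a b m G)))
    where open ℕSolver

  conv-≗ : ∀ m {F G} → (∀ d q → F d q ≡ G d q) → conv m F ≡ conv m G
  conv-≗ m h = conv-cong m (λ d q _ → h d q)

  conv-0 : ∀ m {F} → (∀ d q → deg d ℕ.+ deg q ≡ deg m → F d q ≡ 0ℚ) → conv m F ≡ 0ℚ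
  conv-0 m h = trans (conv-cong m h) (conv-zero m)

  infixl 7 _⋆_
  _⋆_ : PS → PS → PS
  (f ⋆ g) m = conv m (λ d q → f d * g q)

  conv₃ : Mono → (Mono → Mono → Mono → ℚ) → ℚ
  conv₃ m K = conv m (λ d q → conv q (K d))

  conv₃-∷ : ∀ a b m K → conv₃ ((a , b) ∷ m) K ≡
    split₃ a (λ x x′ x″ → split₃ b (λ y y′ y″ → conv₃ m (λ d e r → K ((x , y) ∷ d) ((x′ , y′) ∷ e) ((x″ , y″) ∷ r))))
  conv₃-∷ a b m K = trans (conv-∷ a b m _) (splitN-cong a λ x r _ → begin
    splitN b (λ y s → conv m (λ d q → conv ((r , s) ∷ q) (K ((x , y) ∷ d))))
      ≡⟨ splitN-cong b (λ y s _ → conv-≗ m (λ d q → conv-∷ r s q _)) ⟩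
    splitN b (λ y s → conv m (λ d q → splitN r (λ x′ x″ → splitN s (λ y′ y″ → conv q (λ e t → K ((x , y) ∷ d) ((x′ , y′) ∷ e) ((x″ , y″) ∷ t))))))
      ≡⟨ splitN-cong b (λ y s _ → trans (conv-splitN m r _) (splitN-cong r (λ x′ x″ _ → conv-splitN m s _))) ⟩
    splitN b (λ y s → splitN r (λ x′ x″ → splitN s (λ y′ y″ → conv₃ m (λ d e t → K ((x , y) ∷ d) ((x′ , y′) ∷ e) ((x″ , y″) ∷ t)))))
      ≡⟨ splitN-swap b r _ ⟩
    splitN r (λ x′ x″ → split₃ b (λ y y′ y″ → conv₃ m (λ d e t → K ((x , y) ∷ d) ((x′ , y′) ∷ e) ((x″ , y″) ∷ t))))
      ∎)
    where open ≡-Reasoning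

  conv₃-swap : ∀ m K → conv₃ m K ≡ conv₃ m (λ d e → K e d)
  conv₃-swap [] K = trans (conv₃-[] K) (sym (conv₃-[] (λ d e → K e d)))
    where
    conv₃-[] : ∀ K → conv₃ [] K ≡ K [] [] []
    conv₃-[] K = trans (conv-[] (λ d q → conv q (K d))) (conv-[] (K []))
  conv₃-swap ((a , b) ∷ m) K = begin
    conv₃ ((a , b) ∷ m) K
      ≡⟨ conv₃-∷ a b m K ⟩
    split₃ a (λ x x′ x″ → split₃ b (λ y y′ y″ → conv₃ m (λ d e r → K ((x , y) ∷ d) ((x′ , y′) ∷ e) ((x″ , y″) ∷ r))))
      ≡⟨ split₃-swap a _ ⟩
    split₃ a (λ x x′ x″ → split₃ b (λ y y′ y″ → conv₃ m (λ d e r → K ((x′ , y) ∷ d) ((x , y′) ∷ e) ((x″ , y″) ∷ r))))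
      ≡⟨ splitN-cong a (λ x s _ → splitN-cong s (λ x′ x″ _ → trans (split₃-swap b _)
           (splitN-cong b (λ y t _ → splitN-cong t (λ y′ y″ _ → conv₃-swap m _))))) ⟩
    split₃ a (λ x x′ x″ → split₃ b (λ y y′ y″ → conv₃ m (λ d e r → K ((x′ , y′) ∷ e) ((x , y) ∷ d) ((x″ , y″) ∷ r))))
      ≡⟨ sym (conv₃-∷ a b m (λ d e → K e d)) ⟩
    conv₃ ((a , b) ∷ m) (λ d e → K e d)
      ∎
    where open ≡-Reasoning

  -- Associativity and commutativity in one exchange, as needed in the power rule: the derivation
  -- produces f ⋆ (D f ⋆ fʳ), and D f has to come to the front.
  ⋆-left-comm : ∀ f g h m → (f ⋆ (g ⋆ h)) m ≡ (g ⋆ (f ⋆ h)) m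
  ⋆-left-comm f g h m = begin
    conv m (λ d q → f d * conv q (λ e r → g e * h r))
      ≡⟨ conv-≗ m (λ d q → sym (conv-*ˡ q (f d) _)) ⟩
    conv₃ m (λ d e r → f d * (g e * h r))
      ≡⟨ conv₃-swap m (λ d e r → f d * (g e * h r)) ⟩
    conv₃ m (λ d e r → f e * (g d * h r))
      ≡⟨ conv-≗ m (λ d q → conv-≗ q (λ e r → solve 3 (λ f g h → f :* (g :* h) := g :* (f :* h)) refl (f e) (g d) (h r))) ⟩
    conv₃ m (λ d e r → g d * (f e * h r))
      ≡⟨ conv-≗ m (λ d q → conv-*ˡ q (g d) _) ⟩
    conv m (λ d q → g d * conv q (λ e r → f e * h r))     ∎
    where
    open ≡-Reasoning
    open +-*-Solver

  -- The Euler derivation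
  D : PS → PS
  D f m = ιℕ (deg m) * f m

  D-* : ∀ f g m → D (f ⋆ g) m ≡ (D f ⋆ g) m + (f ⋆ D g) m
  D-* f g m = trans (sym (conv-*ˡ m (ιℕ (deg m)) _)) (trans (conv-cong m leibniz) (conv-+ m _ _))
    where
    leibniz : ∀ d q → deg d ℕ.+ deg q ≡ deg m → ιℕ (deg m) * (f d * g q) ≡ D f d * g q + f d * D g q
    leibniz d q eq = trans (cong (λ e → e * (f d * g q)) (trans (cong ιℕ (sym eq)) (ιℕ-+ (deg d) (deg q))))
      (solve 4 (λ u v f g → (u :+ v) :* (f :* g) := (u :* f) :* g :+ f :* (v :* g)) refl (ιℕ (deg d)) (ιℕ (deg q)) (f d) (g q))
      where open +-*-Solver

  D-onePS : ∀ m → D onePS m ≡ 0ℚ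
  D-onePS m with deg m
  ... | zero = refl
  ... | suc n = ℚ.*-zeroʳ (ιℕ (suc n))

  D-pow : ∀ f r m → D (powPS f (suc r)) m ≡ ιℕ (suc r) * (D f ⋆ powPS f r) m
  D-pow f zero m = begin
    D (powPS f 1) m
      ≡⟨ cong (ιℕ (deg m) *_) (*PS-conv f onePS m) ⟩
    D (f ⋆ onePS) m
      ≡⟨ D-* f onePS m ⟩
    (D f ⋆ onePS) m + (f ⋆ D onePS) m
      ≡⟨ cong ((D f ⋆ onePS) m +_) (conv-0 m (λ d q _ → trans (cong (f d *_) (D-onePS q)) (ℚ.*-zeroʳ (f d)))) ⟩
    (D f ⋆ onePS) m + 0ℚ
      ≡⟨ ℚ.+-identityʳ _ ⟩
    (D f ⋆ onePS) m
      ≡⟨ sym (ℚ.*-identityˡ _) ⟩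
    1ℚ * (D f ⋆ onePS) m                           ∎
    where open ≡-Reasoning
  D-pow f (suc r) m = begin
    D (powPS f (suc (suc r))) m
      ≡⟨ cong (ιℕ (deg m) *_) (*PS-conv f (powPS f (suc r)) m) ⟩
    D (f ⋆ powPS f (suc r)) m
      ≡⟨ D-* f (powPS f (suc r)) m ⟩
    P + (f ⋆ D (powPS f (suc r))) m
      ≡⟨ cong (P +_) (conv-≗ m (λ d q → trans (cong (f d *_) (D-pow f r q)) (swap (f d) (ιℕ (suc r)) ((D f ⋆ powPS f r) q)))) ⟩
    P + conv m (λ d q → ιℕ (suc r) * (f d * (D f ⋆ powPS f r) q))
      ≡⟨ cong (P +_) (conv-*ˡ m (ιℕ (suc r)) _) ⟩
    P + ιℕ (suc r) * (f ⋆ (D f ⋆ powPS f r)) m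
      ≡⟨ cong (λ e → P + ιℕ (suc r) * e) (trans (⋆-left-comm f (D f) (powPS f r) m) (conv-≗ m (λ d q → cong (D f d *_) (sym (*PS-conv f (powPS f r) q))))) ⟩
    P + ιℕ (suc r) * P
      ≡⟨ cong (_+ ιℕ (suc r) * P) (sym (ℚ.*-identityˡ P)) ⟩
    1ℚ * P + ιℕ (suc r) * P
      ≡⟨ sym (ℚ.*-distribʳ-+ P 1ℚ (ιℕ (suc r))) ⟩
    (1ℚ + ιℕ (suc r)) * P
      ≡⟨ cong (_* P) (sym (ιℕ-+ 1 (suc r))) ⟩
    ιℕ (suc (suc r)) * P                                                         ∎
    where
    open ≡-Reasoning
    P = (D f ⋆ powPS f (suc r)) m
    swap : ∀ a b c → a * (b * c) ≡ b * (a * c)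
    swap = solve 3 (λ a b c → a :* (b :* c) := b :* (a :* c)) refl
      where open +-*-Solver

  ConstantFree : PS → Set
  ConstantFree f = ∀ m → deg m ≡ 0 → f m ≡ 0ℚ

  -- Each of the r factors has degree at least one. This makes the degree-dependent truncation in
  -- `expPS` harmless.
  pow-vanishes : ∀ {f} → ConstantFree f → ∀ r m → deg m < r → powPS f r m ≡ 0ℚ
  pow-vanishes {f} f0 (suc r) m (s≤s m≤r) = trans (*PS-conv f (powPS f r) m) (conv-0 m term)
    where
    term : ∀ d q → deg d ℕ.+ deg q ≡ deg m → f d * powPS f r q ≡ 0ℚ
    term d q eq with deg d in e
    ... | zero = trans (cong (_* powPS f r q) (f0 d e)) (ℚ.*-zeroˡ (powPS f r q))
    ... | suc n = trans (cong (f d *_) (pow-vanishes f0 r q (ℕ.≤-trans (ℕ.≤-trans (s≤s (ℕ.m≤n+m (deg q) n)) (ℕ.≤-reflexive eq)) m≤r))) (ℚ.*-zeroʳ (f d))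

  1/-! : ∀ r → ιℕ (suc r) * 1/ (suc r !) ≡ 1/ (r !)
  1/-! r = sym (divℚ-unique (ℤ.+ 1) (r !) (ℕ.1≤n! r) (begin
    (ιℕ (suc r) * 1/ (suc r !)) * ιℕ (r !)
      ≡⟨ solve 3 (λ a b c → (a :* b) :* c := b :* (a :* c)) refl (ιℕ (suc r)) (1/ (suc r !)) (ιℕ (r !)) ⟩
    1/ (suc r !) * (ιℕ (suc r) * ιℕ (r !))
      ≡⟨ cong (1/ (suc r !) *_) (sym (ιℕ-* (suc r) (r !))) ⟩
    1/ (suc r !) * ιℕ (suc r !)
      ≡⟨ 1/-* (suc r !) (ℕ.1≤n! (suc r)) ⟩
    1ℚ                                          ∎))
    where
    open ≡-Reasoning
    open +-*-Solver

  expTerm : PS → Mono → ℕ → ℚ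
  expTerm f m r = powPS f r m * 1/ (r !)

  expPS-extend : ∀ {f} → ConstantFree f → ∀ m N → deg m ≤ N → ∑ (upTo (suc N)) (expTerm f m) ≡ expPS f m
  expPS-extend {f} f0 m N m≤N = ∑-upTo-extend (expTerm f m) (s≤s m≤N) (λ r h → trans (cong (_* 1/ (r !)) (pow-vanishes f0 r m h)) (ℚ.*-zeroˡ (1/ (r !))))

  -- Termwise this is the power rule with (r + 1) / (r + 1)! = 1 / r!. The difficulty is that
  -- `expPS` truncates at the degree of its argument, so the sums for `m` and for its factors `q`
  -- must first be brought to a common bound.
  D-exp : ∀ {f} → ConstantFree f → ∀ m → D (expPS f) m ≡ (D f ⋆ expPS f) m
  D-exp {f} f0 m = by-degree (deg m) refl
    where
    by-degree : ∀ n → deg m ≡ n → D (expPS f) m ≡ (D f ⋆ expPS f) m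
    by-degree zero em = trans (trans (cong (λ n → ιℕ n * expPS f m) em) (ℚ.*-zeroˡ (expPS f m))) (sym (conv-0 m (λ d q eq → trans (cong (λ n → (ιℕ n * f d) * expPS f q) (ℕ.m+n≡0⇒m≡0 (deg d) (trans eq em)))
        (trans (cong (_* expPS f q) (ℚ.*-zeroˡ (f d))) (ℚ.*-zeroˡ (expPS f q))))))
    by-degree (suc n) em = begin
      D (expPS f) m
        ≡⟨ cong (λ k → ιℕ k * ∑ (upTo (suc k)) (expTerm f m)) em ⟩
      ιℕ (suc n) * ∑ (upTo (suc (suc n))) (expTerm f m)
        ≡⟨ sym (∑-*ˡ (upTo (suc (suc n))) (ιℕ (suc n)) (expTerm f m)) ⟩
      ∑ (upTo (suc (suc n))) (λ r → ιℕ (suc n) * expTerm f m r)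
        ≡⟨ ∑-upTo-suc (suc n) (λ r → ιℕ (suc n) * expTerm f m r) ⟩
      ιℕ (suc n) * expTerm f m 0 + ∑ (upTo (suc n)) (λ r → ιℕ (suc n) * expTerm f m (suc r))
        ≡⟨ cong₂ _+_ first-term (∑-cong (upTo (suc n)) later-term) ⟩
      0ℚ + ∑ (upTo (suc n)) (λ r → conv m (λ d q → D f d * expTerm f q r))
        ≡⟨ ℚ.+-identityˡ _ ⟩
      ∑ (upTo (suc n)) (λ r → conv m (λ d q → D f d * expTerm f q r))
        ≡⟨ sym (conv-∑ m (upTo (suc n)) (λ r d q → D f d * expTerm f q r)) ⟩
      conv m (λ d q → ∑ (upTo (suc n)) (λ r → D f d * expTerm f q r))
        ≡⟨ conv-cong m (λ d q eq → trans (∑-*ˡ (upTo (suc n)) (D f d) (expTerm f q)) (truncate d q eq)) ⟩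
      conv m (λ d q → D f d * expPS f q)                                        ∎
      where
      open ≡-Reasoning
      first-term : ιℕ (suc n) * expTerm f m 0 ≡ 0ℚ
      first-term = trans (cong (λ k → ιℕ (suc n) * ((if k ≡ᵇ 0 then 1ℚ else 0ℚ) * 1ℚ)) em) (ℚ.*-zeroʳ (ιℕ (suc n)))
      later-term : ∀ r → ιℕ (suc n) * expTerm f m (suc r) ≡ conv m (λ d q → D f d * expTerm f q r)
      later-term r = begin
        ιℕ (suc n) * (powPS f (suc r) m * 1/ (suc r !))
          ≡⟨ sym (ℚ.*-assoc (ιℕ (suc n)) _ _) ⟩
        (ιℕ (suc n) * powPS f (suc r) m) * 1/ (suc r !)
          ≡⟨ cong (_* 1/ (suc r !)) (trans (cong (λ k → ιℕ k * powPS f (suc r) m) (sym em)) (D-pow f r m)) ⟩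
        (ιℕ (suc r) * P) * 1/ (suc r !)
          ≡⟨ solve 3 (λ a b c → (a :* b) :* c := (a :* c) :* b) refl (ιℕ (suc r)) P (1/ (suc r !)) ⟩
        (ιℕ (suc r) * 1/ (suc r !)) * P
          ≡⟨ cong (_* P) (1/-! r) ⟩
        1/ (r !) * P
          ≡⟨ sym (conv-*ˡ m (1/ (r !)) _) ⟩
        conv m (λ d q → 1/ (r !) * (D f d * powPS f r q))
          ≡⟨ conv-≗ m (λ d q → solve 3 (λ a b c → a :* (b :* c) := b :* (c :* a)) refl (1/ (r !)) (D f d) (powPS f r q)) ⟩
        conv m (λ d q → D f d * expTerm f q r)                  ∎
        where
        open +-*-Solver
        P = (D f ⋆ powPS f r) m
      truncate : ∀ d q → deg d ℕ.+ deg q ≡ deg m → D f d * ∑ (upTo (suc n)) (expTerm f q) ≡ D f d * expPS f q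
      truncate d q eq with deg d in ed
      -- Here `q` may have the full degree n + 1, for which the bound n is too short; but then D f d
      -- is zero. In the other case q has degree at most n.
      ... | zero = trans (cong (_* ∑ (upTo (suc n)) (expTerm f q)) (ℚ.*-zeroˡ (f d))) (trans (ℚ.*-zeroˡ (∑ (upTo (suc n)) (expTerm f q)))
                     (sym (trans (cong (_* expPS f q) (ℚ.*-zeroˡ (f d))) (ℚ.*-zeroˡ (expPS f q)))))
      ... | suc t = cong (ιℕ (suc t) * f d *_) (expPS-extend f0 q n (ℕ.≤-trans (ℕ.m≤n+m (deg q) t) (ℕ.≤-reflexive (ℕ.suc-injective (trans eq em)))))

-- Matching monomials, and multiplication by a pure power.

module Powers where

  open CycleTypes using (Ty; T⇒≡; ≡⇒T; ¬T⇒≡)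
  open CycleStatistics using (hit)
  open Summation
  open ClassEquation using (T-ext)
  open PowerSeries
  open import Data.Bool using (Bool; true; false; _∧_; T)
  open import Data.Bool.Properties using (T-∧)
  open import Data.Nat as ℕ using (ℕ; zero; suc; _≤_; _<_; z≤n; s≤s; _≡ᵇ_)
  import Data.Nat.Properties as ℕ
  open import Data.Rational as ℚ using (ℚ; 0ℚ; _+_; _*_)
  import Data.Rational.Properties as ℚ
  open import Data.Rational.Solver using (module +-*-Solver)
  open import Data.Product using (_,_)
  open import Data.List as L using ([]; _∷_)
  open import Function using (_∘_; Equivalence)
  open import Relation.Binary.PropositionalEquality

  tl : Mono → Mono
  tl [] = []
  tl (_ ∷ m) = m

  next : Ty → Ty
  next (j , θ) = suc j , θ

  -- δ N m c : the exponents prescribed by c and by m agree for 1 ≤ j ≤ N.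
  δ : ℕ → Mono → (Ty → ℕ) → Bool
  δ zero m c = true
  δ (suc N) m c = (c (1 , true) ≡ᵇ expo m 1 true) ∧ ((c (1 , false) ≡ᵇ expo m 1 false) ∧ δ N (tl m) (c ∘ next))

  δ-ext : ∀ N m {c c′} → (∀ j θ → c (suc j , θ) ≡ c′ (suc j , θ)) → δ N m c ≡ δ N m c′
  δ-ext zero m h = refl
  δ-ext (suc N) m h = cong₂ _∧_ (cong (_≡ᵇ expo m 1 true) (h 0 true))
    (cong₂ _∧_ (cong (_≡ᵇ expo m 1 false) (h 0 false)) (δ-ext N (tl m) (λ j θ → h (suc j) θ)))

  expo-outside : ∀ (m : Mono) j θ → L.length m ≤ j → expo m (suc j) θ ≡ 0
  expo-outside [] j θ _ = refl
  expo-outside (_ ∷ m) (suc j) θ (s≤s h) = expo-outside m j θ h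

  expo-tl : ∀ m j θ → expo (tl m) (suc j) θ ≡ expo m (suc (suc j)) θ
  expo-tl [] j θ = refl
  expo-tl (_ ∷ m) j θ = refl

  δ⇒≡ : ∀ N m {c} → T (δ N m c) → ∀ j θ → j < N → c (suc j , θ) ≡ expo m (suc j) θ
  δ⇒≡ (suc N) m {c} h j θ j<N with Equivalence.to (T-∧ {c (1 , true) ≡ᵇ expo m 1 true}) h
  ... | h₁ , h′ with Equivalence.to (T-∧ {c (1 , false) ≡ᵇ expo m 1 false}) h′
  δ⇒≡ (suc N) m h zero true  _ | h₁ , h′ | h₂ , h₃ = ℕ.≡ᵇ⇒≡ _ _ h₁
  δ⇒≡ (suc N) m h zero false _ | h₁ , h′ | h₂ , h₃ = ℕ.≡ᵇ⇒≡ _ _ h₂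
  δ⇒≡ (suc N) m h (suc j) θ (s≤s j<N) | h₁ , h′ | h₂ , h₃ = trans (δ⇒≡ N (tl m) h₃ j θ j<N) (expo-tl m j θ)

  ≡⇒δ : ∀ N m {c} → (∀ j θ → j < N → c (suc j , θ) ≡ expo m (suc j) θ) → T (δ N m c)
  ≡⇒δ zero m h = _
  ≡⇒δ (suc N) m {c} h = Equivalence.from (T-∧ {c (1 , true) ≡ᵇ expo m 1 true}) (ℕ.≡⇒≡ᵇ _ _ (h 0 true (s≤s z≤n)) ,
    Equivalence.from (T-∧ {c (1 , false) ≡ᵇ expo m 1 false}) (ℕ.≡⇒≡ᵇ _ _ (h 0 false (s≤s z≤n)) ,
      ≡⇒δ N (tl m) (λ j θ j<N → trans (h (suc j) θ (s≤s j<N)) (sym (expo-tl m j θ)))))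

  ⟦∧⟧ : ∀ a b → ⟦ a ∧ b ⟧ ≡ ⟦ a ⟧ * ⟦ b ⟧
  ⟦∧⟧ true b = sym (ℚ.*-identityˡ ⟦ b ⟧)
  ⟦∧⟧ false b = sym (ℚ.*-zeroˡ ⟦ b ⟧)

  ⟦∧∧⟧ : ∀ a b c → ⟦ a ∧ (b ∧ c) ⟧ ≡ ⟦ a ⟧ * (⟦ b ⟧ * ⟦ c ⟧)
  ⟦∧∧⟧ a b c = trans (⟦∧⟧ a (b ∧ c)) (cong (⟦ a ⟧ *_) (⟦∧⟧ b c))

  -- d is the pure power t_{j,θ}^ℓ
  isPower : ℕ → ℕ → Bool → Mono → Bool
  isPower ℓ j θ d = (expo d j θ ≡ᵇ ℓ) ∧ (deg d ≡ᵇ ℓ)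

  expo≤deg : ∀ d j θ → expo d j θ ≤ deg d
  expo≤deg [] j θ = z≤n
  expo≤deg (_ ∷ d) zero θ = z≤n
  expo≤deg ((a , b) ∷ d) (suc zero) true = ℕ.≤-trans (ℕ.m≤m+n a b) (ℕ.m≤m+n _ _)
  expo≤deg ((a , b) ∷ d) (suc zero) false = ℕ.≤-trans (ℕ.m≤n+m b a) (ℕ.m≤m+n _ _)
  expo≤deg ((a , b) ∷ d) (suc (suc j)) θ = ℕ.≤-trans (expo≤deg d (suc j) θ) (ℕ.m≤n+m _ (a ℕ.+ b))

  m+n≤n⇒m≡0 : ∀ {u v} → u ℕ.+ v ≤ v → u ≡ 0
  m+n≤n⇒m≡0 {u} {v} h = ℕ.n≤0⇒n≡0 (ℕ.+-cancelʳ-≤ v u 0 h)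

  deg-∷ : ∀ x y d → (deg ((x , y) ∷ d) ≡ᵇ 0) ≡ (x ≡ᵇ 0) ∧ ((y ≡ᵇ 0) ∧ (deg d ≡ᵇ 0))
  deg-∷ zero zero d = refl
  deg-∷ zero (suc y) d = refl
  deg-∷ (suc x) y d = refl

  -- A single exponent never exceeds the degree, so equality of the two leaves no room for the first
  -- pair of exponents.
  isPower-∷-suc : ∀ ℓ j θ x y d → isPower ℓ (suc (suc j)) θ ((x , y) ∷ d) ≡ (x ≡ᵇ 0) ∧ ((y ≡ᵇ 0) ∧ isPower ℓ (suc j) θ d)
  isPower-∷-suc ℓ j θ zero zero d = refl
  isPower-∷-suc ℓ j θ zero (suc y) d = T-ext {(expo d (suc j) θ ≡ᵇ ℓ) ∧ (suc y ℕ.+ deg d ≡ᵇ ℓ)} (λ h → no h) λ ()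
    where
    no : T ((expo d (suc j) θ ≡ᵇ ℓ) ∧ (suc y ℕ.+ deg d ≡ᵇ ℓ)) → T false
    no h with Equivalence.to (T-∧ {expo d (suc j) θ ≡ᵇ ℓ}) h
    ... | h₁ , h₂ with m+n≤n⇒m≡0 {suc y} {deg d} (ℕ.≤-trans (ℕ.≤-reflexive (trans (ℕ.≡ᵇ⇒≡ (suc y ℕ.+ deg d) ℓ h₂) (sym (ℕ.≡ᵇ⇒≡ _ ℓ h₁)))) (expo≤deg d (suc j) θ))
    ... | ()
  isPower-∷-suc ℓ j θ (suc x) y d = T-ext {(expo d (suc j) θ ≡ᵇ ℓ) ∧ (suc x ℕ.+ y ℕ.+ deg d ≡ᵇ ℓ)} (λ h → no h) λ ()
    where
    no : T ((expo d (suc j) θ ≡ᵇ ℓ) ∧ (suc x ℕ.+ y ℕ.+ deg d ≡ᵇ ℓ)) → T false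
    no h with Equivalence.to (T-∧ {expo d (suc j) θ ≡ᵇ ℓ}) h
    ... | h₁ , h₂ with m+n≤n⇒m≡0 {suc x ℕ.+ y} {deg d} (ℕ.≤-trans (ℕ.≤-reflexive (trans (ℕ.≡ᵇ⇒≡ (suc x ℕ.+ y ℕ.+ deg d) ℓ h₂) (sym (ℕ.≡ᵇ⇒≡ _ ℓ h₁)))) (expo≤deg d (suc j) θ))
    ... | ()

  +≡ˡ : ∀ x r ℓ → x ≡ ℓ → (x ℕ.+ r ≡ᵇ ℓ) ≡ (r ≡ᵇ 0)
  +≡ˡ zero r zero refl = refl
  +≡ˡ (suc x) r (suc .x) refl = +≡ˡ x r x refl

  isPower-∷-true : ∀ ℓ x y d → isPower ℓ 1 true ((x , y) ∷ d) ≡ (x ≡ᵇ ℓ) ∧ ((y ≡ᵇ 0) ∧ (deg d ≡ᵇ 0))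
  isPower-∷-true ℓ x y d with x ≡ᵇ ℓ in e
  ... | false = refl
  ... | true = trans (cong (_≡ᵇ ℓ) (ℕ.+-assoc x y (deg d))) (trans (+≡ˡ x (y ℕ.+ deg d) ℓ (ℕ.≡ᵇ⇒≡ x ℓ (≡⇒T e))) (deg-∷ 0 y d))

  isPower-∷-false : ∀ ℓ x y d → isPower ℓ 1 false ((x , y) ∷ d) ≡ (x ≡ᵇ 0) ∧ ((y ≡ᵇ ℓ) ∧ (deg d ≡ᵇ 0))
  isPower-∷-false ℓ x y d with y ≡ᵇ ℓ in e
  ... | false with x ≡ᵇ 0
  ... | true = refl
  ... | false = refl
  isPower-∷-false ℓ x y d | true = trans (cong (_≡ᵇ ℓ) (trans (cong (ℕ._+ deg d) (ℕ.+-comm x y)) (ℕ.+-assoc y x (deg d))))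
    (trans (+≡ˡ y (x ℕ.+ deg d) ℓ (ℕ.≡ᵇ⇒≡ y ℓ (≡⇒T e))) (x0 x))
    where
    x0 : ∀ x → (x ℕ.+ deg d ≡ᵇ 0) ≡ (x ≡ᵇ 0) ∧ (deg d ≡ᵇ 0)
    x0 zero = refl
    x0 (suc x) = refl

  conv-∷-product : ∀ a b m F (f g : ℕ → ℕ → ℚ) H →
    (∀ x y d x′ y′ q → F ((x , y) ∷ d) ((x′ , y′) ∷ q) ≡ f x x′ * (g y y′ * H d q)) →
    conv ((a , b) ∷ m) F ≡ splitN a f * (splitN b g * conv m H)
  conv-∷-product a b m F f g H h = begin
    conv ((a , b) ∷ m) F
      ≡⟨ conv-∷ a b m F ⟩
    splitN a (λ x x′ → splitN b (λ y y′ → conv m (λ d q → F ((x , y) ∷ d) ((x′ , y′) ∷ q)))) ≡⟨ splitN-cong a (λ x x′ _ → trans (splitN-cong b (λ y y′ _ →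
                                                                                                  trans (conv-≗ m (λ d q → h x y d x′ y′ q)) (trans (conv-*ˡ m (f x x′) (λ d q → g y y′ * H d q)) (cong (f x x′ *_) (conv-*ˡ m (g y y′) H)))))
                                                                                                  (trans (splitN-*ˡ b (f x x′) (λ y y′ → g y y′ * conv m H)) (cong (f x x′ *_) (splitN-*ʳ b (conv m H) g)))) ⟩
    splitN a (λ x x′ → f x x′ * (splitN b g * conv m H))
      ≡⟨ splitN-*ʳ a (splitN b g * conv m H) f ⟩
    splitN a f * (splitN b g * conv m H)                                                     ∎
    where open ≡-Reasoning

  splitN-first : ∀ a (h : ℕ → ℚ) → splitN a (λ x y → ⟦ x ≡ᵇ 0 ⟧ * h y) ≡ h a
  splitN-first zero h = trans (splitN-zero _) (ℚ.*-identityˡ (h 0))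
  splitN-first (suc a) h = trans (splitN-suc a _) (trans (cong₂ _+_ (ℚ.*-identityˡ (h (suc a)))
    (trans (splitN-*ˡ a 0ℚ (λ _ y → h y)) (ℚ.*-zeroˡ (splitN a (λ _ y → h y))))) (ℚ.+-identityʳ (h (suc a))))

  splitN-match : ∀ a ℓ c → splitN a (λ x y → ⟦ x ≡ᵇ ℓ ⟧ * ⟦ c ≡ᵇ y ⟧) ≡ ⟦ c ℕ.+ ℓ ≡ᵇ a ⟧
  splitN-match a zero c = trans (splitN-first a (λ y → ⟦ c ≡ᵇ y ⟧)) (cong (λ n → ⟦ n ≡ᵇ a ⟧) (sym (ℕ.+-identityʳ c)))
  splitN-match zero (suc ℓ) c = trans (splitN-zero _) (trans (ℚ.*-zeroˡ ⟦ c ≡ᵇ 0 ⟧) (cong (λ n → ⟦ n ≡ᵇ 0 ⟧) (sym (ℕ.+-suc c ℓ))))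
  splitN-match (suc a) (suc ℓ) c = trans (splitN-suc a _) (trans (cong₂ _+_ (ℚ.*-zeroˡ ⟦ c ≡ᵇ suc a ⟧) (splitN-match a ℓ c))
    (trans (ℚ.+-identityˡ _) (cong (λ n → ⟦ n ≡ᵇ suc a ⟧) (sym (ℕ.+-suc c ℓ)))))

  conv-one : ∀ m (G : Mono → ℚ) → conv m (λ d q → ⟦ deg d ≡ᵇ 0 ⟧ * G q) ≡ G m
  conv-one [] G = trans (conv-[] _) (ℚ.*-identityˡ (G []))
  conv-one ((a , b) ∷ m) G = begin
    conv ((a , b) ∷ m) (λ d q → ⟦ deg d ≡ᵇ 0 ⟧ * G q)
      ≡⟨ conv-∷ a b m _ ⟩
    splitN a (λ x x′ → splitN b (λ y y′ → conv m (λ d q → ⟦ deg ((x , y) ∷ d) ≡ᵇ 0 ⟧ * G ((x′ , y′) ∷ q))))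
      ≡⟨ splitN-cong a (λ x x′ _ → trans (splitN-cong b (λ y y′ _ → trans (conv-≗ m (λ d q → trans
           (cong (_* G ((x′ , y′) ∷ q)) (trans (cong ⟦_⟧ (deg-∷ x y d)) (⟦∧∧⟧ (x ≡ᵇ 0) (y ≡ᵇ 0) (deg d ≡ᵇ 0))))
           (assoc₄ ⟦ x ≡ᵇ 0 ⟧ ⟦ y ≡ᵇ 0 ⟧ ⟦ deg d ≡ᵇ 0 ⟧ (G ((x′ , y′) ∷ q)))))
           (trans (conv-*ˡ m ⟦ x ≡ᵇ 0 ⟧ (λ d q → ⟦ y ≡ᵇ 0 ⟧ * (⟦ deg d ≡ᵇ 0 ⟧ * G ((x′ , y′) ∷ q)))) (cong (⟦ x ≡ᵇ 0 ⟧ *_) (conv-*ˡ m ⟦ y ≡ᵇ 0 ⟧ (λ d q → ⟦ deg d ≡ᵇ 0 ⟧ * G ((x′ , y′) ∷ q)))))))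
           (splitN-*ˡ b ⟦ x ≡ᵇ 0 ⟧ (λ y y′ → ⟦ y ≡ᵇ 0 ⟧ * conv m (λ d q → ⟦ deg d ≡ᵇ 0 ⟧ * G ((x′ , y′) ∷ q))))) ⟩
    splitN a (λ x x′ → ⟦ x ≡ᵇ 0 ⟧ * splitN b (λ y y′ → ⟦ y ≡ᵇ 0 ⟧ * conv m (λ d q → ⟦ deg d ≡ᵇ 0 ⟧ * G ((x′ , y′) ∷ q))))
      ≡⟨ splitN-first a (λ x′ → splitN b (λ y y′ → ⟦ y ≡ᵇ 0 ⟧ * conv m (λ d q → ⟦ deg d ≡ᵇ 0 ⟧ * G ((x′ , y′) ∷ q)))) ⟩
    splitN b (λ y y′ → ⟦ y ≡ᵇ 0 ⟧ * conv m (λ d q → ⟦ deg d ≡ᵇ 0 ⟧ * G ((a , y′) ∷ q)))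
      ≡⟨ splitN-first b (λ y′ → conv m (λ d q → ⟦ deg d ≡ᵇ 0 ⟧ * G ((a , y′) ∷ q))) ⟩
    conv m (λ d q → ⟦ deg d ≡ᵇ 0 ⟧ * G ((a , b) ∷ q))
      ≡⟨ conv-one m (λ q → G ((a , b) ∷ q)) ⟩
    G ((a , b) ∷ m)
      ∎
    where
    open ≡-Reasoning
    assoc₄ : ∀ a b c d → (a * (b * c)) * d ≡ a * (b * (c * d))
    assoc₄ = solve 4 (λ a b c d → (a :* (b :* c)) :* d := a :* (b :* (c :* d))) refl
      where open +-*-Solver

  interchange₃ : ∀ a b c d e f → (a * (b * c)) * (d * (e * f)) ≡ (a * d) * ((b * e) * (c * f))
  interchange₃ = solve 6 (λ a b c d e f → (a :* (b :* c)) :* (d :* (e :* f)) := (a :* d) :* ((b :* e) :* (c :* f))) refl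
    where open +-*-Solver

  infixl 6 _⊕[_]_
  _⊕[_]_ : (Ty → ℕ) → ℕ → Ty → Ty → ℕ
  (c ⊕[ ℓ ] τ) σ = c σ ℕ.+ ℓ ℕ.* hit τ σ

  δ-[]-false : ∀ N j θ ℓ c → j < N → δ N [] (c ⊕[ suc ℓ ] (suc j , θ)) ≡ false
  δ-[]-false (suc N) zero true ℓ c _ rewrite ℕ.+-suc (c (1 , true)) (ℓ ℕ.* 1) = refl
  δ-[]-false (suc N) zero false ℓ c _ rewrite ℕ.+-suc (c (1 , false)) (ℓ ℕ.* 1) with c (1 , true) ℕ.+ ℓ ℕ.* 0 ≡ᵇ 0
  ... | true = refl
  ... | false = refl
  δ-[]-false (suc N) (suc j) θ ℓ c (s≤s j<N)
    rewrite δ-[]-false N j θ ℓ (c ∘ next) j<N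
    with c (1 , true) ℕ.+ ℓ ℕ.* 0 ≡ᵇ 0 | c (1 , false) ℕ.+ ℓ ℕ.* 0 ≡ᵇ 0
  ... | true | true = refl
  ... | true | false = refl
  ... | false | _ = refl

  -- Adding ℓ to the count at one type multiplies the monomial of the counts by t_{j,θ}^ℓ; this is
  -- the same fact for coefficients. Since `δ N` is blind to larger indices, the index of the new
  -- power has to lie below the cut-off.
  δ-shift : ∀ N m j θ ℓ c → j < N →
    ⟦ δ N m (c ⊕[ ℓ ] (suc j , θ)) ⟧ ≡ conv m (λ d q → ⟦ isPower ℓ (suc j) θ d ⟧ * ⟦ δ N q c ⟧)
  δ-shift N [] j θ zero c j<N = trans (cong ⟦_⟧ (δ-ext N [] (λ i η → ℕ.+-identityʳ (c (suc i , η))))) (sym (trans (conv-[] _) (ℚ.*-identityˡ ⟦ δ N [] c ⟧)))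
  δ-shift N [] j θ (suc ℓ) c j<N = trans (cong ⟦_⟧ (δ-[]-false N j θ ℓ c j<N)) (sym (trans (conv-[] _) (ℚ.*-zeroˡ ⟦ δ N [] c ⟧)))
  δ-shift (suc N) ((a , b) ∷ m) zero true ℓ c _ = begin
    ⟦ δ (suc N) ((a , b) ∷ m) (c ⊕[ ℓ ] (1 , true)) ⟧
      ≡⟨ ⟦∧∧⟧ (c₁ ℕ.+ ℓ ℕ.* 1 ≡ᵇ a) (c₂ ℕ.+ ℓ ℕ.* 0 ≡ᵇ b) (δ N m ((c ⊕[ ℓ ] (1 , true)) ∘ next)) ⟩
    ⟦ c₁ ℕ.+ ℓ ℕ.* 1 ≡ᵇ a ⟧ * (⟦ c₂ ℕ.+ ℓ ℕ.* 0 ≡ᵇ b ⟧ * ⟦ δ N m ((c ⊕[ ℓ ] (1 , true)) ∘ next) ⟧)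
      ≡⟨ cong₂ (λ u v → ⟦ c₁ ℕ.+ u ≡ᵇ a ⟧ * v) (ℕ.*-identityʳ ℓ) (cong₂ (λ u v → ⟦ c₂ ℕ.+ u ≡ᵇ b ⟧ * ⟦ v ⟧) (ℕ.*-zeroʳ ℓ)
           (δ-ext N m (λ i η → trans (cong (c (suc (suc i) , η) ℕ.+_) (ℕ.*-zeroʳ ℓ)) (ℕ.+-identityʳ _)))) ⟩
    ⟦ c₁ ℕ.+ ℓ ≡ᵇ a ⟧ * (⟦ c₂ ℕ.+ 0 ≡ᵇ b ⟧ * ⟦ δ N m (c ∘ next) ⟧)
      ≡⟨ sym (cong₂ _*_ (splitN-match a ℓ c₁) (cong₂ _*_ (splitN-match b 0 c₂) (conv-one m (λ q → ⟦ δ N q (c ∘ next) ⟧)))) ⟩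
    splitN a (λ x x′ → ⟦ x ≡ᵇ ℓ ⟧ * ⟦ c₁ ≡ᵇ x′ ⟧) * (splitN b (λ y y′ → ⟦ y ≡ᵇ 0 ⟧ * ⟦ c₂ ≡ᵇ y′ ⟧) * conv m (λ d q → ⟦ deg d ≡ᵇ 0 ⟧ * ⟦ δ N q (c ∘ next) ⟧))
      ≡⟨ sym (conv-∷-product a b m (λ d q → ⟦ isPower ℓ 1 true d ⟧ * ⟦ δ (suc N) q c ⟧) _ _ _ (λ x y d x′ y′ q →
           trans (cong₂ _*_ (trans (cong ⟦_⟧ (isPower-∷-true ℓ x y d)) (⟦∧∧⟧ (x ≡ᵇ ℓ) (y ≡ᵇ 0) (deg d ≡ᵇ 0))) (⟦∧∧⟧ (c₁ ≡ᵇ x′) (c₂ ≡ᵇ y′) (δ N q (c ∘ next))))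
                 (interchange₃ ⟦ x ≡ᵇ ℓ ⟧ ⟦ y ≡ᵇ 0 ⟧ ⟦ deg d ≡ᵇ 0 ⟧ ⟦ c₁ ≡ᵇ x′ ⟧ ⟦ c₂ ≡ᵇ y′ ⟧ ⟦ δ N q (c ∘ next) ⟧))) ⟩
    conv ((a , b) ∷ m) (λ d q → ⟦ isPower ℓ 1 true d ⟧ * ⟦ δ (suc N) q c ⟧)
      ∎
    where
    open ≡-Reasoning
    c₁ = c (1 , true)
    c₂ = c (1 , false)
  δ-shift (suc N) ((a , b) ∷ m) zero false ℓ c _ = begin
    ⟦ δ (suc N) ((a , b) ∷ m) (c ⊕[ ℓ ] (1 , false)) ⟧
      ≡⟨ ⟦∧∧⟧ (c₁ ℕ.+ ℓ ℕ.* 0 ≡ᵇ a) (c₂ ℕ.+ ℓ ℕ.* 1 ≡ᵇ b) (δ N m ((c ⊕[ ℓ ] (1 , false)) ∘ next)) ⟩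
    ⟦ c₁ ℕ.+ ℓ ℕ.* 0 ≡ᵇ a ⟧ * (⟦ c₂ ℕ.+ ℓ ℕ.* 1 ≡ᵇ b ⟧ * ⟦ δ N m ((c ⊕[ ℓ ] (1 , false)) ∘ next) ⟧)
      ≡⟨ cong₂ (λ u v → ⟦ c₁ ℕ.+ u ≡ᵇ a ⟧ * v) (ℕ.*-zeroʳ ℓ) (cong₂ (λ u v → ⟦ c₂ ℕ.+ u ≡ᵇ b ⟧ * ⟦ v ⟧) (ℕ.*-identityʳ ℓ)
           (δ-ext N m (λ i η → trans (cong (c (suc (suc i) , η) ℕ.+_) (ℕ.*-zeroʳ ℓ)) (ℕ.+-identityʳ _)))) ⟩
    ⟦ c₁ ℕ.+ 0 ≡ᵇ a ⟧ * (⟦ c₂ ℕ.+ ℓ ≡ᵇ b ⟧ * ⟦ δ N m (c ∘ next) ⟧)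
      ≡⟨ sym (cong₂ _*_ (splitN-match a 0 c₁) (cong₂ _*_ (splitN-match b ℓ c₂) (conv-one m (λ q → ⟦ δ N q (c ∘ next) ⟧)))) ⟩
    splitN a (λ x x′ → ⟦ x ≡ᵇ 0 ⟧ * ⟦ c₁ ≡ᵇ x′ ⟧) * (splitN b (λ y y′ → ⟦ y ≡ᵇ ℓ ⟧ * ⟦ c₂ ≡ᵇ y′ ⟧) * conv m (λ d q → ⟦ deg d ≡ᵇ 0 ⟧ * ⟦ δ N q (c ∘ next) ⟧))
      ≡⟨ sym (conv-∷-product a b m (λ d q → ⟦ isPower ℓ 1 false d ⟧ * ⟦ δ (suc N) q c ⟧) _ _ _ (λ x y d x′ y′ q →
           trans (cong₂ _*_ (trans (cong ⟦_⟧ (isPower-∷-false ℓ x y d)) (⟦∧∧⟧ (x ≡ᵇ 0) (y ≡ᵇ ℓ) (deg d ≡ᵇ 0))) (⟦∧∧⟧ (c₁ ≡ᵇ x′) (c₂ ≡ᵇ y′) (δ N q (c ∘ next))))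
                 (interchange₃ ⟦ x ≡ᵇ 0 ⟧ ⟦ y ≡ᵇ ℓ ⟧ ⟦ deg d ≡ᵇ 0 ⟧ ⟦ c₁ ≡ᵇ x′ ⟧ ⟦ c₂ ≡ᵇ y′ ⟧ ⟦ δ N q (c ∘ next) ⟧))) ⟩
    conv ((a , b) ∷ m) (λ d q → ⟦ isPower ℓ 1 false d ⟧ * ⟦ δ (suc N) q c ⟧)
      ∎
    where
    open ≡-Reasoning
    c₁ = c (1 , true)
    c₂ = c (1 , false)
  δ-shift (suc N) ((a , b) ∷ m) (suc j) θ ℓ c (s≤s j<N) = begin
    ⟦ δ (suc N) ((a , b) ∷ m) (c ⊕[ ℓ ] (suc (suc j) , θ)) ⟧
      ≡⟨ ⟦∧∧⟧ (c₁ ℕ.+ ℓ ℕ.* 0 ≡ᵇ a) (c₂ ℕ.+ ℓ ℕ.* 0 ≡ᵇ b) (δ N m ((c ⊕[ ℓ ] (suc (suc j) , θ)) ∘ next)) ⟩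
    ⟦ c₁ ℕ.+ ℓ ℕ.* 0 ≡ᵇ a ⟧ * (⟦ c₂ ℕ.+ ℓ ℕ.* 0 ≡ᵇ b ⟧ * ⟦ δ N m ((c ⊕[ ℓ ] (suc (suc j) , θ)) ∘ next) ⟧)
      ≡⟨ cong₂ (λ u v → ⟦ c₁ ℕ.+ u ≡ᵇ a ⟧ * v) (ℕ.*-zeroʳ ℓ) (cong₂ (λ u v → ⟦ c₂ ℕ.+ u ≡ᵇ b ⟧ * ⟦ v ⟧) (ℕ.*-zeroʳ ℓ) refl) ⟩
    ⟦ c₁ ℕ.+ 0 ≡ᵇ a ⟧ * (⟦ c₂ ℕ.+ 0 ≡ᵇ b ⟧ * ⟦ δ N m ((c ∘ next) ⊕[ ℓ ] (suc j , θ)) ⟧)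
      ≡⟨ sym (cong₂ _*_ (splitN-match a 0 c₁) (cong₂ _*_ (splitN-match b 0 c₂) (sym (δ-shift N m j θ ℓ (c ∘ next) j<N)))) ⟩
    splitN a (λ x x′ → ⟦ x ≡ᵇ 0 ⟧ * ⟦ c₁ ≡ᵇ x′ ⟧) * (splitN b (λ y y′ → ⟦ y ≡ᵇ 0 ⟧ * ⟦ c₂ ≡ᵇ y′ ⟧) * conv m (λ d q → ⟦ isPower ℓ (suc j) θ d ⟧ * ⟦ δ N q (c ∘ next) ⟧))
      ≡⟨ sym (conv-∷-product a b m (λ d q → ⟦ isPower ℓ (suc (suc j)) θ d ⟧ * ⟦ δ (suc N) q c ⟧) _ _ _ (λ x y d x′ y′ q →
           trans (cong₂ _*_ (trans (cong ⟦_⟧ (isPower-∷-suc ℓ j θ x y d)) (⟦∧∧⟧ (x ≡ᵇ 0) (y ≡ᵇ 0) (isPower ℓ (suc j) θ d))) (⟦∧∧⟧ (c₁ ≡ᵇ x′) (c₂ ≡ᵇ y′) (δ N q (c ∘ next))))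
                 (interchange₃ ⟦ x ≡ᵇ 0 ⟧ ⟦ y ≡ᵇ 0 ⟧ ⟦ isPower ℓ (suc j) θ d ⟧ ⟦ c₁ ≡ᵇ x′ ⟧ ⟦ c₂ ≡ᵇ y′ ⟧ ⟦ δ N q (c ∘ next) ⟧))) ⟩
    conv ((a , b) ∷ m) (λ d q → ⟦ isPower ℓ (suc (suc j)) θ d ⟧ * ⟦ δ (suc N) q c ⟧)
      ∎
    where
    open ≡-Reasoning
    c₁ = c (1 , true)
    c₂ = c (1 , false)

-- The Euler derivative of the exponent on the right-hand side.

module Exponents where

  open CycleTypes using (Ty; T⇒≡; ≡⇒T; ¬T⇒≡; powType; quotients-coprime)
  open Summation
  open SignedAverages using (sgn; ½)
  open ClassEquation using (T-ext)
  open PowerSeries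
  open Powers
  open import Data.Bool using (Bool; true; false; _∧_; not; _xor_; if_then_else_; T)
  open import Data.Bool.Properties using (T-∧)
  open import Data.Empty using (⊥-elim)
  open import Data.Nat as ℕ using (ℕ; zero; suc; _≤_; _<_; z≤n; s≤s; _≡ᵇ_; NonZero)
  import Data.Nat.Properties as ℕ
  open import Data.Nat.DivMod using (m*n/n≡m)
  open import Data.Nat.Divisibility using (_∣_; _∣?_; divides; quotient; ∣⇒≤; module _∣_)
  open import Data.Nat.GCD using (gcd; gcd[m,n]∣m; gcd[m,n]∣n; c*gcd[m,n]≡gcd[cm,cn]; gcd-comm)
  open import Data.Nat.Coprimality as Coprime using (Coprime; coprime⇒gcd≡1)
  open import Data.Rational as ℚ using (ℚ; 0ℚ; 1ℚ; _+_; _*_)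
  import Data.Rational.Properties as ℚ
  open import Data.Rational.Solver using (module +-*-Solver)
  open import Data.Product using (_×_; _,_; proj₁; proj₂)
  open import Data.List as L using (upTo; length)
  open import Data.List.Membership.Propositional.Properties using (∈-upTo⁻)
  open import Function using (_∘_; Equivalence)
  open import Relation.Binary.PropositionalEquality
  open import Relation.Nullary
  open import Relation.Nullary.Decidable using (⌊_⌋; toWitness; fromWitness; T?)

  ∑-upTo-single : ∀ {N} i₀ f → i₀ < N → (∀ i → i ≢ i₀ → f i ≡ 0ℚ) → ∑ (upTo N) f ≡ f i₀
  ∑-upTo-single {suc N} zero f _ h = trans (∑-upTo-suc N f) (trans (cong (f 0 +_) (∑-≡0 (upTo N) (λ {i} _ → h (suc i) λ ()))) (ℚ.+-identityʳ (f 0)))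
  ∑-upTo-single {suc N} (suc i₀) f (s≤s i₀<N) h = trans (∑-upTo-suc N f) (trans (cong₂ _+_ (h 0 λ ())
    (∑-upTo-single i₀ (f ∘ suc) i₀<N (λ i ne → h (suc i) (ne ∘ ℕ.suc-injective)))) (ℚ.+-identityˡ (f (suc i₀))))

  module Exponent (k : ℕ) (1≤k : 1 ≤ k) where

    size : ℕ → ℕ → ℕ
    size j′ h′ = suc j′ ℕ.* (k ℕ./ suc h′)

    contributes : Mono → ℕ → Bool → ℕ → Bool
    contributes m j′ θ h′ = ⌊ suc h′ ∣? k ⌋ ∧ ((gcd (suc h′) (suc j′) ≡ᵇ 1) ∧ ((expo m (suc j′) θ ≡ᵇ size j′ h′) ∧ (deg m ≡ᵇ size j′ h′)))

    term : Mono → ℕ → Bool → ℕ → ℚ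
    term m j′ θ h′ = if contributes m j′ θ h′ then divℚ (srootsZ2 (suc h′) θ) (2 ℕ.* size j′ h′) else 0ℚ

    rhsExponent-term : ∀ m → rhsExponent k m ≡ ∑ (upTo (length m)) (λ j′ → ∑ signs (λ θ → ∑ (upTo k) (term m j′ θ)))
    rhsExponent-term m = refl

    contributes⇒ : ∀ m j′ θ h′ → T (contributes m j′ θ h′) →
      suc h′ ∣ k × gcd (suc h′) (suc j′) ≡ 1 × expo m (suc j′) θ ≡ size j′ h′ × deg m ≡ size j′ h′
    contributes⇒ m j′ θ h′ c with Equivalence.to (T-∧ {⌊ suc h′ ∣? k ⌋}) c
    ... | c₁ , c′ with Equivalence.to (T-∧ {gcd (suc h′) (suc j′) ≡ᵇ 1}) c′
    ... | c₂ , c″ with Equivalence.to (T-∧ {expo m (suc j′) θ ≡ᵇ size j′ h′}) c″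
    ... | c₃ , c₄ = toWitness c₁ , ℕ.≡ᵇ⇒≡ _ 1 c₂ , ℕ.≡ᵇ⇒≡ _ _ c₃ , ℕ.≡ᵇ⇒≡ _ _ c₄

    ⇒contributes : ∀ m j′ θ h′ → suc h′ ∣ k → gcd (suc h′) (suc j′) ≡ 1 → expo m (suc j′) θ ≡ size j′ h′ → deg m ≡ size j′ h′ →
      T (contributes m j′ θ h′)
    ⇒contributes m j′ θ h′ c₁ c₂ c₃ c₄ = Equivalence.from (T-∧ {⌊ suc h′ ∣? k ⌋}) (fromWitness c₁ ,
      Equivalence.from (T-∧ {gcd (suc h′) (suc j′) ≡ᵇ 1}) (ℕ.≡⇒≡ᵇ _ 1 c₂ ,
        Equivalence.from (T-∧ {expo m (suc j′) θ ≡ᵇ size j′ h′}) (ℕ.≡⇒≡ᵇ _ _ c₃ , ℕ.≡⇒≡ᵇ _ _ c₄)))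

    term-zero : ∀ m j′ θ h′ → ¬ T (contributes m j′ θ h′) → term m j′ θ h′ ≡ 0ℚ
    term-zero m j′ θ h′ ¬c = cong (λ b → if b then divℚ (srootsZ2 (suc h′) θ) (2 ℕ.* size j′ h′) else 0ℚ) (¬T⇒≡ ¬c)

    constantFree : ConstantFree (rhsExponent k)
    constantFree m m0 = ∑-≡0 (upTo (length m)) (λ {j′} _ → ∑-≡0 signs (λ {θ} _ → ∑-≡0 (upTo k) (λ {h′} _ → vanish j′ θ h′)))
      where
      vanish : ∀ j′ θ h′ → term m j′ θ h′ ≡ 0ℚ
      vanish j′ θ h′ with contributes m j′ θ h′ in c
      ... | false = refl
      -- A match would make the size equal to the degree 0, and division by zero has the value `0ℚ`
      -- by convention, so positivity of the sizes need not be shown here.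
      ... | true = cong (λ n → divℚ (srootsZ2 (suc h′) θ) (2 ℕ.* n)) (trans (sym (proj₂ (proj₂ (proj₂ (contributes⇒ m j′ θ h′ (≡⇒T c)))))) m0)

    module _ (m : Mono) (t : ℕ) (deg≡ : deg m ≡ suc t) where

      ℓ g j₀ h₀ : ℕ
      ℓ = suc t
      g = gcd ℓ k
      j₀ = quotient (gcd[m,n]∣m ℓ k)
      h₀ = quotient (gcd[m,n]∣n ℓ k)

      ℓ≡ : ℓ ≡ j₀ ℕ.* g
      ℓ≡ = _∣_.equality (gcd[m,n]∣m ℓ k)
      k≡ : k ≡ h₀ ℕ.* g
      k≡ = _∣_.equality (gcd[m,n]∣n ℓ k)

      -- If h ∣ k, gcd(h , j) = 1 and j k / h = ℓ, then k / h = gcd(ℓ , k).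
      indices : ∀ j′ θ h′ → T (contributes m j′ θ h′) → suc j′ ≡ j₀ × suc h′ ≡ h₀
      indices j′ θ h′ c with contributes⇒ m j′ θ h′ c
      ... | divides q kq , coprime , _ , deg≡size = ℕ.*-cancelʳ-≡ (suc j′) j₀ g (trans (cong (suc j′ ℕ.*_) g≡q) (trans (sym ℓ≡jq) ℓ≡)) ,
                                                    ℕ.*-cancelʳ-≡ (suc h′) h₀ g (trans (cong (suc h′ ℕ.*_) g≡q) (trans (ℕ.*-comm (suc h′) q) (trans (sym kq) k≡)))
        where
        k/h≡q : k ℕ./ suc h′ ≡ q
        k/h≡q = trans (cong (ℕ._/ suc h′) kq) (m*n/n≡m q (suc h′))
        ℓ≡jq : ℓ ≡ suc j′ ℕ.* q
        ℓ≡jq = trans (sym deg≡) (trans deg≡size (cong (suc j′ ℕ.*_) k/h≡q))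
        g≡q : g ≡ q
        g≡q = begin
          gcd ℓ k
            ≡⟨ cong₂ gcd (trans ℓ≡jq (ℕ.*-comm (suc j′) q)) kq ⟩
          gcd (q ℕ.* suc j′) (q ℕ.* suc h′)
            ≡⟨ sym (c*gcd[m,n]≡gcd[cm,cn] q (suc j′) (suc h′)) ⟩
          q ℕ.* gcd (suc j′) (suc h′)
            ≡⟨ cong (q ℕ.*_) (trans (gcd-comm (suc j′) (suc h′)) coprime) ⟩
          q ℕ.* 1
            ≡⟨ ℕ.*-identityʳ q ⟩
          q                                        ∎
          where open ≡-Reasoning
        g≢0 : g ≢ 0
        g≢0 g0 = ℕ.<-irrefl (sym (trans ℓ≡ (trans (cong (j₀ ℕ.*_) g0) (ℕ.*-zeroʳ j₀)))) (s≤s z≤n)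
        instance
          _ : NonZero g
          _ = ℕ.≢-nonZero g≢0

      module _ (a b : ℕ) (a≡ : j₀ ≡ suc a) (b≡ : h₀ ≡ suc b) where

        k≡gh : k ≡ g ℕ.* suc b
        k≡gh = trans k≡ (trans (cong (ℕ._* g) b≡) (ℕ.*-comm (suc b) g))

        b<k : b < k
        b<k = ∣⇒≤ {{ℕ.>-nonZero 1≤k}} (divides g k≡gh)

        size≡ : size a b ≡ ℓ
        size≡ = trans (cong (suc a ℕ.*_) (trans (cong (ℕ._/ suc b) k≡gh) (m*n/n≡m g (suc b))))
                      (trans (cong (ℕ._* g) (sym a≡)) (sym ℓ≡))

        contributes≡ : ∀ θ → contributes m a θ b ≡ (expo m (suc a) θ ≡ᵇ ℓ)
        contributes≡ θ = T-ext
          (λ c → ℕ.≡⇒≡ᵇ _ _ (trans (proj₁ (proj₂ (proj₂ (contributes⇒ m a θ b c)))) size≡))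
          (λ e → ⇒contributes m a θ b
            (divides g k≡gh)
            (coprime⇒gcd≡1 (Coprime.sym (subst₂ Coprime a≡ b≡ (quotients-coprime ℓ k 1≤k))))
            (trans (ℕ.≡ᵇ⇒≡ _ _ e) (sym size≡)) (trans deg≡ (sym size≡)))

        -- The derivation multiplies by ℓ, which cancels against the denominator 2ℓ; what is left is
        -- the ½ of the recursion.
        term-value : ∀ θ → ιℕ ℓ * term m a θ b ≡ ½ * (⟦ expo m (suc a) θ ≡ᵇ ℓ ⟧ * ι (srootsZ2 (suc b) θ))
        term-value θ = trans (cong (ιℕ ℓ *_) (cong₂ (λ c n → if c then divℚ (srootsZ2 (suc b) θ) (2 ℕ.* n) else 0ℚ) (contributes≡ θ) size≡)) (value (expo m (suc a) θ ≡ᵇ ℓ))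
          where
          p = srootsZ2 (suc b) θ
          value : ∀ c → ιℕ ℓ * (if c then divℚ p (2 ℕ.* ℓ) else 0ℚ) ≡ ½ * (⟦ c ⟧ * ι p)
          value false = trans (ℚ.*-zeroʳ (ιℕ ℓ)) (sym (trans (cong (½ *_) (ℚ.*-zeroˡ (ι p))) (ℚ.*-zeroʳ ½)))
          value true = begin
            ιℕ ℓ * x
              ≡⟨ sym (ℚ.*-identityˡ (ιℕ ℓ * x)) ⟩
            (½ * ιℕ 2) * (ιℕ ℓ * x)
              ≡⟨ solve 4 (λ h d l x → (h :* d) :* (l :* x) := h :* (x :* (d :* l))) refl ½ (ιℕ 2) (ιℕ ℓ) x ⟩
            ½ * (x * (ιℕ 2 * ιℕ ℓ))
              ≡⟨ cong (λ e → ½ * (x * e)) (sym (ιℕ-* 2 ℓ)) ⟩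
            ½ * (x * ιℕ (2 ℕ.* ℓ))
              ≡⟨ cong (½ *_) (divℚ-* p (2 ℕ.* ℓ) (s≤s z≤n)) ⟩
            ½ * ι p
              ≡⟨ cong (½ *_) (sym (ℚ.*-identityˡ (ι p))) ⟩
            ½ * (1ℚ * ι p)                      ∎
            where
            open ≡-Reasoning
            open +-*-Solver
            x = divℚ p (2 ℕ.* ℓ)

        off-j : ∀ j′ → j′ ≢ a → ∑ signs (λ θ → ∑ (upTo k) (term m j′ θ)) ≡ 0ℚ
        off-j j′ ne = ∑-≡0 signs (λ {θ} _ → ∑-≡0 (upTo k) (λ {h′} _ →
          term-zero m j′ θ h′ (λ c → ne (ℕ.suc-injective (trans (proj₁ (indices j′ θ h′ c)) a≡)))))

        off-h : ∀ θ h′ → h′ ≢ b → term m a θ h′ ≡ 0ℚ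
        off-h θ h′ ne = term-zero m a θ h′ (λ c → ne (ℕ.suc-injective (trans (proj₂ (indices a θ h′ c)) b≡)))

        D-by-sign : D (rhsExponent k) m ≡ ½ * ∑ signs (λ θ → ⟦ expo m (suc a) θ ≡ᵇ ℓ ⟧ * ι (srootsZ2 (suc b) θ))
        D-by-sign with a ℕ.<? length m
        ... | yes a< = begin
          ιℕ (deg m) * rhsExponent k m
            ≡⟨ cong₂ (λ n e → ιℕ n * e) deg≡ (trans (rhsExponent-term m) (trans (∑-upTo-single a (λ j′ → ∑ signs (λ θ → ∑ (upTo k) (term m j′ θ))) a< off-j)
                                                                                (∑-cong signs (λ θ → ∑-upTo-single b (term m a θ) b<k (off-h θ))))) ⟩
          ιℕ ℓ * ∑ signs (λ θ → term m a θ b)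
            ≡⟨ sym (∑-*ˡ signs (ιℕ ℓ) (λ θ → term m a θ b)) ⟩
          ∑ signs (λ θ → ιℕ ℓ * term m a θ b)
            ≡⟨ ∑-cong signs term-value ⟩
          ∑ signs (λ θ → ½ * (⟦ expo m (suc a) θ ≡ᵇ ℓ ⟧ * ι (srootsZ2 (suc b) θ)))
            ≡⟨ ∑-*ˡ signs ½ (λ θ → ⟦ expo m (suc a) θ ≡ᵇ ℓ ⟧ * ι (srootsZ2 (suc b) θ)) ⟩
          ½ * ∑ signs (λ θ → ⟦ expo m (suc a) θ ≡ᵇ ℓ ⟧ * ι (srootsZ2 (suc b) θ))     ∎
          where open ≡-Reasoning
        -- `rhsExponent` inspects only indices up to `length m`. Beyond them the exponent in `m` is
        -- 0, which differs from ℓ, so both sides vanish.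
        ... | no a≮ = trans (trans (cong (ιℕ (deg m) *_) (trans (rhsExponent-term m) (∑-≡0 (upTo (length m)) (λ {j′} j∈ →
                off-j j′ (λ { refl → a≮ (∈-upTo⁻ j∈) }))))) (ℚ.*-zeroʳ (ιℕ (deg m))))
              (sym (trans (cong (½ *_) (∑-≡0 signs (λ {θ} _ → trans (cong (λ n → ⟦ n ≡ᵇ ℓ ⟧ * ι (srootsZ2 (suc b) θ)) (expo-outside m a θ (ℕ.≮⇒≥ a≮)))
                (ℚ.*-zeroˡ (ι (srootsZ2 (suc b) θ)))))) (ℚ.*-zeroʳ ½)))

    srootsZ2-∑ : ∀ h θ → ι (srootsZ2 h θ) ≡ ∑ signs (λ s → ⟦ not ((s ^Z2 h) xor θ) ⟧ * sgn s)
    srootsZ2-∑ h θ = trans (ι-sumℤ (L.filter (λ s → T? (not ((s ^Z2 h) xor θ))) signs) signℤ) (∑-filter (λ s → not ((s ^Z2 h) xor θ)) signs sgn)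

    -- Sorts the signs `s` by their h-th power. The sum over classes θ weighted by root counts
    -- becomes a sum over the class of a cycle of x, as in the recursion.
    by-root : ∀ h (X : Bool → ℚ) → ∑ signs (λ θ → X θ * ι (srootsZ2 h θ)) ≡ ∑ signs (λ s → sgn s * X (s ^Z2 h))
    by-root h X = begin
      ∑ signs (λ θ → X θ * ι (srootsZ2 h θ))
        ≡⟨ ∑-cong signs (λ θ → trans (cong (X θ *_) (srootsZ2-∑ h θ)) (sym (∑-*ˡ signs (X θ) (λ s → ⟦ not ((s ^Z2 h) xor θ) ⟧ * sgn s)))) ⟩
      ∑ signs (λ θ → ∑ signs (λ s → X θ * (⟦ not ((s ^Z2 h) xor θ) ⟧ * sgn s)))
        ≡⟨ ∑-swap signs signs (λ θ s → X θ * (⟦ not ((s ^Z2 h) xor θ) ⟧ * sgn s)) ⟩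
      ∑ signs (λ s → ∑ signs (λ θ → X θ * (⟦ not ((s ^Z2 h) xor θ) ⟧ * sgn s)))
        ≡⟨ ∑-cong signs (λ s → select (s ^Z2 h) (sgn s)) ⟩
      ∑ signs (λ s → sgn s * X (s ^Z2 h))                                               ∎
      where
      open ≡-Reasoning
      select : ∀ η c → ∑ signs (λ θ → X θ * (⟦ not (η xor θ) ⟧ * c)) ≡ c * X η
      select true c = solve 3 (λ x y c → x :* (con 1ℚ :* c) :+ (y :* (con 0ℚ :* c) :+ con 0ℚ) := c :* x) refl (X true) (X false) c
        where open +-*-Solver
      select false c = solve 3 (λ x y c → x :* (con 0ℚ :* c) :+ (y :* (con 1ℚ :* c) :+ con 0ℚ) := c :* y) refl (X true) (X false) c
        where open +-*-Solver

    -- In degree ℓ the triple sum over j, θ and h collapses, because ℓ determines j and h. The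
    -- result is exactly the coefficient with which a closing cycle of length ℓ enters `newCycle`.
    D-exponent : ∀ m t → deg m ≡ suc t → D (rhsExponent k) m ≡
      ½ * ∑ signs (λ s → sgn s * ⟦ isPower (suc t) (proj₁ (powType k (suc t , s))) (proj₂ (powType k (suc t , s))) m ⟧)
    D-exponent m t deg≡ with quotient (gcd[m,n]∣m (suc t) k) in a≡ | quotient (gcd[m,n]∣n (suc t) k) in b≡
    ... | zero | _ = ⊥-elim (ℕ.<-irrefl (sym (trans (_∣_.equality (gcd[m,n]∣m (suc t) k)) (cong (ℕ._* gcd (suc t) k) a≡))) (s≤s z≤n))
    ... | suc a | zero = ⊥-elim (ℕ.<-irrefl (sym (trans (_∣_.equality (gcd[m,n]∣n (suc t) k)) (cong (ℕ._* gcd (suc t) k) b≡))) 1≤k)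
    ... | suc a | suc b = trans (D-by-sign m t deg≡ a b a≡ b≡) (cong (½ *_) (trans (by-root (suc b) (λ θ → ⟦ expo m (suc a) θ ≡ᵇ suc t ⟧))
      (∑-cong signs (λ s → cong (λ c → sgn s * ⟦ c ⟧) (sym (trans (cong ((expo m (suc a) (s ^Z2 suc b) ≡ᵇ suc t) ∧_) (T⇒≡ (ℕ.≡⇒≡ᵇ _ _ deg≡))) (∧-true _)))))))
      where
      ∧-true : ∀ c → c ∧ true ≡ c
      ∧-true true = refl
      ∧-true false = refl

-- Comparison of the coefficients on both sides.

module Coefficients where

  open CycleTypes
  open Insertion
  open CycleStatistics
  open Conjugacy using (SameStat)
  open Summation
  open SignedAverages
  open ClassEquation
  open PowerSeries
  open Powers
  open Exponents
  open import Data.Bool using (Bool; true; false; _∧_; not; _xor_; if_then_else_; T)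
  open import Data.Bool.Properties using (T-∧)
  open import Data.Empty using (⊥-elim)
  open import Data.Nat as ℕ using (ℕ; zero; suc; _≤_; _<_; z≤n; s≤s; _≡ᵇ_)
  import Data.Nat.Properties as ℕ
  open import Data.Nat.Induction using (<-rec)
  open import Data.Nat.Divisibility using (_∣_; quotient; divides; ∣⇒≤; module _∣_)
  open import Data.Nat.GCD using (gcd; gcd[m,n]∣m)
  open import Data.Rational as ℚ using (ℚ; 0ℚ; 1ℚ; _+_; _*_)
  import Data.Rational.Properties as ℚ
  open import Data.Rational.Solver using (module +-*-Solver)
  open import Data.Fin as Fin using (Fin)
  open import Data.Product using (∃; _×_; _,_; proj₁; proj₂)
  open import Data.Sum using (inj₁; inj₂)
  import Data.Vec as Vec
  open import Data.List using (List; []; _∷_; upTo; applyUpTo; length; map; tabulate; filter)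
  open import Data.List.Properties using (map-applyUpTo; length-map; length-applyUpTo; map-∘)
  open import Function using (_∘_; id; Equivalence)
  open import Relation.Binary.PropositionalEquality
  open import Relation.Nullary
  open import Relation.Nullary.Decidable using (T?)

  open Statistics id using () renaming (stat to stat₁)

  countCyc≡stat : ∀ {n} (w : SVec n) j θ → countCyc w j θ ≡ stat₁ w (j , θ)
  countCyc≡stat w j θ = count id
    where
    p = λ i → (proj₁ (cycleOf w i) ≡ᵇ j) ∧ not (proj₂ (cycleOf w i) xor θ)
    count : ∀ {n} (f : Fin n → Fin _) → length (filter (λ i → T? (p i)) (tabulate f)) ≡ Σℕ.sum (λ i → bit (p (f i)))
    count {zero} f = refl
    count {suc n} f with p (f Fin.zero)
    ... | true = cong suc (count (f ∘ Fin.suc))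
    ... | false = count (f ∘ Fin.suc)

  stat-outside : ∀ {n} {w : SVec n} → Inj w → ∀ j θ → n ≤ j → stat₁ w (suc j , θ) ≡ 0
  stat-outside {n} {w} iw j θ n≤j = trans (Σℕ.sum-cong-≗ (λ i → hit≢ (cycleOf w i) (suc j , θ) (λ eq →
    ℕ.<⇒≱ (s≤s n≤j) (subst (_≤ n) (cong proj₁ eq) (cycleOf-bounded iw i))))) (sum≡0 n)

  stat-zero : ∀ {n} {w : SVec n} → Inj w → ∀ θ → stat₁ w (0 , θ) ≡ 0
  stat-zero {n} {w} iw θ = trans (Σℕ.sum-cong-≗ (λ i → hit≢ (cycleOf w i) (0 , θ) (λ eq →
    ℕ.<⇒≱ (pos (HT-cycleOf iw i)) (ℕ.≤-reflexive (cong proj₁ eq))))) (sum≡0 n)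

  expo-map : ∀ (f : ℕ → ℕ × ℕ) g n j θ → j < n → expo (map f (applyUpTo g n)) (suc j) θ ≡ (if θ then proj₁ (f (g j)) else proj₂ (f (g j)))
  expo-map f g (suc n) zero θ _ = refl
  expo-map f g (suc n) (suc j) θ (s≤s j<n) = expo-map f (g ∘ suc) n j θ j<n

  expo-typeMono : ∀ {n} {w : SVec n} → Inj w → ∀ j θ → expo (typeMono w) (suc j) θ ≡ stat₁ w (suc j , θ)
  expo-typeMono {n} {w} iw j θ with j ℕ.<? n
  ... | no j≮n = trans (expo-outside (typeMono w) j θ (ℕ.≤-trans (ℕ.≤-reflexive (trans (length-map _ (upTo n)) (length-applyUpTo id n))) (ℕ.≮⇒≥ j≮n)))
                       (sym (stat-outside iw j θ (ℕ.≮⇒≥ j≮n)))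
  expo-typeMono {n} {w} iw j true  | yes j<n = trans (expo-map _ id n j true j<n) (countCyc≡stat w (suc j) true)
  expo-typeMono {n} {w} iw j false | yes j<n = trans (expo-map _ id n j false j<n) (countCyc≡stat w (suc j) false)

  sumℕ-cong : ∀ {A : Set} (xs : List A) {f g : A → ℕ} → (∀ x → f x ≡ g x) → sumℕ (map f xs) ≡ sumℕ (map g xs)
  sumℕ-cong [] h = refl
  sumℕ-cong (x ∷ xs) h = cong₂ ℕ._+_ (h x) (sumℕ-cong xs h)

  sumℕ-swap : ∀ {A : Set} {n} (xs : List A) (H : Fin n → A → ℕ) → sumℕ (map (λ j → Σℕ.sum (λ i → H i j)) xs) ≡ Σℕ.sum (λ i → sumℕ (map (H i) xs))
  sumℕ-swap {n = n} [] H = sym (sum≡0 n)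
  sumℕ-swap (x ∷ xs) H = trans (cong (Σℕ.sum (λ i → H i x) ℕ.+_) (sumℕ-swap xs H)) (sym (Σℕ.∑-distrib-+ (λ i → H i x) (λ i → sumℕ (map (H i) xs))))

  sumℕ-zero : ∀ (f : ℕ → ℕ) n → (∀ i → f i ≡ 0) → ∀ g → sumℕ (map f (applyUpTo g n)) ≡ 0
  sumℕ-zero f zero h g = refl
  sumℕ-zero f (suc n) h g = cong₂ ℕ._+_ (h (g 0)) (sumℕ-zero f n h (g ∘ suc))

  sumℕ-single : ∀ (f : ℕ → ℕ) {n} i₀ → i₀ < n → (∀ i → i ≢ i₀ → f i ≡ 0) → sumℕ (map f (upTo n)) ≡ f i₀
  sumℕ-single f {suc n} zero _ h = trans (cong (f 0 ℕ.+_) (trans (cong sumℕ (trans (map-applyUpTo suc f n) (sym (map-applyUpTo id (f ∘ suc) n))))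
    (sumℕ-zero (f ∘ suc) n (λ i → h (suc i) λ ()) id))) (ℕ.+-identityʳ (f 0))
  sumℕ-single f {suc n} (suc i₀) (s≤s i₀<n) h = cong₂ ℕ._+_ (h 0 λ ()) (trans (cong sumℕ (trans (map-applyUpTo suc f n) (sym (map-applyUpTo id (f ∘ suc) n))))
    (sumℕ-single (f ∘ suc) i₀ i₀<n (λ i ne → h (suc i) (ne ∘ ℕ.suc-injective))))

  -- Every point is counted exactly once, since the length of its cycle lies between 1 and n.
  deg-typeMono : ∀ {n} {w : SVec n} → Inj w → deg (typeMono w) ≡ n
  deg-typeMono {n} {w} iw = begin
    sumℕ (map (λ e → proj₁ e ℕ.+ proj₂ e) (map counts (upTo n)))
      ≡⟨ cong sumℕ (sym (map-∘ (upTo n))) ⟩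
    sumℕ (map (λ j → countCyc w (suc j) true ℕ.+ countCyc w (suc j) false) (upTo n))
      ≡⟨ sumℕ-cong (upTo n) (λ j → trans (cong₂ ℕ._+_ (countCyc≡stat w (suc j) true) (countCyc≡stat w (suc j) false))
                                                                                            (sym (Σℕ.∑-distrib-+ (λ i → hit (cycleOf w i) (suc j , true)) (λ i → hit (cycleOf w i) (suc j , false))))) ⟩
    sumℕ (map (λ j → Σℕ.sum (λ i → H i j)) (upTo n))
      ≡⟨ sumℕ-swap (upTo n) H ⟩
    Σℕ.sum (λ i → sumℕ (map (H i) (upTo n)))
      ≡⟨ Σℕ.sum-cong-≗ one ⟩
    Σℕ.sum {n} (λ _ → 1)
      ≡⟨ ones n ⟩
    n                                                                                  ∎
    where
    open ≡-Reasoning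
    counts = λ j → countCyc w (suc j) true , countCyc w (suc j) false
    H : Fin n → ℕ → ℕ
    H i j = hit (cycleOf w i) (suc j , true) ℕ.+ hit (cycleOf w i) (suc j , false)
    ones : ∀ n → Σℕ.sum {n} (λ _ → 1) ≡ n
    ones zero = refl
    ones (suc n) = cong suc (ones n)
    two : ∀ τ j₀ → proj₁ τ ≡ suc j₀ → hit τ (suc j₀ , true) ℕ.+ hit τ (suc j₀ , false) ≡ 1
    two (.(suc j₀) , true) j₀ refl rewrite T⇒≡ (ℕ.≡⇒≡ᵇ j₀ j₀ refl) = refl
    two (.(suc j₀) , false) j₀ refl rewrite T⇒≡ (ℕ.≡⇒≡ᵇ j₀ j₀ refl) = refl
    one : ∀ i → sumℕ (map (H i) (upTo n)) ≡ 1
    one i = at (proj₁ (cycleOf w i)) refl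
      where
      at : ∀ j → proj₁ (cycleOf w i) ≡ j → sumℕ (map (H i) (upTo n)) ≡ 1
      at zero eq = ⊥-elim (ℕ.<⇒≱ (pos (HT-cycleOf iw i)) (ℕ.≤-reflexive eq))
      at (suc j₀) eq = trans (sumℕ-single (H i) j₀ (subst (_≤ n) eq (cycleOf-bounded iw i))
        (λ j ne → cong₂ ℕ._+_ (hit≢ (cycleOf w i) (suc j , true) (λ e → ne (ℕ.suc-injective (trans (sym (cong proj₁ e)) eq)))) (hit≢ (cycleOf w i) (suc j , false) (λ e → ne (ℕ.suc-injective (trans (sym (cong proj₁ e)) eq))))))
        (two (cycleOf w i) j₀ eq)

  module Main (k : ℕ) (1≤k : 1 ≤ k) where

    V : Ty → Ty
    V = powType k

    open Recursion V
    open Averages V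
    open Statistics V using (stat)
    open Exponent k 1≤k using (constantFree; D-exponent)

    stat-power : ∀ {n} {x : SVec n} → Inj x → ∀ τ → stat x τ ≡ stat₁ (x ^B k) τ
    stat-power {x = x} ix τ = Σℕ.sum-cong-≗ (λ i → cong (λ σ → hit σ τ) (sym (cycleOf-unique (Inj-^B ix k) (HT-^B k 1≤k (HT-cycleOf ix i)))))

    F G : PS
    F = rhsExponent k
    G = rhsPS k

    -- The index of the variable divides the length r + 1, so a cut-off not below the length
    -- satisfies the bound of `δ-shift`.
    V-index : ∀ r s → ∃ λ j → proj₁ (V (suc r , s)) ≡ suc j × j ≤ r
    V-index r s with quotient (gcd[m,n]∣m (suc r) k) in e
    ... | zero = ⊥-elim (ℕ.<-irrefl (sym (trans (_∣_.equality (gcd[m,n]∣m (suc r) k)) (cong (ℕ._* gcd (suc r) k) e))) (s≤s z≤n))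
    ... | suc j = j , refl , ℕ.≤-pred (∣⇒≤ (divides (gcd (suc r) k) (trans (_∣_.equality (gcd[m,n]∣m (suc r) k)) (trans (cong (ℕ._* gcd (suc r) k) e) (ℕ.*-comm (suc j) (gcd (suc r) k))))))

    power? : ℕ → Bool → Mono → Bool
    power? r s = isPower (suc r) (proj₁ (V (suc r , s))) (proj₂ (V (suc r , s)))

    -- The homogeneous part of D F in degree r + 1, by `D-exponent` and `κ-off`.
    κ : ℕ → Mono → ℚ
    κ r d = ½ * ∑ signs (λ s → sgn s * ⟦ power? r s d ⟧)

    κ-off : ∀ r d → deg d ≢ suc r → κ r d ≡ 0ℚ
    κ-off r d ne = trans (cong (½ *_) (∑-≡0 signs (λ {s} _ → trans (cong (λ b → sgn s * ⟦ b ⟧) (off s)) (ℚ.*-zeroʳ (sgn s))))) (ℚ.*-zeroʳ ½)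
      where
      off : ∀ s → power? r s d ≡ false
      off s = ¬T⇒≡ (λ h → ne (ℕ.≡ᵇ⇒≡ (deg d) (suc r) (proj₂ (Equivalence.to (T-∧ {expo d (proj₁ (V (suc r , s))) (proj₂ (V (suc r , s))) ≡ᵇ suc r}) h))))

    -- The lengths r + 1, ..., r + n, nested as `averageI-suc` produces them: one point fewer, one
    -- phantom more.
    κ-sum : ℕ → ℕ → Mono → ℚ
    κ-sum zero r d = 0ℚ
    κ-sum (suc n) r d = κ r d + κ-sum n (suc r) d

    κ-sum-below : ∀ n r d → deg d ≤ r → κ-sum n r d ≡ 0ℚ
    κ-sum-below zero r d h = refl
    κ-sum-below (suc n) r d h = trans (cong₂ _+_ (κ-off r d (λ eq → ℕ.<⇒≱ (s≤s h) (ℕ.≤-reflexive (sym eq))))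
      (κ-sum-below n (suc r) d (ℕ.m≤n⇒m≤1+n h))) (ℚ.+-identityʳ 0ℚ)

    κ-sum-value : ∀ n r d t → deg d ≡ suc t → r ≤ t → t < r ℕ.+ n → κ-sum n r d ≡ κ t d
    κ-sum-value zero r d t eq r≤t t< = ⊥-elim (ℕ.<⇒≱ t< (subst (_≤ t) (sym (ℕ.+-identityʳ r)) r≤t))
    κ-sum-value (suc n) r d t eq r≤t t< with ℕ.m≤n⇒m<n∨m≡n r≤t
    ... | inj₂ refl = trans (cong (κ r d +_) (κ-sum-below n (suc r) d (ℕ.≤-reflexive eq))) (ℚ.+-identityʳ (κ r d))
    ... | inj₁ r<t = trans (cong₂ _+_ (κ-off r d (λ e → ℕ.<-irrefl (ℕ.suc-injective (trans (sym e) eq)) r<t))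
      (κ-sum-value n (suc r) d t eq r<t (subst (t <_) (ℕ.+-suc r n) t<))) (ℚ.+-identityˡ (κ t d))

    -- `N` is the largest index that `δ` compares. It is kept free, at least the degree, because the
    -- vanishing part must also reach the length of a monomial, which may exceed its degree.
    module _ (N : ℕ) where

      φ : Mono → Functional
      φ m c = ⟦ δ N m c ⟧

      Ext-φ : ∀ m → Ext (φ m)
      Ext-φ m h = cong ⟦_⟧ (δ-ext N m (λ j θ → h (suc j , θ)))

      average-conv : ∀ n m (e : Mono → ℚ) → average n (λ c → conv m (λ d q → e d * φ q c)) ≡ conv m (λ d q → e d * average n (φ q))
      average-conv n m e = begin
        β n * ∑ B (λ x → sgn (sg x) * conv m (λ d q → e d * φ q (stat x)))
          ≡⟨ cong (β n *_) (∑-cong B (λ x → sym (conv-*ˡ m (sgn (sg x)) (λ d q → e d * φ q (stat x))))) ⟩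
        β n * ∑ B (λ x → conv m (λ d q → sgn (sg x) * (e d * φ q (stat x))))
          ≡⟨ cong (β n *_) (sym (conv-∑ m B (λ x d q → sgn (sg x) * (e d * φ q (stat x))))) ⟩
        β n * conv m (λ d q → ∑ B (λ x → sgn (sg x) * (e d * φ q (stat x))))
          ≡⟨ sym (conv-*ˡ m (β n) (λ d q → ∑ B (λ x → sgn (sg x) * (e d * φ q (stat x))))) ⟩
        conv m (λ d q → β n * ∑ B (λ x → sgn (sg x) * (e d * φ q (stat x))))
          ≡⟨ conv-≗ m (λ d q → trans (cong (β n *_) (trans (∑-cong B (λ x → swap (sgn (sg x)) (e d) (φ q (stat x)))) (∑-*ˡ B (e d) (λ x → sgn (sg x) * φ q (stat x)))))
                                                                                       (swap (β n) (e d) (∑ B (λ x → sgn (sg x) * φ q (stat x))))) ⟩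
        conv m (λ d q → e d * average n (φ q))                                     ∎
        where
        open ≡-Reasoning
        B = elemsB n
        swap : ∀ a b c → a * (b * c) ≡ b * (a * c)
        swap = solve 3 (λ a b c → a :* (b :* c) := b :* (a :* c)) refl
          where open +-*-Solver

      newCycle-conv : ∀ n r m → suc r ≤ N → newCycle n (suc r) (φ m) ≡ conv m (λ d q → κ r d * average n (φ q))
      newCycle-conv n r m r<N = begin
        ½ * ∑ signs (λ s → sgn s * average n (shift (suc r) (V (suc r , s)) (φ m)))
          ≡⟨ cong (½ *_) (∑-cong signs (λ s → cong (sgn s *_) (trans (cong (β n *_) (∑-cong (elemsB n) (λ x → cong (sgn (sg x) *_) (shifted s (stat x))))) (average-conv n m (λ d → ⟦ power? r s d ⟧))))) ⟩
        ½ * ∑ signs (λ s → sgn s * conv m (λ d q → ⟦ power? r s d ⟧ * average n (φ q)))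
          ≡⟨ cong (½ *_) (trans (∑-cong signs (λ s → sym (conv-*ˡ m (sgn s) (λ d q → ⟦ power? r s d ⟧ * average n (φ q))))) (sym (conv-∑ m signs (λ s d q → sgn s * (⟦ power? r s d ⟧ * average n (φ q)))))) ⟩
        ½ * conv m (λ d q → ∑ signs (λ s → sgn s * (⟦ power? r s d ⟧ * average n (φ q))))
          ≡⟨ sym (conv-*ˡ m ½ (λ d q → ∑ signs (λ s → sgn s * (⟦ power? r s d ⟧ * average n (φ q))))) ⟩
        conv m (λ d q → ½ * ∑ signs (λ s → sgn s * (⟦ power? r s d ⟧ * average n (φ q))))
          ≡⟨ conv-≗ m (λ d q → trans (cong (½ *_) (trans (∑-cong signs (λ s → sym (ℚ.*-assoc (sgn s) ⟦ power? r s d ⟧ (average n (φ q))))) (∑-*ʳ signs (average n (φ q)) (λ s → sgn s * ⟦ power? r s d ⟧))))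
               (sym (ℚ.*-assoc ½ (∑ signs (λ s → sgn s * ⟦ power? r s d ⟧)) (average n (φ q))))) ⟩
        conv m (λ d q → κ r d * average n (φ q))
          ∎
        where
        open ≡-Reasoning
        shifted : ∀ s c → φ m (c ⊕[ suc r ] V (suc r , s)) ≡ conv m (λ d q → ⟦ power? r s d ⟧ * φ q c)
        shifted s c with V-index r s
        ... | j , eq , j≤r = subst (λ i → ⟦ δ N m (c ⊕[ suc r ] (i , η)) ⟧ ≡ conv m (λ d q → ⟦ isPower (suc r) i η d ⟧ * ⟦ δ N q c ⟧)) (sym eq)
                               (δ-shift N m j η (suc r) c (ℕ.≤-trans (s≤s j≤r) r<N))
          where η = proj₂ (V (suc r , s))

      Solved : ℕ → Set
      Solved n = ∀ m → deg m ≡ n → n ≤ N → average n (φ m) ≡ G m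

      -- The invariant is that points and phantoms together make up the degree of `m`. In the
      -- summand for a closing cycle, κ forces deg d to be its full length, so that q has exactly as
      -- many degrees as there are points left and the induction hypothesis applies. On no points
      -- there is no mark and the sum is empty.
      averageI-conv : ∀ n r m → (∀ {n′} → n′ < n → Solved n′) → n ℕ.+ r ≡ deg m → deg m ≤ N →
        averageI n r (φ m) ≡ conv m (λ d q → κ-sum n r d * G q)
      averageI-conv zero r m ih eq m≤N = sym (conv-0 m (λ d q _ → ℚ.*-zeroˡ (G q)))
      averageI-conv (suc n) r m ih eq m≤N = begin
        averageI (suc n) r (φ m)
          ≡⟨ averageI-suc n r (Ext-φ m) ⟩
        newCycle n (suc r) (φ m) + averageI n (suc r) (φ m)
          ≡⟨ cong₂ _+_ (newCycle-conv n r m (ℕ.≤-trans (ℕ.≤-trans (s≤s (ℕ.m≤n+m r n)) (ℕ.≤-reflexive eq)) m≤N))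
                                                                                                       (averageI-conv n (suc r) m (λ n′<n → ih (ℕ.m≤n⇒m≤1+n n′<n)) (trans (ℕ.+-suc n r) eq) m≤N) ⟩
        conv m (λ d q → κ r d * average n (φ q)) + conv m (λ d q → κ-sum n (suc r) d * G q)
          ≡⟨ cong (_+ conv m (λ d q → κ-sum n (suc r) d * G q)) (conv-cong m known) ⟩
        conv m (λ d q → κ r d * G q) + conv m (λ d q → κ-sum n (suc r) d * G q)
          ≡⟨ sym (conv-+ m (λ d q → κ r d * G q) (λ d q → κ-sum n (suc r) d * G q)) ⟩
        conv m (λ d q → κ r d * G q + κ-sum n (suc r) d * G q)
          ≡⟨ conv-≗ m (λ d q → sym (ℚ.*-distribʳ-+ (G q) (κ r d) (κ-sum n (suc r) d))) ⟩
        conv m (λ d q → κ-sum (suc n) r d * G q)                                                  ∎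
        where
        open ≡-Reasoning
        known : ∀ d q → deg d ℕ.+ deg q ≡ deg m → κ r d * average n (φ q) ≡ κ r d * G q
        known d q dq with deg d ℕ.≟ suc r
        ... | no ne = trans (cong (_* average n (φ q)) (κ-off r d ne)) (trans (ℚ.*-zeroˡ (average n (φ q))) (sym (trans (cong (_* G q) (κ-off r d ne)) (ℚ.*-zeroˡ (G q)))))
        ... | yes d≡ = cong (κ r d *_) (ih ℕ.≤-refl q q≡ (ℕ.≤-trans (ℕ.≤-trans (ℕ.m≤n⇒m≤1+n (ℕ.m≤m+n n r)) (ℕ.≤-reflexive eq)) m≤N))
          where
          q≡ : deg q ≡ n
          q≡ = ℕ.+-cancelˡ-≡ (suc r) (deg q) n (trans (trans (cong (ℕ._+ deg q) (sym d≡)) dq) (trans (sym eq) (cong suc (ℕ.+-comm n r))))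

      solved : ∀ n → Solved n
      solved = <-rec Solved step
        where
        step : ∀ n → (∀ {n′} → n′ < n → Solved n′) → Solved n
        step zero ih m m0 _ = trans base (sym constant)
          where
          open ≡-Reasoning
          base : average 0 (φ m) ≡ 1ℚ
          base = cong (λ b → 1ℚ * (1ℚ * ⟦ b ⟧ + 0ℚ)) (T⇒≡ (≡⇒δ N m {c = stat Vec.[]} (λ j θ _ → sym (ℕ.n≤0⇒n≡0 (ℕ.≤-trans (expo≤deg m (suc j) θ) (ℕ.≤-reflexive m0))))))
          constant : G m ≡ 1ℚ
          constant = begin
            ∑ (upTo (suc (deg m))) (expTerm F m)
              ≡⟨ cong (λ n → ∑ (upTo (suc n)) (expTerm F m)) m0 ⟩
            onePS m * 1ℚ + 0ℚ
              ≡⟨ cong (λ n → (if n ≡ᵇ 0 then 1ℚ else 0ℚ) * 1ℚ + 0ℚ) m0 ⟩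
            1ℚ                                                         ∎
        step (suc n) ih m m≡ n≤N = *-cancelʳ-ιℕ (suc n) (s≤s z≤n) (begin
          average (suc n) (φ m) * ιℕ (suc n)
            ≡⟨ ℚ.*-comm (average (suc n) (φ m)) (ιℕ (suc n)) ⟩
          ιℕ (suc n) * average (suc n) (φ m)
            ≡⟨ sym (averageI-0 (suc n) (Ext-φ m)) ⟩
          averageI (suc n) 0 (φ m)
            ≡⟨ averageI-conv (suc n) 0 m ih (trans (ℕ.+-identityʳ (suc n)) (sym m≡)) (ℕ.≤-trans (ℕ.≤-reflexive m≡) n≤N) ⟩
          conv m (λ d q → κ-sum (suc n) 0 d * G q)
            ≡⟨ conv-cong m (λ d q eq → cong (_* G q) (derivative d (ℕ.≤-trans (ℕ.m≤m+n (deg d) (deg q)) (ℕ.≤-reflexive (trans eq m≡))))) ⟩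
          (D F ⋆ G) m
            ≡⟨ sym (D-exp constantFree m) ⟩
          D G m
            ≡⟨ cong (λ n → ιℕ n * G m) m≡ ⟩
          ιℕ (suc n) * G m
            ≡⟨ ℚ.*-comm (ιℕ (suc n)) (G m) ⟩
          G m * ιℕ (suc n)                                   ∎)
          where
          open ≡-Reasoning
          derivative : ∀ d → deg d ≤ suc n → κ-sum (suc n) 0 d ≡ D F d
          derivative d d≤ = by-degree (deg d) refl
            where
            by-degree : ∀ t → deg d ≡ t → κ-sum (suc n) 0 d ≡ D F d
            by-degree zero d0 = trans (κ-sum-below (suc n) 0 d (ℕ.≤-reflexive d0)) (sym (trans (cong (λ n → ιℕ n * F d) d0) (ℚ.*-zeroˡ (F d))))
            by-degree (suc t) d≡ = trans (κ-sum-value (suc n) 0 d t d≡ z≤n (subst (_≤ suc n) d≡ d≤)) (sym (D-exponent d t d≡))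

    -- The cut-off n loses nothing, because cycles in B_n have length at most n, both for y and for
    -- xᵏ. A match of monomials therefore decides equality of statistics, as `class-equation`
    -- requires, and β n cancels the order of B_n there.
    coefficient : ∀ {n} {y : SVec n} → Inj y → divℚ (srootsB k y) (centralizerOrder y) ≡ G (typeMono y)
    coefficient {n} {y} iy = divℚ-unique (srootsB k y) (centralizerOrder y) (centralizer-pos {y = y}) (begin
      G m * Z
        ≡⟨ cong (_* Z) (sym (solved n n m (deg-typeMono iy) ℕ.≤-refl)) ⟩
      (β n * S) * Z
        ≡⟨ trans (ℚ.*-assoc (β n) S Z) (cong (β n *_) (ℚ.*-comm S Z)) ⟩
      β n * (Z * S)
        ≡⟨ cong (β n *_) (sym (class-equation k iy (λ x → δ n m (stat x)) δ⇒same same⇒δ)) ⟩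
      β n * (order n * R)
        ≡⟨ sym (ℚ.*-assoc (β n) (order n) R) ⟩
      (β n * order n) * R
        ≡⟨ cong (_* R) (β-order n) ⟩
      1ℚ * R
        ≡⟨ ℚ.*-identityˡ R ⟩
      R                                    ∎)
      where
      open ≡-Reasoning
      m = typeMono y
      Z = ιℕ (centralizerOrder y)
      R = ι (srootsB k y)
      S = ∑ (elemsB n) (λ x → sgn (sg x) * ⟦ δ n m (stat x) ⟧)
      δ⇒same : ∀ {x} → Inj x → T (δ n m (stat x)) → SameStat (x ^B k) y
      δ⇒same {x} ix h (zero , θ) = trans (stat-zero (Inj-^B ix k) θ) (sym (stat-zero iy θ))
      δ⇒same {x} ix h (suc j , θ) with j ℕ.<? n
      ... | yes j<n = trans (sym (stat-power ix (suc j , θ))) (trans (δ⇒≡ n m h j θ j<n) (expo-typeMono iy j θ))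
      ... | no j≮n = trans (stat-outside (Inj-^B ix k) j θ (ℕ.≮⇒≥ j≮n)) (sym (stat-outside iy j θ (ℕ.≮⇒≥ j≮n)))
      same⇒δ : ∀ {x} → Inj x → SameStat (x ^B k) y → T (δ n m (stat x))
      same⇒δ {x} ix same = ≡⇒δ n m (λ j θ _ → trans (stat-power ix (suc j , θ)) (trans (same (suc j , θ)) (sym (expo-typeMono iy j θ))))

    -- If the match succeeded for some x, then xᵏ itself would be an element with monomial `m`.
    -- Adding `length m` to the cut-off makes the match see every variable of `m`: a power of
    -- t_{j,θ} with j beyond the degree would otherwise go unnoticed.
    vanishing : ∀ m → (∀ n (y : SVec n) → InB y → ¬ SameMono (typeMono y) m) → G m ≡ 0ℚ
    vanishing m none = trans (sym (solved N n m refl (ℕ.m≤m+n n (length m))))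
      (trans (cong (β n *_) (∑-≡0 (elemsB n) (λ {x} x∈ → trans (cong (λ b → sgn (sg x) * ⟦ b ⟧) (¬T⇒≡ (unmatched (∈-elemsB⁻ x∈)))) (ℚ.*-zeroʳ (sgn (sg x)))))) (ℚ.*-zeroʳ (β n)))
      where
      n = deg m
      N = n ℕ.+ length m
      expo-0 : ∀ m θ → expo m 0 θ ≡ 0
      expo-0 [] θ = refl
      expo-0 (_ ∷ m) θ = refl
      unmatched : ∀ {x} → Inj x → ¬ T (δ N m (stat x))
      unmatched {x} ix h = none n (x ^B k) (Inj⇒InB {w = x ^B k} (Inj-^B ix k)) same
        where
        same : SameMono (typeMono (x ^B k)) m
        same zero θ = trans (expo-0 (typeMono (x ^B k)) θ) (sym (expo-0 m θ))
        same (suc j) θ with j ℕ.<? N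
        ... | yes j<N = trans (expo-typeMono (Inj-^B ix k) j θ) (trans (sym (stat-power ix (suc j , θ))) (δ⇒≡ N m h j θ j<N))
        ... | no j≮N = trans (expo-typeMono (Inj-^B ix k) j θ) (trans (stat-outside (Inj-^B ix k) j θ (ℕ.≤-trans (ℕ.m≤m+n n (length m)) (ℕ.≮⇒≥ j≮N)))
                         (sym (expo-outside m j θ (ℕ.≤-trans (ℕ.m≤n+m (length m) n) (ℕ.≮⇒≥ j≮N)))))

open CycleTypes using (InB⇒Inj)
open import Data.Product using (_,_)

theorem6p7 : (k : ℕ) → 1 ≤ k →
    ((n : ℕ) (y : SVec n) → InB y →
    divℚ (srootsB k y) (centralizerOrder y) ≡ rhsPS k (typeMono y))
    × ((m : Mono) → ((n : ℕ) (y : SVec n) → InB y → ¬ SameMono (typeMono y) m) →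
    rhsPS k m ≡ 0ℚ)
theorem6p7 k 1≤k = (λ n y y∈B → coefficient (InB⇒Inj {w = y} y∈B)) , vanishing
  where open Coefficients.Main k 1≤k
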